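{- For $n,k\ge 1$, the number of reduced permutations of genus $1$ in $S_n$ with $k$ cycles is $$r_*(n,k)=\binom{n+2}{2k+2}\binom{k+1}{3}+\binom{n+1}{2k+2}\binom{k+1}{2}.$$ More precisely, for $j=0,1,2$ the number $r_j(n,k)$ of reduced permutations of genus $1$ in $S_n$ with exactly $j$ back points and $k$ cycles is $$r_0(n,k)=\binom{n}{2k}\binom{k+1}{3},\quad r_2(n,k)=\binom{n}{2k+2}\binom{k+2}{3},\quad r_1(n,k)=\binom{n}{2k+1}\left(\binom{k+2}{3}+\binom{k+1}{3}\right).$$
   Context: Permutations are composed right to left; $\zeta_n=(1,\dots,n)$; $z(\pi)$ is the number of cycles; the genus of $\alpha\in S_n$ is defined by $n+1-2g(\alpha)=z(\alpha)+z(\alpha^{ -1}\zeta_n)$. An element $i$ is a back point of $\alpha$ if $\alpha(i)<i$ and $\alpha(i)$ is not the smallest element of its cycle. A trivial cycle is a cycle $(i,i+1,\dots,i+p)$ with entries modulo $n$ (fixed points included); $\alpha$ is reduced if it has no trivial cycle. Binomial coefficients $\binom{m}{r}$ vanish for $r>m$. -}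

module Defs where

open import Data.Nat using (ℕ; zero; suc; _+_; _*_; _∸_; NonZero)
open import Data.Nat.DivMod using (_mod_)
open import Data.Fin as F using (Fin; toℕ)
open import Data.Fin.Properties using (any?; all?)
open import Data.Vec using (Vec; []; _∷_; lookup)
open import Data.List using (List; [_]; concatMap; map; allFin; filter; length)
open import Data.Product using (Σ; ∃; _×_; _,_)
open import Relation.Nullary using (¬_; Dec; yes; no)
open import Relation.Nullary.Decidable using (_×-dec_; _→-dec_; ¬?)
open import Relation.Binary.PropositionalEquality using (_≡_)
import Data.Nat.Properties as ℕP

-- Conventions.  The ground set {1,…,n} is represented by Fin n = {0,…,n-1}
-- (shift by one; this preserves the order, hence back points and cycle
-- minima).  An element of S_n is represented by a function Fin n → Fin n
-- which is a bijection (IsPerm).  Composition is ordinary function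
-- composition (right to left).

Fun : ℕ → Set
Fun n = Fin n → Fin n

IsPerm : ∀ {n} → Fun n → Set
IsPerm {n} f = (i j : Fin n) → f i ≡ f j → i ≡ j

isPerm? : ∀ {n} (f : Fun n) → Dec (IsPerm f)
isPerm? f = all? λ i → all? λ j → (f i F.≟ f j) →-dec (i F.≟ j)

shift : ∀ {n} → Fin n → ℕ → Fin n
shift {suc n} i m = (toℕ i + m) mod (suc n)

ζ : ∀ {n} → Fun n
ζ i = shift i 1

inv : ∀ {n} → Fun n → Fun n
inv f y with any? (λ x → f x F.≟ y)
... | yes (x , _) = x
... | no _ = y

iter : ∀ {n} → Fun n → ℕ → Fin n → Fin n
iter f zero x = x
iter f (suc m) x = f (iter f m x)

-- i is the smallest element of its cycle (the cycle of i is
-- {f^m(i) : 0 ≤ m < n})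
CycleMin : ∀ {n} → Fun n → Fin n → Set
CycleMin {n} f i = (m : Fin n) → i F.≤ iter f (toℕ m) i

cycleMin? : ∀ {n} (f : Fun n) (i : Fin n) → Dec (CycleMin f i)
cycleMin? f i = all? λ m → i F.≤? iter f (toℕ m) i

-- z(f): the number of cycles = number of cycles' minima
z : ∀ {n} → Fun n → ℕ
z {n} f = length (filter (cycleMin? f) (allFin n))

HasGenus : ∀ {n} → Fun n → ℕ → Set
HasGenus {n} α g = z α + z (λ x → inv α (ζ x)) + 2 * g ≡ n + 1

BackPoint : ∀ {n} → Fun n → Fin n → Set
BackPoint α i = (α i F.< i) × ¬ CycleMin α (α i)

backPoint? : ∀ {n} (α : Fun n) (i : Fin n) → Dec (BackPoint α i)
backPoint? α i = (α i F.<? i) ×-dec ¬? (cycleMin? α (α i))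

numBack : ∀ {n} → Fun n → ℕ
numBack {n} α = length (filter (backPoint? α) (allFin n))

-- α has a trivial cycle (i, i+1, …, i+p) (entries mod n, 0 ≤ p < n;
-- p = 0 gives fixed points)
HasTrivialCycle : ∀ {n} → Fun n → Set
HasTrivialCycle {n} α =
  Σ (Fin n) λ i → Σ (Fin n) λ p →
    ((j : Fin (toℕ p)) → α (shift i (toℕ j)) ≡ shift i (suc (toℕ j)))
    × α (shift i (toℕ p)) ≡ i

hasTrivialCycle? : ∀ {n} (α : Fun n) → Dec (HasTrivialCycle α)
hasTrivialCycle? α = any? λ i → any? λ p →
  all? (λ j → α (shift i (toℕ j)) F.≟ shift i (suc (toℕ j)))
  ×-dec (α (shift i (toℕ p)) F.≟ i)

Reduced : ∀ {n} → Fun n → Set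
Reduced α = ¬ HasTrivialCycle α

reduced? : ∀ {n} (α : Fun n) → Dec (Reduced α)
reduced? α = ¬? (hasTrivialCycle? α)

hasGenus? : ∀ {n} (α : Fun n) (g : ℕ) → Dec (HasGenus α g)
hasGenus? α g = _ ℕP.≟ _

allVecs : (m n : ℕ) → List (Vec (Fin m) n)
allVecs m zero = [ [] ]
allVecs m (suc n) = concatMap (λ x → map (x ∷_) (allVecs m n)) (allFin m)

countPerms : (n : ℕ) (P : Fun n → Set) → ((α : Fun n) → Dec (P α)) → ℕ
countPerms n P P? =
  length (filter (λ v → isPerm? (lookup v) ×-dec P? (lookup v)) (allVecs n n))

RedG1 : ∀ {n} → ℕ → Fun n → Set
RedG1 k α = Reduced α × HasGenus α 1 × z α ≡ k

redG1? : ∀ {n} (k : ℕ) (α : Fun n) → Dec (RedG1 k α)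
redG1? k α = reduced? α ×-dec hasGenus? α 1 ×-dec (z α ℕP.≟ k)

rStar : ℕ → ℕ → ℕ
rStar n k = countPerms n (RedG1 k) (redG1? k)

rj : ℕ → ℕ → ℕ → ℕ
rj j n k = countPerms n (λ α → RedG1 k α × numBack α ≡ j)
                        (λ α → redG1? k α ×-dec (numBack α ℕP.≟ j))

{-# OPTIONS --safe #-}
module Submission where

-- Write α = ζ ∘ γ.  The points moved by γ form a set S of some size m, and on S the pair (α, γ) induces a pair
-- (α′, γ′) on m points with the same cycle structure; α is reduced exactly when α′ and γ′ have no fixed points, so
-- r_j(n,k) is a binomial coefficient C(n,m) times the number of such fixed-point-free pairs.  Genus one says that
-- the cycles of α′ and γ′ exceed length 2 by 2 in total, whence m = 2k + j, where j counts the back points.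
-- For j = 0 the permutation α′, and for j = 2 the permutation γ′, is a fixed-point-free involution M; for j = 1 the
-- sides of the polygon with 2m sides, glued along γ′, give such an M.  In each case φ = M ∘ ζ has only 2-cycles apart
-- from one 4-cycle or two 3-cycles, i.e. consecutive chords of M are parallel except at four or six cuts.  The
-- blocks between the cuts must be matched antipodally, so M is determined by t₁ < t₂ ≤ t₃ < N, the cuts in the
-- first half of the circle; for j = 1 these alternate in parity.  Counting triples gives the binomial coefficients.

-- For φ = M ∘ ζ the equation φ (φ x) = x says M x = M (x + 1) + 1 on the circle, so a 2-cycle of φ
-- is a pair of parallel consecutive chords, and every failure of parallelism sits on a longer
-- cycle. All cycle counting goes through one number, the excess of a fixed-point-free permutation:
-- the sum of ℓ - 2 over its cycle lengths ℓ. Back points never outnumber the excess, and for α′ and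
-- the inverse of γ′ together both numbers add up to 2, so they agree separately. An excess of 2
-- leaves room for at most six points on longer cycles. This turns the possible patterns of blocks
-- into a finite check, and only the lengths of the blocks remain as parameters. The weak inequality
-- t₂ ≤ t₃ makes four cuts the degenerate case of six, so that both are counted at once by a single
-- binomial coefficient. For j = 1 neither α′ nor γ′ is an involution. Doubling the number of points
-- produces one, at the price of a parity condition: chords must join even to odd sides.

open import Defs
import Algebra.Properties.CommutativeMonoid.Sum as Sum
open import Data.Bool.Base using (Bool; true; false; T; _∧_; _∨_; if_then_else_)
open import Data.Empty using (⊥; ⊥-elim)
open import Data.Fin as F using (Fin; zero; suc; toℕ; fromℕ<)
open import Data.Fin.Properties as FP using (any?; all?; toℕ-injective; toℕ<n; toℕ-fromℕ<)
open import Data.Fin.Patterns using (0F; 1F; 2F; 3F; 4F; 5F)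
open import Data.Integer.Base as ℤ using (ℤ; -[1+_])
open import Data.List.Base as List using (List; []; _∷_; _++_; length; filter; allFin; map; concatMap; cartesianProduct)
open import Data.List.Membership.Propositional using (_∈_)
import Data.List.Membership.Propositional.Properties as ∈P
open import Data.List.Relation.Unary.All as All using (All; []; _∷_)
import Data.List.Relation.Unary.All.Properties as AllP
open import Data.List.Relation.Unary.Any as Any using (Any; here; there)
open import Data.List.Relation.Unary.Unique.Propositional using (Unique)
open import Data.List.Relation.Unary.AllPairs using ([]; _∷_)
import Data.List.Relation.Unary.Unique.Propositional.Properties as UP
import Data.List.Properties as LP
open import Data.Nat
open import Data.Nat.Combinatorics using (_C_)
open import Data.Nat.DivMod using (_mod_)
import Data.Nat.DivMod as DM
open import Data.Nat.Properties as ℕP using (+-comm; ≤-trans; ≤-reflexive; ≤-antisym; <⇒≤; <-irrefl; ≤⇒≯; +-identityʳ; ≮⇒≥;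
  ≤-refl; suc-injective; <⇒≱; <-≤-trans; <-trans; ≤-pred; +-suc; +-assoc; m≤m+n; ≤-<-trans; m≤n⇒m<n∨m≡n; ≰⇒>)
import Data.Nat.Combinatorics as CP
open import Data.Product using (∃; _×_; _,_; proj₁; proj₂; map₂)
open import Data.Sum.Base using (_⊎_; inj₁; inj₂)
open import Data.Unit.Base using (tt)
open import Data.Vec.Base as Vec using (Vec; []; _∷_; lookup; tabulate; zipWith; replicate)
import Data.Vec.Properties as VP
open import Data.Vec.N-ary using (N-ary; _$ⁿ_)
open import Function.Base using (_∘_; id)
open import Relation.Binary.Definitions using (tri<; tri≈; tri>)
open import Relation.Binary.PropositionalEquality
open import Relation.Nullary using (¬_; Dec; yes; no)
open import Relation.Nullary.Decidable using (_×-dec_; _→-dec_; ¬?; True; toWitness)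
open Sum ℕP.+-0-commutativeMonoid using (sum; sum-cong-≗; ∑-distrib-+)
open import Data.Nat.Solver using (module +-*-Solver)

-- Linear arithmetic

infixl 8 _:+_
infixr 9 _:*_
infix 7 _:≤_ _:<_ _:≡_
infixr 6 _:∧_

data Term (n : ℕ) : Set where
  var  : Fin n → Term n
  con  : ℕ → Term n
  _:+_ : Term n → Term n → Term n
  _:*_ : ℕ → Term n → Term n

data Atom (n : ℕ) : Set where
  _:≤_ _:<_ _:≡_ : Term n → Term n → Atom n
  :⊥ : Atom n
  _:∧_ : Atom n → Atom n → Atom n

⟦_⟧ : ∀ {n} → Term n → Vec ℕ n → ℕ
⟦ var i ⟧ ρ = lookup ρ i
⟦ con k ⟧ ρ = k
⟦ s :+ t ⟧ ρ = ⟦ s ⟧ ρ + ⟦ t ⟧ ρ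
⟦ k :* t ⟧ ρ = k * ⟦ t ⟧ ρ

Holds : ∀ {n} → Vec ℕ n → Atom n → Set
Holds ρ (s :≤ t) = ⟦ s ⟧ ρ ≤ ⟦ t ⟧ ρ
Holds ρ (s :< t) = ⟦ s ⟧ ρ < ⟦ t ⟧ ρ
Holds ρ (s :≡ t) = ⟦ s ⟧ ρ ≡ ⟦ t ⟧ ρ
Holds ρ :⊥ = ⊥
Holds ρ (g :∧ h) = Holds ρ g × Holds ρ h

-- The constant term is the first entry, treated as the coefficient of an extra unknown with value
-- 1.
Lin : ℕ → Set
Lin n = Vec ℕ (suc n)

dot : ∀ {n} → Vec ℕ n → Vec ℕ n → ℕ
dot [] [] = 0
dot (a ∷ as) (x ∷ xs) = a * x + dot as xs

eval : ∀ {n} → Vec ℕ n → Lin n → ℕ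
eval ρ a = dot a (1 ∷ ρ)

unit : ∀ {n} → Fin n → Vec ℕ n
unit zero = 1 ∷ replicate _ 0
unit (suc i) = 0 ∷ unit i

lin : ∀ {n} → Term n → Lin n
lin (var i) = 0 ∷ unit i
lin (con k) = k ∷ replicate _ 0
lin (s :+ t) = zipWith _+_ (lin s) (lin t)
lin (k :* t) = Vec.map (k *_) (lin t)

dot-0 : ∀ {n} (ρ : Vec ℕ n) → dot (replicate n 0) ρ ≡ 0
dot-0 [] = refl
dot-0 (x ∷ ρ) = dot-0 ρ

dot-unit : ∀ {n} (i : Fin n) ρ → dot (unit i) ρ ≡ lookup ρ i
dot-unit zero (x ∷ ρ) rewrite dot-0 ρ = trans (+-identityʳ _) (ℕP.*-identityˡ x)
dot-unit (suc i) (x ∷ ρ) = dot-unit i ρ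

dot-+ : ∀ {n} (a b ρ : Vec ℕ n) → dot (zipWith _+_ a b) ρ ≡ dot a ρ + dot b ρ
dot-+ [] [] [] = refl
dot-+ (a ∷ as) (b ∷ bs) (x ∷ ρ) = begin
  (a + b) * x + dot (zipWith _+_ as bs) ρ ≡⟨ cong₂ _+_ (ℕP.*-distribʳ-+ x a b) (dot-+ as bs ρ) ⟩
  (a * x + b * x) + (dot as ρ + dot bs ρ) ≡⟨ +-assoc (a * x) _ _ ⟩
  a * x + (b * x + (dot as ρ + dot bs ρ)) ≡⟨ cong (λ w → a * x + w) (swap (b * x) (dot as ρ) (dot bs ρ)) ⟩
  a * x + (dot as ρ + (b * x + dot bs ρ)) ≡⟨ +-assoc (a * x) _ _ ⟨
  (a * x + dot as ρ) + (b * x + dot bs ρ) ∎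
  where
  open ≡-Reasoning
  swap : ∀ p q r → p + (q + r) ≡ q + (p + r)
  swap p q r = trans (sym (+-assoc p q r)) (trans (cong (_+ r) (+-comm p q)) (+-assoc q p r))

dot-* : ∀ {n} k (a ρ : Vec ℕ n) → dot (Vec.map (k *_) a) ρ ≡ k * dot a ρ
dot-* k [] [] = sym (ℕP.*-zeroʳ k)
dot-* k (a ∷ as) (x ∷ ρ) = trans (cong₂ _+_ (ℕP.*-assoc k a x) (dot-* k as ρ)) (sym (ℕP.*-distribˡ-+ k (a * x) (dot as ρ)))

lin-sound : ∀ {n} (t : Term n) ρ → eval ρ (lin t) ≡ ⟦ t ⟧ ρ
lin-sound (var i) ρ = dot-unit i ρ
lin-sound (con k) ρ = trans (cong₂ _+_ (ℕP.*-identityʳ k) (dot-0 ρ)) (+-identityʳ k)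
lin-sound (s :+ t) ρ = trans (dot-+ (lin s) (lin t) (1 ∷ ρ)) (cong₂ _+_ (lin-sound s ρ) (lin-sound t ρ))
lin-sound (k :* t) ρ = trans (dot-* k (lin t) (1 ∷ ρ)) (cong (k *_) (lin-sound t ρ))

-- Terms stay on the side where they were written, so coefficients remain natural numbers and rows
-- can be added without subtraction.
data Row (n : ℕ) : Set where
  leRow eqRow : Lin n → Lin n → Row n

RowHolds : ∀ {n} → Vec ℕ n → Row n → Set
RowHolds ρ (leRow a b) = eval ρ a ≤ eval ρ b
RowHolds ρ (eqRow a b) = eval ρ a ≡ eval ρ b

-- The sum of the rows with the given multipliers; equations may be used backwards.
combine : ∀ {n} → List (Row n) → List ℤ → Lin n × Lin n
combine (leRow a b ∷ rs) (ℤ.+ k ∷ ks) =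
  zipWith _+_ (Vec.map (k *_) a) (proj₁ (combine rs ks)) , zipWith _+_ (Vec.map (k *_) b) (proj₂ (combine rs ks))
combine (leRow a b ∷ rs) (-[1+ k ] ∷ ks) = combine rs ks
combine (eqRow a b ∷ rs) (ℤ.+ k ∷ ks) =
  zipWith _+_ (Vec.map (k *_) a) (proj₁ (combine rs ks)) , zipWith _+_ (Vec.map (k *_) b) (proj₂ (combine rs ks))
combine (eqRow a b ∷ rs) (-[1+ k ] ∷ ks) =
  zipWith _+_ (Vec.map (suc k *_) b) (proj₁ (combine rs ks)) , zipWith _+_ (Vec.map (suc k *_) a) (proj₂ (combine rs ks))
combine _ _ = replicate _ 0 , replicate _ 0

addScaled : ∀ {n} (ρ : Vec ℕ n) k (a b c d : Lin n) → eval ρ a ≤ eval ρ b → eval ρ c ≤ eval ρ d →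
  eval ρ (zipWith _+_ (Vec.map (k *_) a) c) ≤ eval ρ (zipWith _+_ (Vec.map (k *_) b) d)
addScaled ρ k a b c d p q
  rewrite dot-+ (Vec.map (k *_) a) c (1 ∷ ρ) | dot-+ (Vec.map (k *_) b) d (1 ∷ ρ) | dot-* k a (1 ∷ ρ) | dot-* k b (1 ∷ ρ) =
  ℕP.+-mono-≤ (ℕP.*-monoʳ-≤ k p) q

combine-sound : ∀ {n} (ρ : Vec ℕ n) rs ks → All (RowHolds ρ) rs →
  eval ρ (proj₁ (combine rs ks)) ≤ eval ρ (proj₂ (combine rs ks))
combine-sound ρ [] ks ps = ≤-refl
combine-sound ρ (leRow a b ∷ rs) [] ps = ≤-refl
combine-sound ρ (eqRow a b ∷ rs) [] ps = ≤-refl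
combine-sound ρ (leRow a b ∷ rs) (ℤ.+ k ∷ ks) (p ∷ ps) = addScaled ρ k a b _ _ p (combine-sound ρ rs ks ps)
combine-sound ρ (leRow a b ∷ rs) (-[1+ k ] ∷ ks) (p ∷ ps) = combine-sound ρ rs ks ps
combine-sound ρ (eqRow a b ∷ rs) (ℤ.+ k ∷ ks) (p ∷ ps) = addScaled ρ k a b _ _ (≤-reflexive p) (combine-sound ρ rs ks ps)
combine-sound ρ (eqRow a b ∷ rs) (-[1+ k ] ∷ ks) (p ∷ ps) =
  addScaled ρ (suc k) b a _ _ (≤-reflexive (sym p)) (combine-sound ρ rs ks ps)

_⊑ᵇ_ : ∀ {n} → Vec ℕ n → Vec ℕ n → Bool
[] ⊑ᵇ [] = true
(a ∷ as) ⊑ᵇ (b ∷ bs) = (a ≤ᵇ b) ∧ (as ⊑ᵇ bs)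

⊑ᵇ-sound : ∀ {n} (a b ρ : Vec ℕ n) → T (a ⊑ᵇ b) → dot a ρ ≤ dot b ρ
⊑ᵇ-sound [] [] [] _ = z≤n
⊑ᵇ-sound (a ∷ as) (b ∷ bs) (x ∷ ρ) p with a ≤ᵇ b in e
... | true = ℕP.+-mono-≤ (ℕP.*-monoˡ-≤ x (ℕP.≤ᵇ⇒≤ a b (subst T (sym e) tt))) (⊑ᵇ-sound as bs ρ p)

-- A derived inequality `a ≤ b` is absurd as soon as `b + 1` lies below `a` coefficient by
-- coefficient, because the unknowns are natural numbers.
contradictory : ∀ {n} → Lin n × Lin n → Bool
contradictory (a , b ∷ bs) = (suc b ∷ bs) ⊑ᵇ a

contradictory-sound : ∀ {n} (ρ : Vec ℕ n) ab → T (contradictory ab) → eval ρ (proj₁ ab) ≤ eval ρ (proj₂ ab) → ⊥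
contradictory-sound ρ (a , b ∷ bs) c p = <-irrefl refl (≤-trans (⊑ᵇ-sound (suc b ∷ bs) a (1 ∷ ρ) c) p)

-- Fourier–Motzkin search for the multipliers.  Nothing is proved about it: its output is
-- validated by `contradictory`.  A candidate carries its coefficients (right minus left side) and
-- the multipliers that produced it; equations are used for substitution before inequalities are combined.
Cand : Set
Cand = List ℤ × List ℤ

scale : ℤ → List ℤ → List ℤ
scale k = map (k ℤ.*_)

add : List ℤ → List ℤ → List ℤ
add (x ∷ xs) (y ∷ ys) = (x ℤ.+ y) ∷ add xs ys
add [] ys = ys
add xs [] = xs

-- k · c + l · d, without its leading coefficient
join : ℤ → Cand → ℤ → Cand → Cand
join k (c , m) l (d , m′) = List.drop 1 (add (scale k c) (scale l d)) , add (scale k m) (scale l m′)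

tailC : Cand → Cand
tailC (c , m) = List.drop 1 c , m

headC : Cand → ℤ
headC (x ∷ _ , _) = x
headC ([] , _) = ℤ.+ 0

opposite : Cand → Cand
opposite (c , m) = scale (ℤ.- (ℤ.+ 1)) c , scale (ℤ.- (ℤ.+ 1)) m

negative : ℤ → Bool
negative -[1+ _ ] = true
negative (ℤ.+ _) = false

isZero : ℤ → Bool
isZero (ℤ.+ 0) = true
isZero _ = false

useful : Cand → Bool
useful (c , _) = go c
  where
  go : List ℤ → Bool
  go [] = false
  go (x ∷ xs) = negative x ∨ go xs

boolFilter : (Cand → Bool) → List Cand → List Cand
boolFilter p [] = []
boolFilter p (c ∷ cs) = if p c then c ∷ boolFilter p cs else boolFilter p cs

substitute : Cand → Cand → Cand
substitute e c with headC e
... | ℤ.+ k = join (ℤ.+ k) c (ℤ.- headC c) e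
... | -[1+ k ] = join (ℤ.+ suc k) c (headC c) e

splitEq : List Cand → List Cand × List Cand
splitEq [] = [] , []
splitEq (c ∷ cs) with isZero (headC c) | splitEq cs
... | true | zs , ns = c ∷ zs , ns
... | false | zs , ns = zs , c ∷ ns

solved : List Cand → List ℤ
solved [] = []
solved ((c , m) ∷ cs) with c
... | -[1+ _ ] ∷ _ = m
... | _ = solved cs

splitSign : List Cand → List Cand × List Cand × List Cand
splitSign [] = [] , [] , []
splitSign (c ∷ cs) with headC c | splitSign cs
... | ℤ.+ 0 | ps , zs , ns = ps , c ∷ zs , ns
... | ℤ.+ suc _ | ps , zs , ns = c ∷ ps , zs , ns
... | -[1+ _ ] | ps , zs , ns = ps , zs , c ∷ ns

fourierMotzkin : ℕ → List Cand → List Cand → List ℤ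
fourierMotzkin zero eqs les = solved les
fourierMotzkin (suc n) eqs les with splitEq eqs
-- The eliminated unknown is nonnegative, so apart from the substitutions the equation `e` leaves an
-- inequality between the remaining unknowns, oriented by the sign of the leading coefficient.
... | zs , e ∷ es = fourierMotzkin n (map tailC zs ++ map (substitute e) es)
                      (boolFilter useful (map (substitute e) les ++ (if negative (headC e) then tailC e else tailC (opposite e)) ∷ []))
... | zs , [] with splitSign les
-- A candidate with negative leading coefficient remains valid when that term is dropped, again
-- because unknowns are nonnegative. A positive one helps only in combination with a negative one.
... | ps , os , ns = fourierMotzkin n (map tailC zs)
      (boolFilter useful (map tailC os ++ map tailC ns
        ++ concatMap (λ c → map (λ d → join (headC c) d (ℤ.- headC d) c) ns) ps))

-- The constant moves to the end, where it survives the elimination of all unknowns and is read off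
-- by `solved`.
difference : ∀ {n} → Lin n → Lin n → List ℤ
difference (a ∷ as) (b ∷ bs) = Vec.toList (zipWith ℤ._⊖_ bs as) ++ (b ℤ.⊖ a) ∷ []

toCands : ∀ {n} → List (Row n) → List ℤ → List Cand × List Cand
toCands [] _ = [] , []
toCands (r ∷ rs) zs with r | toCands rs (ℤ.+ 0 ∷ zs)
... | leRow a b | es , ls = es , (difference a b , zs ++ ℤ.+ 1 ∷ []) ∷ ls
... | eqRow a b | es , ls = (difference a b , zs ++ ℤ.+ 1 ∷ []) ∷ es , ls

refutation : ∀ {n} → List (Row n) → List ℤ
refutation {n} rs with toCands rs []
... | es , ls = fourierMotzkin n es ls

refuted : ∀ {n} → List (Row n) → Bool
refuted rs = contradictory (combine rs (refutation rs))

refuted-sound : ∀ {n} (ρ : Vec ℕ n) rs → T (refuted rs) → All (RowHolds ρ) rs → ⊥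
refuted-sound ρ rs c ps = contradictory-sound ρ (combine rs (refutation rs)) c (combine-sound ρ rs (refutation rs) ps)

rows : ∀ {n} → Atom n → List (Row n)
rows (s :≤ t) = leRow (lin s) (lin t) ∷ []
rows (s :< t) = leRow (lin (con 1 :+ s)) (lin t) ∷ []
rows (s :≡ t) = eqRow (lin s) (lin t) ∷ []
rows :⊥ = leRow (lin (con 1)) (lin (con 0)) ∷ []
rows (g :∧ h) = rows g ++ rows h

allRows : ∀ {n} → List (Atom n) → List (Row n)
allRows = concatMap rows

rows-sound : ∀ {n} (ρ : Vec ℕ n) h → Holds ρ h → All (RowHolds ρ) (rows h)
rows-sound ρ (s :≤ t) p = subst₂ _≤_ (sym (lin-sound s ρ)) (sym (lin-sound t ρ)) p ∷ []
rows-sound ρ (s :< t) p = subst₂ _≤_ (sym (lin-sound (con 1 :+ s) ρ)) (sym (lin-sound t ρ)) p ∷ []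
rows-sound ρ (s :≡ t) p = trans (lin-sound s ρ) (trans p (sym (lin-sound t ρ))) ∷ []
rows-sound ρ (g :∧ h) (p , q) = AllP.++⁺ (rows-sound ρ g p) (rows-sound ρ h q)

proves : ∀ {n} → List (Atom n) → Atom n → Bool
proves hs (s :≤ t) = refuted (allRows (t :< s ∷ hs))
proves hs (s :< t) = refuted (allRows (t :≤ s ∷ hs))
proves hs (s :≡ t) = proves hs (s :≤ t) ∧ proves hs (t :≤ s)
proves hs :⊥ = refuted (allRows hs)
proves hs (g :∧ h) = proves hs g ∧ proves hs h

allRows-sound : ∀ {n} (ρ : Vec ℕ n) hs → All (Holds ρ) hs → All (RowHolds ρ) (allRows hs)
allRows-sound ρ [] [] = []
allRows-sound ρ (h ∷ hs) (p ∷ ps) = AllP.++⁺ (rows-sound ρ h p) (allRows-sound ρ hs ps)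

T-∧-split : ∀ {a b} → T (a ∧ b) → T a × T b
T-∧-split {true} p = tt , p

proves-≤ : ∀ {n} (ρ : Vec ℕ n) hs s t → T (proves hs (s :≤ t)) → All (Holds ρ) hs → Holds ρ (s :≤ t)
proves-≤ ρ hs s t c ps = ≮⇒≥ λ q → refuted-sound ρ (allRows (t :< s ∷ hs)) c (allRows-sound ρ (t :< s ∷ hs) (q ∷ ps))

proves-sound : ∀ {n} (ρ : Vec ℕ n) hs g → T (proves hs g) → All (Holds ρ) hs → Holds ρ g
proves-sound ρ hs (s :≤ t) c ps = proves-≤ ρ hs s t c ps
proves-sound ρ hs (s :< t) c ps = ≰⇒> λ q → refuted-sound ρ (allRows (t :≤ s ∷ hs)) c (allRows-sound ρ (t :≤ s ∷ hs) (q ∷ ps))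
proves-sound ρ hs (s :≡ t) c ps = ≤-antisym (proves-≤ ρ hs s t (proj₁ (T-∧-split {a = proves hs (s :≤ t)} c)) ps)
  (proves-≤ ρ hs t s (proj₂ (T-∧-split {a = proves hs (s :≤ t)} c)) ps)
proves-sound ρ hs (g :∧ h) c ps = proves-sound ρ hs g (proj₁ (T-∧-split {a = proves hs g} c)) ps ,
  proves-sound ρ hs h (proj₂ (T-∧-split {a = proves hs g} c)) ps
proves-sound ρ hs :⊥ c ps = ⊥-elim (refuted-sound ρ (allRows hs) c (allRows-sound ρ hs ps))

Implication : ∀ {n} → Vec ℕ n → List (Atom n) → Atom n → Set
Implication ρ [] g = Holds ρ g
Implication ρ (h ∷ hs) g = Holds ρ h → Implication ρ hs g

implication : ∀ {n} (ρ : Vec ℕ n) hs g → (All (Holds ρ) hs → Holds ρ g) → Implication ρ hs g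
implication ρ [] g k = k []
implication ρ (h ∷ hs) g k = λ p → implication ρ hs g (λ ps → k (p ∷ ps))

variables : ∀ {n} → Vec (Term n) n
variables = Vec.map var (Vec.allFin _)

-- When the search succeeds, the implicit argument reduces to the unit type and is filled in by
-- evaluation. The hypotheses listed in `f` become ordinary arguments.
lia : ∀ {n} (ρ : Vec ℕ n) (f : N-ary n (Term n) (List (Atom n) × Atom n))
  {_ : T (proves (proj₁ (f $ⁿ variables)) (proj₂ (f $ⁿ variables)))} →
  Implication ρ (proj₁ (f $ⁿ variables)) (proj₂ (f $ⁿ variables))
lia ρ f {c} = implication ρ _ _ (proves-sound ρ _ (proj₂ (f $ⁿ variables)) c)

-- Counting

∈-remove : ∀ {A : Set} {x : A} {ys} → x ∈ ys →
  ∃ λ zs → length ys ≡ suc (length zs) × (∀ {y} → y ∈ ys → y ≢ x → y ∈ zs)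
∈-remove {ys = _ ∷ ys} (here refl) = ys , refl , λ { (here refl) y≢x → ⊥-elim (y≢x refl) ; (there q) _ → q }
∈-remove {ys = w ∷ ys} (there p) with ∈-remove p
... | zs , e , f = w ∷ zs , cong suc e , λ { (here refl) _ → here refl ; (there q) y≢x → there (f q y≢x) }

length-inj : ∀ {A B : Set} {xs : List A} {ys : List B} (h : A → B) → Unique xs → (∀ {x} → x ∈ xs → h x ∈ ys) →
  (∀ {x y} → x ∈ xs → y ∈ xs → h x ≡ h y → x ≡ y) → length xs ≤ length ys
length-inj {xs = []} h u into inj = z≤n
length-inj {xs = x ∷ xs} {ys} h (x≢ ∷ u) into inj with ∈-remove (into (here refl))
... | zs , e , f = subst (suc (length xs) ≤_) (sym e)
  (s≤s (length-inj h u (λ y∈ → f (into (there y∈)) λ eq → All.lookup x≢ y∈ (inj (here refl) (there y∈) (sym eq)))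
        (λ p q → inj (there p) (there q))))

length-cong : ∀ {A : Set} {xs ys : List A} → Unique xs → Unique ys → (∀ {x} → x ∈ xs → x ∈ ys) →
  (∀ {x} → x ∈ ys → x ∈ xs) → length xs ≡ length ys
length-cong u v f g = ≤-antisym (length-inj id u f (λ _ _ e → e)) (length-inj id v g (λ _ _ e → e))

map-unique : ∀ {A B : Set} {xs : List A} (h : A → B) → Unique xs →
  (∀ {x y} → x ∈ xs → y ∈ xs → h x ≡ h y → x ≡ y) → Unique (map h xs)
map-unique {xs = []} h u inj = []
map-unique {xs = x ∷ xs} h (x≢ ∷ u) inj =
  AllP.map⁺ (All.tabulate λ y∈ e → All.lookup x≢ y∈ (inj (here refl) (there y∈) e)) ∷
  map-unique h u (λ p q → inj (there p) (there q))

allVecs-complete : ∀ m {n} (v : Vec (Fin m) n) → v ∈ allVecs m n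
allVecs-complete m [] = here refl
allVecs-complete m (x ∷ v) = ∈P.∈-concatMap⁺ (λ x → map (x ∷_) (allVecs m _))
  (Any.map (λ { refl → ∈P.∈-map⁺ (x ∷_) (allVecs-complete m v) }) (∈P.∈-allFin x))

allVecs-unique : ∀ m n → Unique (allVecs m n)
allVecs-unique m zero = [] ∷ []
allVecs-unique m (suc n) = go (UP.allFin⁺ m)
  where
  go : ∀ {xs} → Unique xs → Unique (concatMap (λ x → map (x ∷_) (allVecs m n)) xs)
  go [] = []
  go {x ∷ xs} (x≢ ∷ u) = UP.++⁺ (UP.map⁺ VP.∷-injectiveʳ (allVecs-unique m n)) (go u) λ { (p , q) → disjoint p q }
    where
    disjoint : ∀ {v} → v ∈ map (x ∷_) (allVecs m n) → v ∈ concatMap (λ x → map (x ∷_) (allVecs m n)) xs → ⊥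
    disjoint p q with ∈P.∈-map⁻ (x ∷_) p
    ... | v , _ , refl = All.lookup x≢
      (Any.map (λ r → VP.∷-injectiveˡ (proj₂ (proj₂ (∈P.∈-map⁻ (_ ∷_) r)))) (∈P.∈-concatMap⁻ (λ x → map (x ∷_) (allVecs m n)) q)) refl

ι : ∀ {A : Set} → Dec A → ℕ
ι (yes _) = 1
ι (no _) = 0

ι-yes : ∀ {A : Set} (d : Dec A) → A → ι d ≡ 1
ι-yes (yes _) _ = refl
ι-yes (no ¬a) a = ⊥-elim (¬a a)

ι-no : ∀ {A : Set} (d : Dec A) → ¬ A → ι d ≡ 0
ι-no (yes a) ¬a = ⊥-elim (¬a a)
ι-no (no _) _ = refl

ι-cong : ∀ {A B : Set} (d : Dec A) (e : Dec B) → (A → B) → (B → A) → ι d ≡ ι e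
ι-cong (yes a) e f g = sym (ι-yes e (f a))
ι-cong (no ¬a) e f g = sym (ι-no e (¬a ∘ g))

count : ∀ {n} {P : Fin n → Set} → (∀ i → Dec (P i)) → ℕ
count P? = sum (λ i → ι (P? i))

length-filter-tabulate : ∀ {n} {A : Set} {P : A → Set} (P? : ∀ a → Dec (P a)) (f : Fin n → A) →
  length (filter P? (List.tabulate f)) ≡ sum (λ i → ι (P? (f i)))
length-filter-tabulate {zero} P? f = refl
length-filter-tabulate {suc n} P? f with P? (f zero)
... | yes _ = cong suc (length-filter-tabulate P? (f ∘ suc))
... | no _ = length-filter-tabulate P? (f ∘ suc)

length-filter : ∀ {n} {P : Fin n → Set} (P? : ∀ i → Dec (P i)) → length (filter P? (allFin n)) ≡ count P?
length-filter P? = length-filter-tabulate P? id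

count-cong : ∀ {n} {P Q : Fin n → Set} (P? : ∀ i → Dec (P i)) (Q? : ∀ i → Dec (Q i)) →
  (∀ i → P i → Q i) → (∀ i → Q i → P i) → count P? ≡ count Q?
count-cong P? Q? f g = sum-cong-≗ λ i → ι-cong (P? i) (Q? i) (f i) (g i)

count-inj : ∀ {m n} {P : Fin m → Set} {Q : Fin n → Set} (P? : ∀ i → Dec (P i)) (Q? : ∀ i → Dec (Q i)) (h : Fin m → Fin n) →
  (∀ i → P i → Q (h i)) → (∀ i j → P i → P j → h i ≡ h j → i ≡ j) → count P? ≤ count Q?
count-inj {m} {n} P? Q? h into inj = subst₂ _≤_ (length-filter P?) (length-filter Q?)
  (length-inj h (UP.filter⁺ P? (UP.allFin⁺ m))
    (λ {x} p → ∈P.∈-filter⁺ Q? (∈P.∈-allFin (h x)) (into x (proj₂ (∈P.∈-filter⁻ P? {xs = allFin m} p))))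
    (λ {x} {y} p q → inj x y (proj₂ (∈P.∈-filter⁻ P? {xs = allFin m} p)) (proj₂ (∈P.∈-filter⁻ P? {xs = allFin m} q))))

sum-mono : ∀ {n} (f g : Fin n → ℕ) → (∀ i → f i ≤ g i) → sum f ≤ sum g
sum-mono {zero} f g p = z≤n
sum-mono {suc n} f g p = ℕP.+-mono-≤ (p zero) (sum-mono (f ∘ suc) (g ∘ suc) (p ∘ suc))

sum-1 : ∀ n → sum {n} (λ _ → 1) ≡ n
sum-1 zero = refl
sum-1 (suc n) = cong suc (sum-1 n)

sum-+ : ∀ {n} (f g : Fin n → ℕ) → sum (λ i → f i + g i) ≡ sum f + sum g
sum-+ {n} f g = ∑-distrib-+ {n} f g

count-none : ∀ {n} {P : Fin n → Set} (P? : ∀ i → Dec (P i)) → (∀ i → ¬ P i) → count P? ≡ 0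
count-none {zero} P? f = refl
count-none {suc n} P? f = cong₂ _+_ (ι-no (P? zero) (f zero)) (count-none (P? ∘ suc) (f ∘ suc))

count-positive : ∀ {n} {P : Fin n → Set} (P? : ∀ i → Dec (P i)) i → P i → 1 ≤ count P?
count-positive P? zero p = ≤-trans (≤-reflexive (sym (ι-yes (P? zero) p))) (m≤m+n _ _)
count-positive P? (suc i) p = ≤-trans (count-positive (P? ∘ suc) i p) (ℕP.m≤n+m _ _)

count-witness : ∀ {n} {P : Fin n → Set} (P? : ∀ i → Dec (P i)) → 1 ≤ count P? → ∃ P
count-witness P? c with any? P?
... | yes w = w
... | no ¬w = ⊥-elim (<-irrefl (sym (count-none P? (λ i p → ¬w (i , p)))) c)

count-≡ : ∀ {n} (y : Fin n) → count (F._≟ y) ≡ 1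
count-≡ y = ≤-antisym
  (subst (count (F._≟ y) ≤_) refl (count-inj {n = 1} (F._≟ y) (λ _ → yes tt) (λ _ → zero) (λ _ _ → tt) (λ { i j refl refl _ → refl })))
  (count-positive (F._≟ y) y refl)

count-≤-sum : ∀ {n} {P : Fin n → Set} (P? : ∀ i → Dec (P i)) (f : Fin n → ℕ) → (∀ i → P i → 1 ≤ f i) → count P? ≤ sum f
count-≤-sum P? f h = sum-mono _ f λ i → bound (P? i) (h i)
  where
  bound : ∀ {A : Set} {k} (d : Dec A) → (A → 1 ≤ k) → ι d ≤ k
  bound (yes a) g = g a
  bound (no _) g = z≤n

-- Cycles

Orbit : ∀ {n} → Fun n → Fin n → Fin n → Set
Orbit f x y = ∃ λ k → iter f k x ≡ y

iter-+ : ∀ {n} (f : Fun n) a b x → iter f (a + b) x ≡ iter f a (iter f b x)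
iter-+ f zero b x = refl
iter-+ f (suc a) b x = cong f (iter-+ f a b x)

iter-comm : ∀ {n} (f : Fun n) k x → iter f k (f x) ≡ f (iter f k x)
iter-comm f zero x = refl
iter-comm f (suc k) x = cong f (iter-comm f k x)

iter-injective : ∀ {n} {f : Fun n} → IsPerm f → ∀ k {x y} → iter f k x ≡ iter f k y → x ≡ y
iter-injective p zero e = e
iter-injective p (suc k) e = iter-injective p k (p _ _ e)

orbit-refl : ∀ {n} {f : Fun n} {x} → Orbit f x x
orbit-refl = 0 , refl

orbit-step : ∀ {n} {f : Fun n} {x} → Orbit f x (f x)
orbit-step = 1 , refl

orbit-trans : ∀ {n} {f : Fun n} {x y w} → Orbit f x y → Orbit f y w → Orbit f x w
orbit-trans {f = f} {x} (a , refl) (b , refl) = b + a , iter-+ f b a x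

module Perm {n} {f : Fun n} (perm : IsPerm f) where

  period : ∀ x → ∃ λ p → p < n × iter f (suc p) x ≡ x
  period x with FP.pigeonhole (ℕP.n<1+n n) (λ j → iter f (toℕ j) x)
  ... | i , j , i<j , e = toℕ j ∸ suc (toℕ i) , bound , iter-injective perm (toℕ i) (sym back)
    where
    split : toℕ i + suc (toℕ j ∸ suc (toℕ i)) ≡ toℕ j
    split = trans (+-suc _ _) (ℕP.m+[n∸m]≡n i<j)
    back : iter f (toℕ i) x ≡ iter f (toℕ i) (iter f (suc (toℕ j ∸ suc (toℕ i))) x)
    back = trans e (trans (cong (λ k → iter f k x) (sym split)) (iter-+ f (toℕ i) _ x))
    bound : toℕ j ∸ suc (toℕ i) < n
    bound = ≤-trans (≤-trans (ℕP.m≤n+m _ (toℕ i)) (≤-reflexive split)) (≤-pred (toℕ<n j))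

  iter-period : ∀ {x p} → iter f p x ≡ x → ∀ k → iter f (k * p) x ≡ x
  iter-period e zero = refl
  iter-period {x} {p} e (suc k) = trans (iter-+ f p (k * p) x) (trans (cong (iter f p) (iter-period {x} {p} e k)) e)

  orbit-sym : ∀ {x y} → Orbit f x y → Orbit f y x
  orbit-sym {x} (k , refl) with period x
  ... | p , _ , e = k * p , trans (sym (iter-+ f (k * p) k x))
        (trans (cong (λ j → iter f j x) (trans (+-comm (k * p) k) (sym (ℕP.*-suc k p)))) (iter-period {x} {suc p} e k))

  -- `CycleMin` inspects only the first n iterates. Nothing is lost: reducing an exponent modulo a
  -- period, which is at most n, reaches the same point.
  orbit-bounded : ∀ {x y} → Orbit f x y → ∃ λ (m : Fin n) → iter f (toℕ m) x ≡ y
  orbit-bounded {x} (k , refl) with period x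
  ... | p , p<n , e = fromℕ< r<n , (begin
    iter f (toℕ (fromℕ< r<n)) x ≡⟨ cong (λ j → iter f j x) (toℕ-fromℕ< r<n) ⟩
    iter f r x ≡⟨ cong (iter f r) (iter-period {x} {suc p} e q) ⟨
    iter f r (iter f (q * suc p) x) ≡⟨ iter-+ f r (q * suc p) x ⟨
    iter f (r + q * suc p) x ≡⟨ cong (λ j → iter f j x) (DM.m≡m%n+[m/n]*n k (suc p)) ⟨
    iter f k x ∎)
    where
    open ≡-Reasoning
    r = k % suc p
    q = k / suc p
    r<n : r < n
    r<n = ≤-trans (DM.m%n<n k (suc p)) p<n

  preimage : ∀ y → ∃ λ x → f x ≡ y
  preimage y with period y
  ... | p , _ , e = iter f p y , e

  -- Opaque, unlike Defs.inv, whose unfolding is costly.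
  abstract
    f⁻¹ : Fun n
    f⁻¹ y = proj₁ (preimage y)

    f-f⁻¹ : ∀ y → f (f⁻¹ y) ≡ y
    f-f⁻¹ y = proj₂ (preimage y)

  f⁻¹-f : ∀ x → f⁻¹ (f x) ≡ x
  f⁻¹-f x = perm _ _ (f-f⁻¹ (f x))

  f⁻¹-perm : IsPerm f⁻¹
  f⁻¹-perm x y e = trans (sym (f-f⁻¹ x)) (trans (cong f e) (f-f⁻¹ y))

  f-inv : ∀ y → f (inv f y) ≡ y
  f-inv y with any? (λ x → f x F.≟ y)
  ... | yes (x , e) = e
  ... | no ¬e = ⊥-elim (¬e (preimage y))

  inv-f : ∀ x → inv f (f x) ≡ x
  inv-f x = perm _ _ (f-inv (f x))

  inv-perm : IsPerm (inv f)
  inv-perm x y e = trans (sym (f-inv x)) (trans (cong f e) (f-inv y))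

  min-least : ∀ {c y} → CycleMin f c → Orbit f c y → c F.≤ y
  min-least c o with orbit-bounded o
  ... | m , refl = c m

  min-unique : ∀ {c d} → CycleMin f c → CycleMin f d → Orbit f c d → c ≡ d
  min-unique c d o = toℕ-injective (≤-antisym (min-least c o) (min-least d (orbit-sym o)))

  min-intro : ∀ {c} → (∀ y → Orbit f c y → c F.≤ y) → CycleMin f c
  min-intro h m = h _ (toℕ m , refl)

  -- Strong induction on the value: a point that is not the minimum has a smaller iterate.
  minOf : ∀ x → ∃ λ c → Orbit f x c × CycleMin f c
  minOf x = go (suc (toℕ x)) x (ℕP.n<1+n _)
    where
    go : ∀ b x → toℕ x < b → ∃ λ c → Orbit f x c × CycleMin f c
    go (suc b) x (s≤s x≤b) with cycleMin? f x
    ... | yes c = x , orbit-refl , c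
    ... | no ¬c with FP.¬∀⟶∃¬ n (λ m → x F.≤ iter f (toℕ m) x) (λ m → x F.≤? iter f (toℕ m) x) ¬c
    ... | m , ¬le with go b (iter f (toℕ m) x) (<-≤-trans (≰⇒> ¬le) x≤b)
    ... | c , o , cm = c , orbit-trans (toℕ m , refl) o , cm

z-count : ∀ {n} (f : Fun n) → z f ≡ count (cycleMin? f)
z-count f = length-filter (cycleMin? f)

count-∘ : ∀ {n} {f : Fun n} → IsPerm f → {P : Fin n → Set} (P? : ∀ i → Dec (P i)) → count (λ i → P? (f i)) ≡ count P?
count-∘ {n} {f} perm {P} P? = ≤-antisym
  (count-inj (λ i → P? (f i)) P? f (λ _ p → p) (λ i j _ _ → perm i j))
  (count-inj P? (λ i → P? (f i)) f⁻¹ (λ i p → subst P (sym (f-f⁻¹ i)) p) (λ i j _ _ → f⁻¹-perm i j))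
  where open Perm perm

-- Each cycle of f is charged to the cycle of g through the image of its minimum.
z-≤ : ∀ {m n} {f : Fun m} {g : Fun n} → IsPerm f → IsPerm g → (h : Fin m → Fin n) →
  (∀ x y → Orbit g (h x) (h y) → Orbit f x y) → z f ≤ z g
z-≤ {f = f} {g} pf pg h reflect = subst₂ _≤_ (sym (z-count f)) (sym (z-count g))
  (count-inj (cycleMin? f) (cycleMin? g) (λ x → proj₁ (G.minOf (h x))) (λ x _ → proj₂ (proj₂ (G.minOf (h x)))) inj)
  where
  module G = Perm pg
  inj : ∀ x y → CycleMin f x → CycleMin f y → proj₁ (G.minOf (h x)) ≡ proj₁ (G.minOf (h y)) → x ≡ y
  inj x y cx cy e = Perm.min-unique pf cx cy (reflect x y
    (orbit-trans (proj₁ (proj₂ (G.minOf (h x)))) (subst (λ c → Orbit g c (h y)) (sym e) (G.orbit-sym (proj₁ (proj₂ (G.minOf (h y))))))))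

iter-inverse : ∀ {n} {f g : Fun n} → (∀ x → f (g x) ≡ x) → ∀ k x → iter f k (iter g k x) ≡ x
iter-inverse e zero x = refl
iter-inverse {f = f} {g} e (suc k) x = trans (sym (iter-comm f k (g (iter g k x)))) (trans (cong (iter f k) (e _)) (iter-inverse e k x))

z-inverse : ∀ {n} {f g : Fun n} → IsPerm f → IsPerm g → (∀ x → f (g x) ≡ x) → (∀ x → g (f x) ≡ x) → z f ≡ z g
z-inverse pf pg e e′ = ≤-antisym
  (z-≤ pf pg id λ { x y (k , refl) → Perm.orbit-sym pf (k , iter-inverse e k x) })
  (z-≤ pg pf id λ { x y (k , refl) → Perm.orbit-sym pg (k , iter-inverse e′ k x) })

iter-cong : ∀ {n} {f g : Fun n} → (∀ x → f x ≡ g x) → ∀ k x → iter f k x ≡ iter g k x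
iter-cong e zero x = refl
iter-cong {f = f} e (suc k) x = trans (cong f (iter-cong e k x)) (e _)

z-cong : ∀ {n} {f g : Fun n} → IsPerm f → IsPerm g → (∀ x → f x ≡ g x) → z f ≡ z g
z-cong pf pg e = ≤-antisym
  (z-≤ pf pg id λ { x y (k , refl) → k , iter-cong e k x })
  (z-≤ pg pf id λ { x y (k , refl) → k , sym (iter-cong e k x) })

z-conjugate : ∀ {n} {f g h : Fun n} → IsPerm f → IsPerm g → IsPerm h → (∀ x → h (f x) ≡ g (h x)) → z f ≡ z g
z-conjugate {f = f} {g} {h} pf pg ph e = ≤-antisym
  (z-≤ pf pg h λ { x y (k , q) → k , ph _ _ (trans (iter-h k x) q) })
  (z-≤ pg pf H.f⁻¹ λ { x y (k , q) → k , trans (cong (iter g k) (sym (H.f-f⁻¹ x))) (trans (sym (iter-h k _)) (trans (cong h q) (H.f-f⁻¹ y))) })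
  where
  module H = Perm ph
  iter-h : ∀ k x → h (iter f k x) ≡ iter g k (h x)
  iter-h zero x = refl
  iter-h (suc k) x = trans (e _) (cong g (iter-h k x))

-- The long cycle ζ

toℕ-mod : ∀ a n .{{_ : NonZero n}} → toℕ (a mod n) ≡ a % n
toℕ-mod a n = toℕ-fromℕ< (DM.m%n<n a n)

ζ-next : ∀ {n} {x : Fin n} → suc (toℕ x) < n → toℕ (ζ x) ≡ suc (toℕ x)
ζ-next {suc n} {x} lt = trans (toℕ-mod (toℕ x + 1) (suc n))
  (trans (cong (_% suc n) (+-comm (toℕ x) 1)) (DM.m<n⇒m%n≡m lt))

ζ-last : ∀ {n} {x : Fin n} → suc (toℕ x) ≡ n → toℕ (ζ x) ≡ 0
ζ-last {suc n} {x} e = trans (toℕ-mod (toℕ x + 1) (suc n))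
  (trans (cong (_% suc n) (trans (+-comm (toℕ x) 1) e)) (DM.n%n≡0 (suc n)))

data ζ-View {n} (x : Fin n) : Set where
  next : suc (toℕ x) < n → toℕ (ζ x) ≡ suc (toℕ x) → ζ-View x
  last : suc (toℕ x) ≡ n → toℕ (ζ x) ≡ 0 → ζ-View x

ζ-view : ∀ {n} (x : Fin n) → ζ-View x
ζ-view {n} x with m≤n⇒m<n∨m≡n (toℕ<n x)
... | inj₁ lt = next lt (ζ-next lt)
... | inj₂ e = last e (ζ-last e)

ζ-perm : ∀ {n} → IsPerm (ζ {n})
ζ-perm x y e with ζ-view x | ζ-view y
... | next _ p | next _ q = toℕ-injective (suc-injective (trans (sym p) (trans (cong toℕ e) q)))
... | next _ p | last _ q = ⊥-elim (ℕP.1+n≢0 (trans (sym p) (trans (cong toℕ e) q)))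
... | last _ p | next _ q = ⊥-elim (ℕP.1+n≢0 (trans (sym q) (trans (cong toℕ (sym e)) p)))
... | last p _ | last q _ = toℕ-injective (suc-injective (trans p (sym q)))

-- Replaces the modular arithmetic in the definition of trivial cycles by steps along ζ, which can
-- be compared with the position of S.
shift-iter : ∀ {n} (i : Fin n) p → shift i p ≡ iter ζ p i
shift-iter {suc n} i zero = toℕ-injective (trans (toℕ-mod (toℕ i + 0) (suc n))
  (trans (cong (_% suc n) (+-identityʳ (toℕ i))) (DM.m<n⇒m%n≡m (toℕ<n i))))
shift-iter {suc n} i (suc p) = trans (toℕ-injective (begin
  toℕ ((toℕ i + suc p) mod suc n)                ≡⟨ toℕ-mod (toℕ i + suc p) (suc n) ⟩
  (toℕ i + suc p) % suc n                     ≡⟨ cong (_% suc n) (trans (+-suc (toℕ i) p) (+-comm 1 _)) ⟩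
  (toℕ i + p + 1) % suc n                     ≡⟨ DM.%-distribˡ-+ (toℕ i + p) 1 (suc n) ⟩
  ((toℕ i + p) % suc n + 1 % suc n) % suc n ≡⟨ cong (λ w → (w + 1 % suc n) % suc n) (DM.m%n%n≡m%n (toℕ i + p) (suc n)) ⟨
  ((toℕ i + p) % suc n % suc n + 1 % suc n) % suc n ≡⟨ DM.%-distribˡ-+ ((toℕ i + p) % suc n) 1 (suc n) ⟨
  ((toℕ i + p) % suc n + 1) % suc n        ≡⟨ cong (λ w → (w + 1) % suc n) (toℕ-mod (toℕ i + p) (suc n)) ⟨
  (toℕ (shift i p) + 1) % suc n               ≡⟨ toℕ-mod (toℕ (shift i p) + 1) (suc n) ⟨
  toℕ (ζ (shift i p))                            ∎)) (cong ζ (shift-iter i p))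
  where open ≡-Reasoning

ζ-transitive : ∀ {n} (x y : Fin n) → Orbit ζ x y
ζ-transitive {suc n} x y = orbit-trans (Perm.orbit-sym ζ-perm (from0 x)) (from0 y)
  where
  steps : ∀ k → k < suc n → toℕ (iter ζ k (zero {n})) ≡ k
  steps zero _ = refl
  steps (suc k) lt = trans (ζ-next (subst (λ w → suc w < suc n) (sym (steps k (<-trans (ℕP.n<1+n k) lt))) lt))
    (cong suc (steps k (<-trans (ℕP.n<1+n k) lt)))
  from0 : ∀ y → Orbit ζ zero y
  from0 y = toℕ y , toℕ-injective (steps (toℕ y) (toℕ<n y))

∘-perm : ∀ {n} {f g : Fun n} → IsPerm f → IsPerm g → IsPerm (λ x → f (g x))
∘-perm pf pg x y e = pg x y (pf _ _ e)

ζ⁻¹ : ∀ {n} → Fun n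
ζ⁻¹ = Perm.f⁻¹ ζ-perm

ζ-ζ⁻¹ : ∀ {n} (x : Fin n) → ζ (ζ⁻¹ x) ≡ x
ζ-ζ⁻¹ = Perm.f-f⁻¹ ζ-perm

ζ⁻¹-ζ : ∀ {n} (x : Fin n) → ζ⁻¹ (ζ x) ≡ x
ζ⁻¹-ζ = Perm.f⁻¹-f ζ-perm

ζ⁻¹-perm : ∀ {n} → IsPerm (ζ⁻¹ {n})
ζ⁻¹-perm = Perm.f⁻¹-perm ζ-perm

-- Back points and the excess of cycle lengths over two

Mid : ∀ {n} → Fun n → Fin n → Set
Mid f x = ¬ CycleMin f x × ¬ CycleMin f (f x)

mid? : ∀ {n} (f : Fun n) x → Dec (Mid f x)
mid? f x = ¬? (cycleMin? f x) ×-dec ¬? (cycleMin? f (f x))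

Long : ∀ {n} → Fun n → Fin n → Set
Long f x = f (f x) ≢ x

long? : ∀ {n} (f : Fun n) x → Dec (Long f x)
long? f x = ¬? (f (f x) F.≟ x)

weakDescents : ∀ {n} → Fun n → ℕ
weakDescents f = count (λ i → f i F.≤? i)

-- A weak descent either lands on a cycle minimum or is a back point; a fixed point is its own
-- minimum. Conversely each minimum is the image of exactly one point, and that point is a weak
-- descent.
numBack+z : ∀ {n} {f : Fun n} → IsPerm f → numBack f + z f ≡ weakDescents f
numBack+z {n} {f} pf = begin
  numBack f + z f ≡⟨ cong₂ _+_ (length-filter (backPoint? f)) (z-count f) ⟩
  count (backPoint? f) + count (cycleMin? f) ≡⟨ cong (count (backPoint? f) +_) (count-∘ pf (cycleMin? f)) ⟨
  count (backPoint? f) + count (λ i → cycleMin? f (f i)) ≡⟨ sum-+ (ι ∘ backPoint? f) (λ i → ι (cycleMin? f (f i))) ⟨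
  sum (λ i → ι (backPoint? f i) + ι (cycleMin? f (f i))) ≡⟨ sum-cong-≗ pointwise ⟩
  weakDescents f ∎
  where
  open ≡-Reasoning
  open Perm pf
  descent : ∀ i → CycleMin f (f i) → f i F.≤ i
  descent i c = min-least c (orbit-sym orbit-step)
  pointwise : ∀ i → ι (backPoint? f i) + ι (cycleMin? f (f i)) ≡ ι (f i F.≤? i)
  pointwise i with cycleMin? f (f i)
  ... | yes c = trans (cong (_+ 1) (ι-no (f i F.<? i ×-dec no (λ ¬c → ¬c c)) (λ b → proj₂ b c))) (sym (ι-yes (f i F.≤? i) (descent i c)))
  ... | no ¬c = trans (+-identityʳ _) (ι-cong (f i F.<? i ×-dec yes ¬c) (f i F.≤? i) (λ b → <⇒≤ (proj₁ b))
      (λ le → ℕP.≤∧≢⇒< le (λ e → ¬c (subst (CycleMin f) (toℕ-injective (sym e)) (fixed-min (toℕ-injective e)))) , ¬c))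
    where
    fixed-min : f i ≡ i → CycleMin f i
    fixed-min e m = ≤-reflexive (cong toℕ (sym (fixed (toℕ m))))
      where
      fixed : ∀ k → iter f k i ≡ i
      fixed zero = refl
      fixed (suc k) = trans (cong f (fixed k)) e

module Derangement {n} {f : Fun n} (pf : IsPerm f) (moves : ∀ x → f x ≢ x) where
  open Perm pf

  min-image : ∀ {x} → CycleMin f x → ¬ CycleMin f (f x)
  min-image c d = moves _ (sym (min-unique c d orbit-step))

  -- A cycle of length ℓ ≥ 2 consists of its minimum, the point sent to the minimum, and ℓ - 2
  -- points satisfying `Mid`. So `count (mid? f)` is the excess.
  size : n ≡ 2 * z f + count (mid? f)
  size = begin
    n ≡⟨ sum-1 n ⟨
    sum (λ (_ : Fin n) → 1) ≡⟨ sum-cong-≗ pointwise ⟩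
    sum (λ i → ι (cycleMin? f i) + ι (cycleMin? f (f i)) + ι (mid? f i))
      ≡⟨ sum-+ (λ i → ι (cycleMin? f i) + ι (cycleMin? f (f i))) (ι ∘ mid? f) ⟩
    sum (λ i → ι (cycleMin? f i) + ι (cycleMin? f (f i))) + count (mid? f)
      ≡⟨ cong (_+ count (mid? f)) (sum-+ (ι ∘ cycleMin? f) (λ i → ι (cycleMin? f (f i)))) ⟩
    count (cycleMin? f) + count (λ i → cycleMin? f (f i)) + count (mid? f)
      ≡⟨ cong (λ w → count (cycleMin? f) + w + count (mid? f)) (trans (count-∘ pf (cycleMin? f)) (sym (+-identityʳ _))) ⟩
    2 * count (cycleMin? f) + count (mid? f) ≡⟨ cong (λ w → 2 * w + count (mid? f)) (z-count f) ⟨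
    2 * z f + count (mid? f) ∎
    where
    open ≡-Reasoning
    pointwise : ∀ i → 1 ≡ ι (cycleMin? f i) + ι (cycleMin? f (f i)) + ι (mid? f i)
    pointwise i with cycleMin? f i | cycleMin? f (f i)
    ... | yes c | yes d = ⊥-elim (min-image c d)
    ... | yes c | no _ = refl
    ... | no _ | yes _ = refl
    ... | no _ | no _ = refl

  -- The smaller value `f i` lies on the cycle of i, so a back point is not a minimum, and its image
  -- is not one by definition.
  numBack-≤ : numBack f ≤ count (mid? f)
  numBack-≤ = subst (_≤ count (mid? f)) (sym (length-filter (backPoint? f)))
    (count-inj (backPoint? f) (mid? f) id
      (λ i (lt , ¬c) → (λ c → <⇒≱ lt (min-least c orbit-step)) , ¬c) (λ _ _ _ _ e → e))

  2-cycle : ∀ {x y} → f (f x) ≡ x → Orbit f x y → y ≡ x ⊎ y ≡ f x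
  2-cycle e (zero , refl) = inj₁ refl
  2-cycle {x} e (suc k , refl) with 2-cycle e (k , refl)
  ... | inj₁ q = inj₂ (cong f q)
  ... | inj₂ q = inj₁ (trans (cong f q) e)

  mid-long : ∀ {x} → Mid f x → Long f x
  mid-long {x} (¬c , ¬d) e with minOf x
  ... | c , o , cm with 2-cycle e o
  ... | inj₁ refl = ¬c cm
  ... | inj₂ refl = ¬d cm

  -- On a cycle longer than 2, the point after the minimum is `Mid`, and so is the point two steps
  -- before the minimum.
  long-mid : ∀ x → Long f x → Mid f x ⊎ Mid f (f x) ⊎ Mid f (f⁻¹ x)
  long-mid x lx = cases (cycleMin? f x) (cycleMin? f (f x))
    where
    cases : Dec (CycleMin f x) → Dec (CycleMin f (f x)) → Mid f x ⊎ Mid f (f x) ⊎ Mid f (f⁻¹ x)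
    cases (yes c) _ = inj₂ (inj₁ (min-image c , λ d → lx (sym (min-unique c d (2 , refl)))))
    cases (no ¬c) (no ¬d) = inj₁ (¬c , ¬d)
    cases (no ¬c) (yes d) = inj₂ (inj₂ ((λ c → lx (trans (cong f (sym (min-unique c d (2 , cong f (f-f⁻¹ x))))) (f-f⁻¹ x))) ,
      subst (λ y → ¬ CycleMin f y) (sym (f-f⁻¹ x)) ¬c))

  long-weight : ∀ x → Long f x → 1 ≤ ι (mid? f x) + (ι (mid? f (f x)) + ι (mid? f (f⁻¹ x)))
  long-weight x lx = weight (mid? f x) (mid? f (f x)) (mid? f (f⁻¹ x)) (long-mid x lx)
    where
    weight : ∀ {A B C : Set} (a : Dec A) (b : Dec B) (c : Dec C) → A ⊎ B ⊎ C → 1 ≤ ι a + (ι b + ι c)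
    weight (yes _) _ _ _ = s≤s z≤n
    weight (no _) (yes _) _ _ = s≤s z≤n
    weight (no _) (no _) (yes _) _ = s≤s z≤n
    weight (no ¬a) (no ¬b) (no ¬c) (inj₁ a) = ⊥-elim (¬a a)
    weight (no ¬a) (no ¬b) (no ¬c) (inj₂ (inj₁ b)) = ⊥-elim (¬b b)
    weight (no ¬a) (no ¬b) (no ¬c) (inj₂ (inj₂ c)) = ⊥-elim (¬c c)

  -- Every long point is within one step of a `Mid` point, and a `Mid` point serves at most three of
  -- them. A 3-cycle attains the bound; an excess of 2 therefore allows six long points.
  long-count : count (long? f) ≤ 3 * count (mid? f)
  long-count = begin
    count (long? f) ≤⟨ count-≤-sum (long? f) _ long-weight ⟩
    sum (λ x → ι (mid? f x) + (ι (mid? f (f x)) + ι (mid? f (f⁻¹ x))))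
      ≡⟨ sum-+ (ι ∘ mid? f) (λ x → ι (mid? f (f x)) + ι (mid? f (f⁻¹ x))) ⟩
    count (mid? f) + sum (λ x → ι (mid? f (f x)) + ι (mid? f (f⁻¹ x)))
      ≡⟨ cong (count (mid? f) +_) (sum-+ (λ x → ι (mid? f (f x))) (λ x → ι (mid? f (f⁻¹ x)))) ⟩
    count (mid? f) + (count (λ x → mid? f (f x)) + count (λ x → mid? f (f⁻¹ x)))
      ≡⟨ cong₂ (λ a b → count (mid? f) + (a + b)) (count-∘ pf (mid? f)) (trans (count-∘ f⁻¹-perm (mid? f)) (sym (+-identityʳ _))) ⟩
    3 * count (mid? f) ∎
    where open ℕP.≤-Reasoning

-- Subsets of a circle

infix 4 _⊑_

-- An m-element subset of `Fin n`, recorded as a sequence of decisions. In this form subsets with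
-- the same elements are equal, the embedding is increasing by construction, and Pascal's recursion
-- counts them.
data _⊑_ : ℕ → ℕ → Set where
  done : 0 ⊑ 0
  keep : ∀ {m n} → m ⊑ n → suc m ⊑ suc n
  drop : ∀ {m n} → m ⊑ n → m ⊑ suc n

emb : ∀ {m n} → m ⊑ n → Fin m → Fin n
emb (keep S) zero = zero
emb (keep S) (suc t) = suc (emb S t)
emb (drop S) t = suc (emb S t)

_∈ˢ_ : ∀ {m n} → Fin n → m ⊑ n → Set
i ∈ˢ S = ∃ λ t → emb S t ≡ i

locate : ∀ {m n} (S : m ⊑ n) i → Dec (i ∈ˢ S)
locate (keep S) zero = yes (zero , refl)
locate (keep S) (suc i) with locate S i
... | yes (t , refl) = yes (suc t , refl)
... | no ¬i = no λ { (zero , ()) ; (suc t , e) → ¬i (t , FP.suc-injective e) }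
locate (drop S) zero = no λ { (t , ()) }
locate (drop S) (suc i) with locate S i
... | yes (t , refl) = yes (t , refl)
... | no ¬i = no λ { (t , e) → ¬i (t , FP.suc-injective e) }

emb-injective : ∀ {m n} (S : m ⊑ n) {s t} → emb S s ≡ emb S t → s ≡ t
emb-injective (keep S) {zero} {zero} e = refl
emb-injective (keep S) {suc s} {suc t} e = cong suc (emb-injective S (FP.suc-injective e))
emb-injective (drop S) e = emb-injective S (FP.suc-injective e)

subsets : ∀ m n → List (m ⊑ n)
subsets zero zero = done ∷ []
subsets zero (suc n) = map drop (subsets zero n)
subsets (suc m) zero = []
subsets (suc m) (suc n) = map keep (subsets m n) ++ map drop (subsets (suc m) n)

length-subsets : ∀ m n → length (subsets m n) ≡ n C m
length-subsets zero zero = refl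
length-subsets zero (suc n) = trans (LP.length-map drop (subsets zero n)) (trans (length-subsets zero n) refl)
length-subsets (suc m) zero = sym (CP.k>n⇒nCk≡0 {0} {suc m} (s≤s z≤n))
length-subsets (suc m) (suc n) = trans (LP.length-++ (map keep (subsets m n)))
  (trans (cong₂ _+_ (trans (LP.length-map keep (subsets m n)) (length-subsets m n))
                    (trans (LP.length-map drop (subsets (suc m) n)) (length-subsets (suc m) n)))
    (CP.nCk+nC[k+1]≡[n+1]C[k+1] n m))

subsets-complete : ∀ {m n} (S : m ⊑ n) → S ∈ subsets m n
subsets-complete done = here refl
subsets-complete (keep S) = ∈P.∈-++⁺ˡ (∈P.∈-map⁺ keep (subsets-complete S))
subsets-complete {zero} (drop S) = ∈P.∈-map⁺ drop (subsets-complete S)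
subsets-complete {suc m} {suc n} (drop S) = ∈P.∈-++⁺ʳ (map keep (subsets m n)) (∈P.∈-map⁺ drop (subsets-complete S))

subsets-unique : ∀ m n → Unique (subsets m n)
subsets-unique zero zero = [] ∷ []
subsets-unique zero (suc n) = UP.map⁺ (λ { refl → refl }) (subsets-unique zero n)
subsets-unique (suc m) zero = []
subsets-unique (suc m) (suc n) = UP.++⁺ (UP.map⁺ (λ { refl → refl }) (subsets-unique m n))
    (UP.map⁺ (λ { refl → refl }) (subsets-unique (suc m) n)) λ (p , q) → disjoint p q
  where
  disjoint : ∀ {S} → S ∈ map keep (subsets m n) → S ∈ map drop (subsets (suc m) n) → ⊥
  disjoint p q with ∈P.∈-map⁻ keep p | ∈P.∈-map⁻ drop q
  ... | _ , _ , refl | _ , _ , ()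

⊑-ext : ∀ {m n} (S S′ : m ⊑ n) → (∀ i → i ∈ˢ S → i ∈ˢ S′) → (∀ i → i ∈ˢ S′ → i ∈ˢ S) → S ≡ S′
⊑-ext done done f g = refl
⊑-ext (keep S) (keep S′) f g = cong keep (⊑-ext S S′ (tail f) (tail g))
  where
  tail : ∀ {m n} {S S′ : m ⊑ n} → (∀ i → i ∈ˢ keep S → i ∈ˢ keep S′) → ∀ i → i ∈ˢ S → i ∈ˢ S′
  tail f i (t , refl) with f (suc i) (suc t , refl)
  ... | suc u , e = u , FP.suc-injective e
⊑-ext (keep S) (drop S′) f g with f zero (zero , refl)
... | _ , ()
⊑-ext (drop S) (keep S′) f g with g zero (zero , refl)
... | _ , ()
⊑-ext (drop S) (drop S′) f g = cong drop (⊑-ext S S′ (tail f) (tail g))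
  where
  tail : ∀ {m n} {S S′ : m ⊑ n} → (∀ i → i ∈ˢ drop S → i ∈ˢ drop S′) → ∀ i → i ∈ˢ S → i ∈ˢ S′
  tail f i (t , refl) with f (suc i) (t , refl)
  ... | u , e = u , FP.suc-injective e

support : ∀ {n} {P : Fin n → Set} (P? : ∀ i → Dec (P i)) → count P? ⊑ n
support {zero} P? = done
support {suc n} P? with P? zero
... | yes _ = keep (support (P? ∘ suc))
... | no _ = drop (support (P? ∘ suc))

support-sound : ∀ {n} {P : Fin n → Set} (P? : ∀ i → Dec (P i)) i → i ∈ˢ support P? → P i
support-sound {suc n} P? i (t , e) with P? zero
support-sound {suc n} P? .zero (zero , refl) | yes p = p
support-sound {suc n} P? .(suc _) (suc t , refl) | yes p = support-sound (P? ∘ suc) _ (t , refl)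
support-sound {suc n} P? .(suc _) (t , refl) | no ¬p = support-sound (P? ∘ suc) _ (t , refl)

support-complete : ∀ {n} {P : Fin n → Set} (P? : ∀ i → Dec (P i)) i → P i → i ∈ˢ support P?
support-complete {suc n} P? i p with P? zero
support-complete {suc n} P? zero p | yes _ = zero , refl
support-complete {suc n} P? (suc i) p | yes _ with support-complete (P? ∘ suc) i p
... | t , refl = suc t , refl
support-complete {suc n} P? zero p | no ¬p = ⊥-elim (¬p p)
support-complete {suc n} P? (suc i) p | no _ with support-complete (P? ∘ suc) i p
... | t , refl = t , refl

-- The number of elements of S below i. The argument ranges over ℕ so that the full count m is
-- available at i = n.
rank : ∀ {m n} → m ⊑ n → ℕ → ℕ
rank done i = 0
rank (keep S) zero = 0
rank (keep S) (suc i) = suc (rank S i)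
rank (drop S) zero = 0
rank (drop S) (suc i) = rank S i

rank-zero : ∀ {m n} (S : m ⊑ n) → rank S 0 ≡ 0
rank-zero done = refl
rank-zero (keep S) = refl
rank-zero (drop S) = refl

rank-top : ∀ {m n} (S : m ⊑ n) → rank S n ≡ m
rank-top done = refl
rank-top (keep S) = cong suc (rank-top S)
rank-top (drop S) = rank-top S

rank-emb : ∀ {m n} (S : m ⊑ n) t → rank S (toℕ (emb S t)) ≡ toℕ t
rank-emb (keep S) zero = refl
rank-emb (keep S) (suc t) = cong suc (rank-emb S t)
rank-emb (drop S) t = rank-emb S t

rank-suc-∈ : ∀ {m n} (S : m ⊑ n) t → rank S (suc (toℕ (emb S t))) ≡ suc (toℕ t)
rank-suc-∈ (keep S) zero = cong suc (rank-zero S)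
rank-suc-∈ (keep S) (suc t) = cong suc (rank-suc-∈ S t)
rank-suc-∈ (drop S) t = rank-suc-∈ S t

rank-suc-∉ : ∀ {m n} (S : m ⊑ n) i → ¬ i ∈ˢ S → rank S (suc (toℕ i)) ≡ rank S (toℕ i)
rank-suc-∉ (keep S) zero ∉ = ⊥-elim (∉ (zero , refl))
rank-suc-∉ (keep S) (suc i) ∉ = cong suc (rank-suc-∉ S i λ { (t , refl) → ∉ (suc t , refl) })
rank-suc-∉ (drop S) zero ∉ = rank-zero S
rank-suc-∉ (drop S) (suc i) ∉ = rank-suc-∉ S i λ { (t , refl) → ∉ (t , refl) }

emb-<⇒rank : ∀ {m n} (S : m ⊑ n) u i → toℕ (emb S u) < i → toℕ u < rank S i
emb-<⇒rank (keep S) zero (suc i) lt = s≤s z≤n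
emb-<⇒rank (keep S) (suc u) (suc i) (s≤s lt) = s≤s (emb-<⇒rank S u i lt)
emb-<⇒rank (drop S) u (suc i) (s≤s lt) = emb-<⇒rank S u i lt

rank⇒emb-< : ∀ {m n} (S : m ⊑ n) u i → toℕ u < rank S i → toℕ (emb S u) < i
rank⇒emb-< (keep S) zero (suc i) lt = s≤s z≤n
rank⇒emb-< (keep S) (suc u) (suc i) (s≤s lt) = s≤s (rank⇒emb-< S u i lt)
rank⇒emb-< (drop S) u (suc i) lt = s≤s (rank⇒emb-< S u i lt)

emb-mono : ∀ {m n} (S : m ⊑ n) {s t} → toℕ s < toℕ t → toℕ (emb S s) < toℕ (emb S t)
emb-mono S {s} {t} lt = rank⇒emb-< S s _ (subst (toℕ s <_) (sym (rank-emb S t)) lt)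

emb-mono⁻ : ∀ {m n} (S : m ⊑ n) {s t} → toℕ (emb S s) < toℕ (emb S t) → toℕ s < toℕ t
emb-mono⁻ S {s} {t} lt = subst (toℕ s <_) (rank-emb S t) (emb-<⇒rank S s _ lt)

-- The cyclic structure that a subset S of the circle Fin n inherits: ρ sends a point to the
-- first point of S at or after it.
module Circle {m n} (S : suc m ⊑ n) where

  ρ : Fin n → Fin (suc m)
  ρ i = rank S (toℕ i) mod suc m

  ρ-emb : ∀ t → ρ (emb S t) ≡ t
  ρ-emb t = toℕ-injective (trans (toℕ-mod (rank S (toℕ (emb S t))) (suc m)) (trans (cong (_% suc m) (rank-emb S t)) (DM.m<n⇒m%n≡m (toℕ<n t))))

  ρ-ζ : ∀ i → ρ (ζ i) ≡ rank S (suc (toℕ i)) mod suc m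
  ρ-ζ i with ζ-view i
  ... | next _ e = cong (λ j → rank S j mod suc m) e
  ... | last p e rewrite e | p | rank-zero S | rank-top S = toℕ-injective
      (trans (toℕ-mod 0 (suc m)) (sym (trans (toℕ-mod (suc m) (suc m)) (DM.n%n≡0 (suc m)))))

  ρ-∉ : ∀ {i} → ¬ i ∈ˢ S → ρ (ζ i) ≡ ρ i
  ρ-∉ {i} ∉ = trans (ρ-ζ i) (cong (_mod suc m) (rank-suc-∉ S i ∉))

  ρ-∈ : ∀ t → ρ (ζ (emb S t)) ≡ ζ t
  ρ-∈ t = trans (ρ-ζ (emb S t)) (cong (_mod suc m) (trans (rank-suc-∈ S t) (+-comm 1 (toℕ t))))

  record Nearest (i : Fin n) : Set where
    field
      steps : ℕ
      bound : steps < n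
      arrives : iter ζ steps i ≡ emb S (ρ i)
      avoids : ∀ j → j < steps → ¬ iter ζ j i ∈ˢ S

  nearest : ∀ i → Nearest i
  nearest i with Perm.orbit-bounded ζ-perm (ζ-transitive i (emb S zero))
  ... | q , e with FP.¬∀⟶∃¬-smallest n (λ p → ¬ iter ζ (toℕ p) i ∈ˢ S) (λ p → ¬? (locate S _)) (λ ∉ → ∉ q (zero , sym e))
  ... | p , ¬∉ , before with locate S (iter ζ (toℕ p) i)
  ... | no ∉ = ⊥-elim (¬∉ ∉)
  -- The first element of S met on the walk is the one named by ρ, because ρ is constant along steps
  -- outside S.
  ... | yes (t , e′) = record { steps = toℕ p ; bound = toℕ<n p ; arrives = trans (sym e′)
      (cong (emb S) (trans (sym (ρ-emb t)) (trans (cong ρ e′) (const (toℕ p) ≤-refl)))) ; avoids = avoids }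
    where
    avoids : ∀ j → j < toℕ p → ¬ iter ζ j i ∈ˢ S
    avoids j j<p = subst (λ k → ¬ iter ζ k i ∈ˢ S) (trans (FP.toℕ-inject (fromℕ< j<p)) (toℕ-fromℕ< j<p)) (before (fromℕ< j<p))
    const : ∀ j → j ≤ toℕ p → ρ (iter ζ j i) ≡ ρ i
    const zero _ = refl
    const (suc j) j<p = trans (ρ-∉ (avoids j j<p)) (const j (<⇒≤ j<p))

  -- The walk along ζ always reaches S; its number of steps is the induction measure.
  circle-induction : (P : Fin n → Set) → (∀ t → P (emb S t)) → (∀ i → ¬ i ∈ˢ S → P (ζ i) → P i) → ∀ i → P i
  circle-induction P base step i = go steps i arrives avoids
    where
    open Nearest (nearest i)
    go : ∀ k x → iter ζ k x ≡ emb S (ρ i) → (∀ j → j < k → ¬ iter ζ j x ∈ˢ S) → P x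
    go zero x e _ = subst P (sym e) (base (ρ i))
    go (suc k) x e av = step x (av 0 (s≤s z≤n)) (go k (ζ x) (trans (iter-comm ζ k x) e)
      (λ j lt → subst (λ y → ¬ y ∈ˢ S) (sym (iter-comm ζ j x)) (av (suc j) (s≤s lt))))

-- Removing the fixed points of γ

expand : ∀ {m n} → m ⊑ n → Fun m → Fun n
expand S g i with locate S i
... | yes (t , _) = emb S (g t)
... | no _ = i

expand-∈ : ∀ {m n} (S : m ⊑ n) g t → expand S g (emb S t) ≡ emb S (g t)
expand-∈ S g t with locate S (emb S t)
... | yes (u , e) = cong (emb S ∘ g) (emb-injective S e)
... | no ∉ = ⊥-elim (∉ (t , refl))

expand-∉ : ∀ {m n} (S : m ⊑ n) g {i} → ¬ i ∈ˢ S → expand S g i ≡ i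
expand-∉ S g {i} ∉ with locate S i
... | yes ∈S = ⊥-elim (∉ ∈S)
... | no _ = refl

expand-perm : ∀ {m n} (S : m ⊑ n) {g} → IsPerm g → IsPerm (expand S g)
expand-perm S {g} pg i j e with locate S i | locate S j
... | yes (t , refl) | yes (u , refl) = cong (emb S) (pg t u (emb-injective S e))
... | yes (t , refl) | no ∉ = ⊥-elim (∉ (g t , e))
... | no ∉ | yes (u , refl) = ⊥-elim (∉ (g u , sym e))
... | no _ | no _ = e

-- Zeroing f on S lets a sum split into its parts inside and outside S without a separate indexing
-- of the complement.
offˢ : ∀ {m n} (S : m ⊑ n) → (Fin n → ℕ) → Fin n → ℕ
offˢ done f ()
offˢ (keep S) f zero = 0
offˢ (keep S) f (suc i) = offˢ S (f ∘ suc) i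
offˢ (drop S) f zero = f zero
offˢ (drop S) f (suc i) = offˢ S (f ∘ suc) i

sum-split : ∀ {m n} (S : m ⊑ n) (f : Fin n → ℕ) → sum f ≡ sum (f ∘ emb S) + sum (offˢ S f)
sum-split done f = refl
sum-split (keep S) f = trans (cong (λ w → f zero + w) (sum-split S (f ∘ suc))) (sym (+-assoc (f zero) _ _))
sum-split (drop S) f = trans (cong (λ w → f zero + w) (sum-split S (f ∘ suc)))
  (lia (f zero ∷ sum (f ∘ suc ∘ emb S) ∷ sum (offˢ S (f ∘ suc)) ∷ []) λ a b c → [] , a :+ (b :+ c) :≡ b :+ (a :+ c))

offˢ-cong : ∀ {m n} (S : m ⊑ n) (f g : Fin n → ℕ) → (∀ i → ¬ i ∈ˢ S → f i ≡ g i) → ∀ i → offˢ S f i ≡ offˢ S g i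
offˢ-cong (keep S) f g h zero = refl
offˢ-cong (keep S) f g h (suc i) = offˢ-cong S (f ∘ suc) (g ∘ suc) (λ i ∉ → h (suc i) λ { (zero , ()) ; (suc t , e) → ∉ (t , FP.suc-injective e) }) i
offˢ-cong (drop S) f g h zero = h zero λ { (_ , ()) }
offˢ-cong (drop S) f g h (suc i) = offˢ-cong S (f ∘ suc) (g ∘ suc) (λ i ∉ → h (suc i) λ { (t , e) → ∉ (t , FP.suc-injective e) }) i

offˢ-zero : ∀ {m n} (S : m ⊑ n) → sum (offˢ S (λ _ → 0)) ≡ 0
offˢ-zero done = refl
offˢ-zero (keep S) = offˢ-zero S
offˢ-zero (drop S) = offˢ-zero S

offˢ-one : ∀ {m n} (S : m ⊑ n) → m + sum (offˢ S (λ _ → 1)) ≡ n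
offˢ-one {m} {n} S = trans (cong (_+ sum (offˢ S (λ _ → 1))) (sym (sum-1 m))) (trans (sym (sum-split S (λ _ → 1))) (sum-1 n))

iter-emb : ∀ {m n} (e : Fin m → Fin n) {g : Fun m} {f : Fun n} → (∀ t → f (e t) ≡ e (g t)) → ∀ k t → iter f k (e t) ≡ e (iter g k t)
iter-emb e h zero t = refl
iter-emb e {g} {f} h (suc k) t = trans (cong f (iter-emb e h k t)) (h _)

module _ {m n} {g : Fun m} {f : Fun n} (pg : IsPerm g) (pf : IsPerm f) (e : Fin m → Fin n)
  (mono : ∀ {s t} → toℕ s < toℕ t → toℕ (e s) < toℕ (e t)) (equi : ∀ t → f (e t) ≡ e (g t)) where

  min-emb : ∀ t → CycleMin g t → CycleMin f (e t)
  min-emb t c = Perm.min-intro pf λ { y (k , refl) → ≮⇒≥ λ lt → case-< k (subst (λ w → toℕ w < toℕ (e t)) (iter-emb e equi k t) lt) }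
    where
    case-< : ∀ k → toℕ (e (iter g k t)) < toℕ (e t) → ⊥
    case-< k lt with m≤n⇒m<n∨m≡n (Perm.min-least pg c (k , refl))
    ... | inj₁ lt′ = ℕP.<-asym lt (mono lt′)
    ... | inj₂ eq = <-irrefl (cong (toℕ ∘ e) (toℕ-injective (sym eq))) lt

  emb-min : ∀ t → CycleMin f (e t) → CycleMin g t
  emb-min t c = Perm.min-intro pg λ { y (k , refl) → ≮⇒≥ λ lt →
    <⇒≱ (mono lt) (subst (λ w → toℕ (e t) ≤ toℕ w) (iter-emb e equi k t) (Perm.min-least pf c (k , refl))) }

descents : ∀ {n} → Fun n → ℕ
descents f = count (λ i → f i F.<? i)

module _ {m n} (S : m ⊑ n) {g : Fun m} (pg : IsPerm g) where

  -- Each of the n - m points outside S is fixed and adds one cycle, while `emb S` is increasing and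
  -- so preserves the minima of the other cycles.
  z-expand : m + z (expand S g) ≡ z g + n
  z-expand = begin
    m + z (expand S g) ≡⟨ cong (λ w → m + w) (trans (z-count (expand S g)) (sum-split S (ι ∘ cycleMin? (expand S g)))) ⟩
    m + (sum (λ t → ι (cycleMin? (expand S g) (emb S t))) + sum (offˢ S (ι ∘ cycleMin? (expand S g))))
      ≡⟨ cong₂ (λ a b → m + (a + b)) (count-cong (λ t → cycleMin? (expand S g) (emb S t)) (cycleMin? g)
          (emb-min pg pf (emb S) (emb-mono S) equi) (min-emb pg pf (emb S) (emb-mono S) equi))
          (sum-cong-≗ (offˢ-cong S _ (λ _ → 1) λ i ∉ → ι-yes (cycleMin? (expand S g) i)
            (Perm.min-intro pf λ { y (k , refl) → ≤-reflexive (cong toℕ (sym (fixed ∉ k))) }))) ⟩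
    m + (count (cycleMin? g) + sum (offˢ S (λ _ → 1)))
      ≡⟨ lia (m ∷ count (cycleMin? g) ∷ sum (offˢ S (λ _ → 1)) ∷ n ∷ []) (λ m c s n → m :+ s :≡ n ∷ [] , m :+ (c :+ s) :≡ c :+ n) (offˢ-one S) ⟩
    count (cycleMin? g) + n ≡⟨ cong (_+ n) (z-count g) ⟨
    z g + n ∎
    where
    open ≡-Reasoning
    pf = expand-perm S pg
    equi = expand-∈ S g
    fixed : ∀ {i} → ¬ i ∈ˢ S → ∀ k → iter (expand S g) k i ≡ i
    fixed ∉ zero = refl
    fixed ∉ (suc k) = trans (cong (expand S g) (fixed ∉ k)) (expand-∉ S g ∉)

  descents-expand : descents (expand S g) ≡ descents g
  descents-expand = begin
    descents (expand S g) ≡⟨ sum-split S (λ i → ι (expand S g i F.<? i)) ⟩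
    count (λ t → expand S g (emb S t) F.<? emb S t) + sum (offˢ S (λ i → ι (expand S g i F.<? i)))
      ≡⟨ cong₂ _+_ (count-cong (λ t → expand S g (emb S t) F.<? emb S t) (λ t → g t F.<? t)
          (λ t lt → emb-mono⁻ S (subst (λ w → toℕ w < toℕ (emb S t)) (expand-∈ S g t) lt))
          (λ t lt → subst (λ w → toℕ w < toℕ (emb S t)) (sym (expand-∈ S g t)) (emb-mono S lt)))
        (trans (sum-cong-≗ (offˢ-cong S _ (λ _ → 0) λ i ∉ → ι-no (expand S g i F.<? i) (<-irrefl (cong toℕ (expand-∉ S g ∉))))) (offˢ-zero S)) ⟩
    descents g + 0 ≡⟨ +-identityʳ _ ⟩
    descents g ∎
    where open ≡-Reasoning

-- Adding 1 to the value turns the weak comparison into a strict one. The extra 1 is the point whose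
-- image is the top element, which ζ wraps to 0.
weakDescents-ζ : ∀ {n} {f : Fun (suc n)} → IsPerm f → weakDescents (λ i → ζ (f i)) ≡ descents f + 1
weakDescents-ζ {n} {f} pf = begin
  weakDescents (λ i → ζ (f i)) ≡⟨ sum-cong-≗ pointwise ⟩
  sum (λ i → ι (f i F.<? i) + ι (f i F.≟ top)) ≡⟨ sum-+ (λ i → ι (f i F.<? i)) (λ i → ι (f i F.≟ top)) ⟩
  descents f + count (λ i → f i F.≟ top) ≡⟨ cong (λ w → descents f + w) (trans (count-∘ pf (F._≟ top)) (count-≡ top)) ⟩
  descents f + 1 ∎
  where
  open ≡-Reasoning
  top = F.fromℕ n
  pointwise : ∀ i → ι (ζ (f i) F.≤? i) ≡ ι (f i F.<? i) + ι (f i F.≟ top)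
  pointwise i with ζ-view (f i)
  ... | next lt e = trans (ι-cong (ζ (f i) F.≤? i) (f i F.<? i) (subst (_≤ toℕ i) e) (subst (_≤ toℕ i) (sym e)))
      (trans (sym (+-identityʳ _)) (cong (λ w → ι (f i F.<? i) + w)
        (sym (ι-no (f i F.≟ top) λ eq → <-irrefl (cong suc (trans (cong toℕ eq) (FP.toℕ-fromℕ n))) lt))))
  ... | last p e = trans (ι-yes (ζ (f i) F.≤? i) (subst (_≤ toℕ i) (sym e) z≤n))
      (sym (cong₂ _+_ (ι-no (f i F.<? i) λ lt → <⇒≱ (toℕ<n i) (subst (_≤ toℕ i) p lt))
        (ι-yes (f i F.≟ top) (toℕ-injective (trans (suc-injective p) (sym (FP.toℕ-fromℕ n)))))))

module _ {m n} (S : suc m ⊑ n) {g : Fun (suc m)} (pg : IsPerm g) where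
  open Circle S

  private
    α : Fun n
    α i = ζ (expand S g i)
    α′ : Fun (suc m)
    α′ t = ζ (g t)
    pα : IsPerm α
    pα = ∘-perm ζ-perm (expand-perm S pg)
    pα′ : IsPerm α′
    pα′ = ∘-perm ζ-perm pg

    α-∉ : ∀ {i} → ¬ i ∈ˢ S → α i ≡ ζ i
    α-∉ ∉ = cong ζ (expand-∉ S g ∉)

    ρ-α : ∀ t → ρ (α (emb S t)) ≡ α′ t
    ρ-α t = trans (cong (ρ ∘ ζ) (expand-∈ S g t)) (ρ-∈ (g t))

    toNearest : ∀ i → Orbit α i (emb S (ρ i))
    toNearest = circle-induction (λ i → Orbit α i (emb S (ρ i)))
      (λ t → subst (Orbit α (emb S t)) (cong (emb S) (sym (ρ-emb t))) orbit-refl)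
      (λ i ∉ o → orbit-trans (1 , α-∉ ∉) (subst (λ t → Orbit α (ζ i) (emb S t)) (ρ-∉ ∉) o))

    ρ-step : ∀ i → Orbit α′ (ρ i) (ρ (α i))
    ρ-step i = cases (locate S i)
      where
      cases : Dec (i ∈ˢ S) → Orbit α′ (ρ i) (ρ (α i))
      cases (yes (t , refl)) = 1 , trans (cong α′ (ρ-emb t)) (sym (ρ-α t))
      cases (no ∉) = 0 , sym (trans (cong ρ (α-∉ ∉)) (ρ-∉ ∉))

    ρ-orbit : ∀ {i j} → Orbit α i j → Orbit α′ (ρ i) (ρ j)
    ρ-orbit (zero , refl) = orbit-refl
    ρ-orbit (suc k , refl) = orbit-trans (ρ-orbit (k , refl)) (ρ-step _)

    emb-step : ∀ t → Orbit α (emb S t) (emb S (α′ t))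
    emb-step t = orbit-trans orbit-step (subst (λ u → Orbit α (α (emb S t)) (emb S u)) (ρ-α t) (toNearest (α (emb S t))))

    emb-orbit : ∀ {s t} → Orbit α′ s t → Orbit α (emb S s) (emb S t)
    emb-orbit (zero , refl) = orbit-refl
    emb-orbit (suc k , refl) = orbit-trans (emb-orbit (k , refl)) (emb-step _)

  -- Outside S the map α follows ζ to the next element of S, so ρ and `emb S` induce mutually
  -- inverse maps between the cycles of α and those of α′.
  z-circle : z α ≡ z α′
  z-circle = ≤-antisym
    (z-≤ pα pα′ ρ λ i j o → orbit-trans (toNearest i) (orbit-trans (emb-orbit o) (Perm.orbit-sym pα (toNearest j))))
    (z-≤ pα′ pα (emb S) λ s t o → subst₂ (Orbit α′) (ρ-emb s) (ρ-emb t) (ρ-orbit o))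

  -- In a trivial cycle all points but the last follow ζ, so they lie outside S because g has no
  -- fixed point. If the last point is in S, then α′ fixes it. If not, ζ runs round the cycle, which
  -- is then the whole circle and misses S; but S is not empty.
  reduced⁺ : (∀ t → g t ≢ t) → (∀ t → ζ (g t) ≢ t) → Reduced α
  reduced⁺ g-moves α′-moves (i , p , run , close) = cases (locate S (iter ζ (toℕ p) i))
    where
    run-∉ : ∀ j → j < toℕ p → ¬ iter ζ j i ∈ˢ S
    run-∉ j lt (t , e) = g-moves t (emb-injective S (ζ-perm _ _ (begin
      ζ (emb S (g t))     ≡⟨ cong ζ (expand-∈ S g t) ⟨
      α (emb S t)         ≡⟨ cong α (trans e (sym (shift-iter i j))) ⟩
      α (shift i j)       ≡⟨ subst (λ k → α (shift i k) ≡ shift i (suc k)) (toℕ-fromℕ< lt) (run (fromℕ< lt)) ⟩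
      shift i (suc j)     ≡⟨ shift-iter i (suc j) ⟩
      ζ (iter ζ j i)      ≡⟨ cong ζ e ⟨
      ζ (emb S t)         ∎)))
      where open ≡-Reasoning
    module _ (∉ : ¬ iter ζ (toℕ p) i ∈ˢ S) where
      run-all : ∀ j → j ≤ toℕ p → ¬ iter ζ j i ∈ˢ S
      run-all j j≤p with m≤n⇒m<n∨m≡n j≤p
      ... | inj₂ refl = ∉
      ... | inj₁ lt = run-∉ j lt
      period : iter ζ (suc (toℕ p)) i ≡ i
      period = trans (sym (α-∉ ∉)) (trans (cong α (sym (shift-iter i (toℕ p)))) close)
      absurd : ⊥
      absurd with ζ-transitive i (emb S zero)
      ... | k , e = run-all (k % suc (toℕ p)) (≤-pred (DM.m%n<n k (suc (toℕ p)))) (zero , (begin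
        emb S zero ≡⟨ e ⟨
        iter ζ k i ≡⟨ cong (λ j → iter ζ j i) (DM.m≡m%n+[m/n]*n k (suc (toℕ p))) ⟩
        iter ζ (k % suc (toℕ p) + (k / suc (toℕ p)) * suc (toℕ p)) i ≡⟨ iter-+ ζ (k % suc (toℕ p)) _ i ⟩
        iter ζ (k % suc (toℕ p)) (iter ζ ((k / suc (toℕ p)) * suc (toℕ p)) i)
          ≡⟨ cong (iter ζ (k % suc (toℕ p))) (Perm.iter-period ζ-perm {p = suc (toℕ p)} period (k / suc (toℕ p))) ⟩
        iter ζ (k % suc (toℕ p)) i ∎))
        where open ≡-Reasoning
    const : ∀ j → j ≤ toℕ p → ρ (iter ζ j i) ≡ ρ i
    const zero _ = refl
    const (suc j) lt = trans (ρ-∉ (run-∉ j lt)) (const j (<⇒≤ lt))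
    cases : Dec (iter ζ (toℕ p) i ∈ˢ S) → ⊥
    cases (no ∉) = absurd ∉
    cases (yes (t , e)) = α′-moves t (begin
      α′ t                      ≡⟨ ρ-α t ⟨
      ρ (α (emb S t))           ≡⟨ cong (ρ ∘ α) (trans e (sym (shift-iter i (toℕ p)))) ⟩
      ρ (α (shift i (toℕ p)))   ≡⟨ cong ρ close ⟩
      ρ i                       ≡⟨ const (toℕ p) ≤-refl ⟨
      ρ (iter ζ (toℕ p) i)      ≡⟨ cong ρ e ⟨
      ρ (emb S t)               ≡⟨ ρ-emb t ⟩
      t                         ∎)
      where open ≡-Reasoning

  -- If α′ fixes t, then from `α (emb S t)` the walk along ζ returns to `emb S t` through points
  -- outside S, and α closes it up to a trivial cycle.
  reduced⁻ : Reduced α → ∀ t → ζ (g t) ≢ t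
  reduced⁻ red t e = red (i , fromℕ< bound , run , close)
    where
    i = α (emb S t)
    open Nearest (nearest i)
    ρi : ρ i ≡ t
    ρi = trans (ρ-α t) e
    run : (j : Fin (toℕ (fromℕ< bound))) → α (shift i (toℕ j)) ≡ shift i (suc (toℕ j))
    run j = trans (cong α (shift-iter i (toℕ j)))
        (trans (α-∉ (avoids (toℕ j) (subst (toℕ j <_) (toℕ-fromℕ< bound) (toℕ<n j)))) (sym (shift-iter i (suc (toℕ j)))))
    close : α (shift i (toℕ (fromℕ< bound))) ≡ i
    close = trans (cong α (trans (shift-iter i _) (trans (cong (λ k → iter ζ k i) (toℕ-fromℕ< bound)) (trans arrives (cong (emb S) ρi))))) refl

-- Here g is γ′ and `ζ ∘ g` is α′. The last equation is genus one, `k + z g + 2 ≡ m + 1`, with one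
-- unit cancelled.
Good : ∀ {m} → ℕ → Fun m → Set
Good {m} k g = IsPerm g × (∀ t → g t ≢ t) × (∀ t → ζ (g t) ≢ t) × z (λ t → ζ (g t)) ≡ k × z g + k + 1 ≡ m

good? : ∀ {m} k (g : Fun m) → Dec (Good k g)
good? k g = isPerm? g ×-dec all? (λ t → ¬? (g t F.≟ t)) ×-dec all? (λ t → ¬? (ζ (g t) F.≟ t)) ×-dec (_ ℕP.≟ _) ×-dec (_ ℕP.≟ _)

goods : ∀ m → ℕ → List (Vec (Fin m) m)
goods m k = filter (λ v → good? k (lookup v)) (allVecs m m)

-- A map without fixed points has at most m / 2 cycles; put into the genus equation this bounds m,
-- and later caps the number of back points at 2.
good-bound : ∀ {m k} {g : Fun m} → Good k g → m ≤ 2 * k + 2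
good-bound {m} {k} {g} (pg , moves , _ , _ , e) =
  lia (m ∷ k ∷ z g ∷ count (mid? g) ∷ []) (λ m k z c → z :+ k :+ con 1 :≡ m ∷ m :≡ 2 :* z :+ c ∷ [] , m :≤ 2 :* k :+ con 2)
    e (Derangement.size pg moves)

-- On both sides back points are intermediate points; since the two totals agree, so do the two sides.
good-descents : ∀ {m k} {g : Fun (suc m)} → Good k g → descents g + 1 + k ≡ suc m
good-descents {m} {k} {g} (pg , g-moves , α-moves , zα , e) =
  lia (m ∷ k ∷ z g ∷ descents g ∷ numBack α ∷ numBack β ∷ count (mid? α) ∷ count (mid? β) ∷ weakDescents β ∷ [])
    (λ m k z d a b ma mb w →
      a :+ k :≡ d :+ con 1 ∷ b :+ z :≡ w ∷ d :+ w :≡ con 1 :+ m ∷ a :≤ ma ∷ b :≤ mb ∷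
      con 1 :+ m :≡ 2 :* k :+ ma ∷ con 1 :+ m :≡ 2 :* z :+ mb ∷ z :+ k :+ con 1 :≡ con 1 :+ m ∷ [] ,
      d :+ con 1 :+ k :≡ con 1 :+ m)
    (subst (λ w → numBack α + w ≡ descents g + 1) zα (trans (numBack+z pα) (weakDescents-ζ pg)))
    (subst (λ w → numBack β + w ≡ weakDescents β) zβ (numBack+z pβ))
    complement
    (Derangement.numBack-≤ pα α-moves) (Derangement.numBack-≤ pβ β-moves)
    (subst (λ w → suc m ≡ 2 * w + count (mid? α)) zα (Derangement.size pα α-moves))
    (subst (λ w → suc m ≡ 2 * w + count (mid? β)) zβ (Derangement.size pβ β-moves))
    e
  where
  open Perm pg
  α = λ t → ζ (g t)
  β = f⁻¹
  pα = ∘-perm ζ-perm pg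
  pβ = f⁻¹-perm
  zβ : z β ≡ z g
  zβ = z-inverse pβ pg f⁻¹-f f-f⁻¹
  β-moves : ∀ t → β t ≢ t
  β-moves t e = g-moves t (trans (cong g (sym e)) (f-f⁻¹ t))
  -- Evaluating at `g i` turns a weak descent of the inverse into a weak ascent `i ≤ g i`, the
  -- opposite of a descent of g.
  complement : descents g + weakDescents β ≡ suc m
  complement = begin
    descents g + weakDescents β ≡⟨ cong (λ w → descents g + w) (trans (sym (count-∘ pg (λ i → β i F.≤? i)))
        (count-cong (λ i → β (g i) F.≤? g i) (λ i → i F.≤? g i) (λ i → subst (F._≤ g i) (f⁻¹-f i)) (λ i → subst (F._≤ g i) (sym (f⁻¹-f i))))) ⟩
    descents g + count (λ i → i F.≤? g i) ≡⟨ sum-+ (λ i → ι (g i F.<? i)) (λ i → ι (i F.≤? g i)) ⟨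
    sum (λ i → ι (g i F.<? i) + ι (i F.≤? g i)) ≡⟨ sum-cong-≗ (λ i → dichotomy (g i) i) ⟩
    sum {suc m} (λ _ → 1) ≡⟨ sum-1 (suc m) ⟩
    suc m ∎
    where
    open ≡-Reasoning
    dichotomy : ∀ {n} (a b : Fin n) → ι (a F.<? b) + ι (b F.≤? a) ≡ 1
    dichotomy a b with ℕP.<-≤-connex (toℕ a) (toℕ b)
    ... | inj₁ lt = cong₂ _+_ (ι-yes (a F.<? b) lt) (ι-no (b F.≤? a) (<⇒≱ lt))
    ... | inj₂ le = cong₂ _+_ (ι-no (a F.<? b) (≤⇒≯ le)) (ι-yes (b F.≤? a) le)

reduced-cong : ∀ {n} {f g : Fun n} → (∀ i → f i ≡ g i) → Reduced f → Reduced g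
reduced-cong h red (i , p , run , close) = red (i , p , (λ j → trans (h _) (run j)) , trans (h _) close)

module Decomposed {m n} (S : suc m ⊑ suc n) {g : Fun (suc m)} (pg : IsPerm g) {α : Fun (suc n)} (pα : IsPerm α)
  (h : ∀ i → α i ≡ ζ (expand S g i)) where

  private
    γ = expand S g
    pγ = expand-perm S pg
    β = λ x → inv α (ζ x)
    pβ : IsPerm β
    pβ = ∘-perm (Perm.inv-perm pα) ζ-perm

  z-α : z α ≡ z (λ t → ζ (g t))
  z-α = trans (z-cong pα (∘-perm ζ-perm pγ) h) (z-circle S pg)

  -- The genus is defined through α⁻¹ ∘ ζ. This is the inverse of γ, so it has the same number of
  -- cycles.
  z-β : suc m + z β ≡ z g + suc n
  z-β = trans (cong (λ w → suc m + w) (z-inverse pβ pγ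
    (λ x → trans (cong (inv α) (sym (h x))) (Perm.inv-f pα x))
    (λ x → ζ-perm _ _ (trans (sym (h _)) (Perm.f-inv pα (ζ x)))))) (z-expand S pg)

  back : numBack α + z α ≡ descents g + 1
  back = begin
    numBack α + z α ≡⟨ numBack+z pα ⟩
    weakDescents α ≡⟨ count-cong (λ i → α i F.≤? i) (λ i → ζ (γ i) F.≤? i) (λ i → subst (F._≤ i) (h i)) (λ i → subst (F._≤ i) (sym (h i))) ⟩
    weakDescents (λ i → ζ (γ i)) ≡⟨ weakDescents-ζ pγ ⟩
    descents γ + 1 ≡⟨ cong (_+ 1) (descents-expand S pg) ⟩
    descents g + 1 ∎
    where open ≡-Reasoning

  back-points : ∀ {k} → Good k g → numBack α + 2 * k ≡ suc m
  back-points {k} G@(_ , _ , _ , zk , _) =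
    lia (numBack α ∷ z α ∷ descents g ∷ k ∷ m ∷ []) (λ b z d k m → b :+ z :≡ d :+ con 1 ∷ z :≡ k ∷ d :+ con 1 :+ k :≡ con 1 :+ m ∷ [] ,
      b :+ 2 :* k :≡ con 1 :+ m) back (trans z-α zk) (good-descents G)

  redG1⁺ : ∀ {k} → Good k g → RedG1 k α
  redG1⁺ {k} (_ , g-moves , α-moves , zk , e) = reduced-cong (λ i → sym (h i)) (reduced⁺ S pg g-moves α-moves) ,
    lia (z α ∷ z β ∷ z g ∷ k ∷ m ∷ n ∷ []) (λ a b z k m n → a :≡ k ∷ con 1 :+ m :+ b :≡ z :+ (con 1 :+ n) ∷ z :+ k :+ con 1 :≡ con 1 :+ m ∷ [] ,
      a :+ b :+ con 2 :≡ con 1 :+ n :+ con 1) (trans z-α zk) z-β e ,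
    trans z-α zk

  redG1⁻ : ∀ {k} → (∀ t → g t ≢ t) → RedG1 k α → Good k g
  redG1⁻ {k} g-moves (red , genus , zk) = pg , g-moves , reduced⁻ S pg (reduced-cong h red) , trans (sym z-α) zk ,
    lia (z α ∷ z β ∷ z g ∷ k ∷ m ∷ n ∷ []) (λ a b z k m n → a :≡ k ∷ con 1 :+ m :+ b :≡ z :+
        (con 1 :+ n) ∷ a :+ b :+ con 2 :≡ con 1 :+ n :+ con 1 ∷ [] ,
      z :+ k :+ con 1 :≡ con 1 :+ m) zk z-β genus

record Decomposition {n} (k : ℕ) (α : Fun (suc n)) : Set where
  field
    {m} : ℕ
    S : suc m ⊑ suc n
    g : Fun (suc m)
    agrees : ∀ i → α i ≡ ζ (expand S g i)
    good : Good k g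

ζ-not-reduced : ∀ {n} {α : Fun n} → Fin n → (∀ i → α i ≡ ζ i) → ¬ Reduced α
ζ-not-reduced {n} {α} i h red = loop (Perm.period ζ-perm i)
  where
  step : ∀ j → α (shift i j) ≡ shift i (suc j)
  step j = trans (h _) (trans (cong ζ (shift-iter i j)) (sym (shift-iter i (suc j))))
  loop : (∃ λ p → p < n × iter ζ (suc p) i ≡ i) → ⊥
  loop (p , p<n , e) = red (i , fromℕ< p<n , (λ j → step (toℕ j)) ,
    trans (step _) (trans (cong (shift i ∘ suc) (toℕ-fromℕ< p<n)) (trans (shift-iter i (suc p)) e)))

decompose : ∀ {n k} {α : Fun (suc n)} → IsPerm α → RedG1 k α → Decomposition k α
-- `go` generalises the size of the support so that it can be split into zero and a successor. Size
-- zero means α = ζ, which is one trivial cycle.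
decompose {n} {k} {α} pα r@(red , _) = go _ (support moved?) (support-sound moved?) (support-complete moved?)
  where
  γ : Fun (suc n)
  γ i = ζ⁻¹ (α i)
  ζγ : ∀ i → ζ (γ i) ≡ α i
  ζγ i = ζ-ζ⁻¹ (α i)
  pγ : IsPerm γ
  pγ = ∘-perm ζ⁻¹-perm pα
  moved? : ∀ i → Dec (γ i ≢ i)
  moved? i = ¬? (γ i F.≟ i)
  go : ∀ c (S : c ⊑ suc n) → (∀ i → i ∈ˢ S → γ i ≢ i) → (∀ i → γ i ≢ i → i ∈ˢ S) → Decomposition k α
  go zero S sound complete = ⊥-elim (ζ-not-reduced zero (λ i → trans (sym (ζγ i)) (cong ζ (fixed i))) red)
    where
    fixed : ∀ i → γ i ≡ i
    fixed i = cases (γ i F.≟ i)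
      where
      cases : Dec (γ i ≡ i) → γ i ≡ i
      cases (yes p) = p
      cases (no ≢) = ⊥-elim (FP.¬Fin0 (proj₁ (complete i ≢)))
  go (suc m) S sound complete = record { S = S ; g = g ; agrees = agrees ; good = Decomposed.redG1⁻ S pg pα agrees g-moves r }
    where
    image : ∀ t → γ (emb S t) ∈ˢ S
    image t = complete _ (λ e → sound _ (t , refl) (pγ _ _ e))
    g : Fun (suc m)
    g t = proj₁ (image t)
    emb-g : ∀ t → emb S (g t) ≡ γ (emb S t)
    emb-g t = proj₂ (image t)
    pg : IsPerm g
    pg s t eq = emb-injective S (pγ _ _ (trans (sym (emb-g s)) (trans (cong (emb S) eq) (emb-g t))))
    g-moves : ∀ t → g t ≢ t
    g-moves t eq = sound _ (t , refl) (trans (sym (emb-g t)) (cong (emb S) eq))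
    agrees : ∀ i → α i ≡ ζ (expand S g i)
    agrees i = trans (sym (ζγ i)) (cong ζ (cases (locate S i)))
      where
      outside : ¬ i ∈ˢ S → Dec (γ i ≡ i) → γ i ≡ expand S g i
      outside ∉ (yes p) = trans p (sym (expand-∉ S g ∉))
      outside ∉ (no ≢) = ⊥-elim (∉ (complete i ≢))
      cases : Dec (i ∈ˢ S) → γ i ≡ expand S g i
      cases (yes (t , refl)) = trans (sym (emb-g t)) (sym (expand-∈ S g t))
      cases (no ∉) = outside ∉ (γ i F.≟ i)

-- The binomial factor: a subset together with a good map

lookup-ext : ∀ {A : Set} {n} {u v : Vec A n} → (∀ i → lookup u i ≡ lookup v i) → u ≡ v
lookup-ext {u = u} {v} h = trans (sym (VP.tabulate∘lookup u)) (trans (VP.tabulate-cong h) (VP.tabulate∘lookup v))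

isPerm-cong : ∀ {n} {f g : Fun n} → (∀ i → f i ≡ g i) → IsPerm f → IsPerm g
isPerm-cong h p i j e = p i j (trans (h i) (trans e (sym (h j))))

good-cong : ∀ {m k} {f g : Fun m} → (∀ i → f i ≡ g i) → Good k f → Good k g
good-cong {f = f} {g} h (pf , f-moves , α-moves , zk , e) = pg , (λ t q → f-moves t (trans (h t) q)) , (λ t q → α-moves t (trans (cong ζ (h t)) q)) ,
  trans (z-cong (∘-perm ζ-perm pg) (∘-perm ζ-perm pf) (λ t → cong ζ (sym (h t)))) zk ,
  trans (cong (λ w → w + _ + 1) (z-cong pg pf (λ t → sym (h t)))) e
  where pg = isPerm-cong h pf

∈-goods⁻ : ∀ {m k v} → v ∈ goods m k → Good k (lookup v)
∈-goods⁻ {m} {k} v∈ = proj₂ (∈P.∈-filter⁻ (λ v → good? k (lookup v)) {xs = allVecs m m} v∈)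

∈-goods⁺ : ∀ {m k v} → Good k (lookup v) → v ∈ goods m k
∈-goods⁺ {m} {k} {v} G = ∈P.∈-filter⁺ (λ v → good? k (lookup v)) (allVecs-complete m v) G

goods-unique : ∀ m k → Unique (goods m k)
goods-unique m k = UP.filter⁺ (λ v → good? k (lookup v)) (allVecs-unique m m)

length-cartesianProduct : ∀ {A B : Set} (xs : List A) (ys : List B) → length (cartesianProduct xs ys) ≡ length xs * length ys
length-cartesianProduct [] ys = refl
length-cartesianProduct (x ∷ xs) ys = trans (LP.length-++ (map (x ,_) ys))
  (cong₂ _+_ (LP.length-map (x ,_) ys) (length-cartesianProduct xs ys))

abstract
  assemble : ∀ {m n} → (m ⊑ n) × Vec (Fin m) m → Vec (Fin n) n
  assemble (S , v) = tabulate (λ i → ζ (expand S (lookup v) i))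

  lookup-assemble : ∀ {m n} (S : m ⊑ n) v i → lookup (assemble (S , v)) i ≡ ζ (expand S (lookup v) i)
  lookup-assemble S v i = VP.lookup∘tabulate _ i

expand-cong : ∀ {m n} (S : m ⊑ n) {f g : Fun m} → (∀ t → f t ≡ g t) → ∀ i → expand S f i ≡ expand S g i
expand-cong S h i with locate S i
... | yes (t , _) = cong (emb S) (h t)
... | no _ = refl

-- A point of S is moved by γ, so it belongs to every subset from which the same permutation is
-- assembled.
assemble-image : ∀ {m n k} {S S′ : m ⊑ n} {u u′} → Good k (lookup u) → assemble (S , u) ≡ assemble (S′ , u′) → ∀ i → i ∈ˢ S → i ∈ˢ S′
assemble-image {S = S} {S′} {u} {u′} (_ , moves , _) e i (t , refl) = cases (locate S′ (emb S t))
  where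
  eq : expand S (lookup u) (emb S t) ≡ expand S′ (lookup u′) (emb S t)
  eq = ζ-perm _ _ (trans (sym (lookup-assemble S u _)) (trans (cong (λ v → lookup v (emb S t)) e) (lookup-assemble S′ u′ _)))
  cases : Dec (emb S t ∈ˢ S′) → emb S t ∈ˢ S′
  cases (yes p) = p
  cases (no ∉) = ⊥-elim (moves t (emb-injective S (trans (sym (expand-∈ S (lookup u) t)) (trans eq (expand-∉ S′ (lookup u′) ∉)))))

assemble-injective : ∀ {m n k} {S S′ : m ⊑ n} {u u′} → Good k (lookup u) → Good k (lookup u′) →
  assemble (S , u) ≡ assemble (S′ , u′) → (S , u) ≡ (S′ , u′)
assemble-injective {S = S} {S′} {u} {u′} G G′ e = same (⊑-ext S S′ (assemble-image G e) (assemble-image G′ (sym e))) e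
  where
  same : ∀ {S′} → S ≡ S′ → assemble (S , u) ≡ assemble (S′ , u′) → (S , u) ≡ (S′ , u′)
  same refl e = cong (S ,_) (lookup-ext λ t → emb-injective S (trans (sym (expand-∈ S (lookup u) t)) (trans
    (ζ-perm _ _ (trans (sym (lookup-assemble S u _)) (trans (cong (λ v → lookup v (emb S t)) e) (lookup-assemble S u′ _))))
    (expand-∈ S (lookup u′) t))))

Counted : ∀ {n} → ℕ → ℕ → Fun n → Set
Counted k j α = IsPerm α × RedG1 k α × numBack α ≡ j

assemble-counted : ∀ {m n k j} (S : m ⊑ suc n) {u : Vec (Fin m) m} → Good (suc k) (lookup u) → m ≡ 2 * suc k + j →
  Counted (suc k) j (lookup (assemble (S , u)))
assemble-counted {suc m} {k = k} {j} S {u} G size = pα , D.redG1⁺ G , ℕP.+-cancelʳ-≡ (2 * suc k) _ _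
    (trans (D.back-points G) (trans size (+-comm (2 * suc k) j)))
  where
  pα : IsPerm (lookup (assemble (S , u)))
  pα = isPerm-cong (λ i → sym (lookup-assemble S u i)) (∘-perm ζ-perm (expand-perm S (proj₁ G)))
  module D = Decomposed S (proj₁ G) pα (lookup-assemble S u)

counted-assemble : ∀ {m n k j} (v : Vec (Fin (suc n)) (suc n)) → Counted k j (lookup v) → m ≡ 2 * k + j →
  ∃ λ (S : m ⊑ suc n) → ∃ λ u → Good k (lookup u) × v ≡ assemble (S , u)
counted-assemble {k = k} {j} v (pα , red , nb) size = transport (trans size′ (sym size)) S g agrees good
  where
  open Decomposition (decompose pα red)
  size′ : suc m ≡ 2 * k + j
  size′ = trans (sym (Decomposed.back-points S (proj₁ good) pα agrees good)) (trans (cong (_+ 2 * k) nb) (+-comm j _))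
  transport : ∀ {c m} → c ≡ m → (S : c ⊑ _) (g : Fun c) → (∀ i → lookup v i ≡ ζ (expand S g i)) → Good k g →
    ∃ λ (S : m ⊑ _) → ∃ λ u → Good k (lookup u) × v ≡ assemble (S , u)
  transport refl S g agrees good = S , tabulate g , good-cong (λ i → sym (VP.lookup∘tabulate g i)) good ,
    lookup-ext λ i → trans (agrees i) (trans (cong ζ (expand-cong S (λ t → sym (VP.lookup∘tabulate g t)) i)) (sym (lookup-assemble S (tabulate g) i)))

-- `assemble` is a bijection: the subset is recovered as the support of γ and the good map as the
-- action of γ on it. The relation between m, k and j holds for every permutation counted, so a
-- single m suffices.
rj-goods : ∀ j n k {m} → m ≡ 2 * suc k + j → rj j (suc n) (suc k) ≡ (suc n C m) * length (goods m (suc k))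
rj-goods j n k {m} size = begin
  rj j (suc n) (suc k) ≡⟨ length-cong (UP.filter⁺ P? (allVecs-unique (suc n) (suc n)))
      (map-unique assemble (UP.cartesianProduct⁺ (subsets-unique m (suc n)) (goods-unique m (suc k))) injective) to from ⟩
  length (map assemble pairs) ≡⟨ LP.length-map assemble pairs ⟩
  length pairs ≡⟨ length-cartesianProduct (subsets m (suc n)) (goods m (suc k)) ⟩
  length (subsets m (suc n)) * length (goods m (suc k)) ≡⟨ cong (_* length (goods m (suc k))) (length-subsets m (suc n)) ⟩
  (suc n C m) * length (goods m (suc k)) ∎
  where
  open ≡-Reasoning
  pairs = cartesianProduct (subsets m (suc n)) (goods m (suc k))
  P? : ∀ (v : Vec (Fin (suc n)) (suc n)) → Dec (Counted (suc k) j (lookup v))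
  P? v = isPerm? (lookup v) ×-dec (redG1? (suc k) (lookup v) ×-dec (numBack (lookup v) ℕP.≟ j))
  pair-good : ∀ {S u} → (S , u) ∈ pairs → Good (suc k) (lookup u)
  pair-good p = ∈-goods⁻ (proj₂ (∈P.∈-cartesianProduct⁻ (subsets m (suc n)) (goods m (suc k)) p))
  from : ∀ {v} → v ∈ map assemble pairs → v ∈ filter P? (allVecs (suc n) (suc n))
  from {v} v∈ = helper (∈P.∈-map⁻ assemble v∈)
    where
    helper : (∃ λ x → x ∈ pairs × v ≡ assemble x) → v ∈ filter P? (allVecs (suc n) (suc n))
    helper ((S , u) , p , e) = ∈P.∈-filter⁺ P? (allVecs-complete (suc n) v)
        (subst (λ w → Counted (suc k) j (lookup w)) (sym e) (assemble-counted S (pair-good p) size))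
  to : ∀ {v} → v ∈ filter P? (allVecs (suc n) (suc n)) → v ∈ map assemble pairs
  to {v} v∈ = helper (counted-assemble v (proj₂ (∈P.∈-filter⁻ P? {xs = allVecs (suc n) (suc n)} v∈)) size)
    where
    helper : (∃ λ (S : m ⊑ suc n) → ∃ λ u → Good (suc k) (lookup u) × v ≡ assemble (S , u)) → v ∈ map assemble pairs
    helper (S , u , G , e) = subst (_∈ map assemble pairs) (sym e) (∈P.∈-map⁺ assemble (∈P.∈-cartesianProduct⁺ (subsets-complete S) (∈-goods⁺ G)))
  injective : ∀ {x y} → x ∈ pairs → y ∈ pairs → assemble x ≡ assemble y → x ≡ y
  injective x∈ y∈ = assemble-injective (pair-good x∈) (pair-good y∈)

redG1-back : ∀ {n k} {α : Fun (suc n)} → IsPerm α → RedG1 k α → numBack α ≤ 2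
redG1-back {k = k} {α} pα red = lia (numBack α ∷ k ∷ m ∷ []) (λ b k m → b :+ 2 :* k :≡ con 1 :+ m ∷ con 1 :+ m :≤ 2 :* k :+ con 2 ∷ [] , b :≤ con 2)
  (Decomposed.back-points S (proj₁ good) pα agrees good) (good-bound good)
  where open Decomposition (decompose pα red)

length-filter-∷ : ∀ {A : Set} {P : A → Set} (P? : ∀ a → Dec (P a)) x xs → length (filter P? (x ∷ xs)) ≡ ι (P? x) + length (filter P? xs)
length-filter-∷ P? x xs with P? x
... | yes _ = refl
... | no _ = refl

ι-values : ∀ {A B : Set} {b} (d : Dec (A × B)) (q : ∀ j → Dec (A × B × b ≡ j)) → (A → B → b ≤ 2) → ι d ≡ ι (q 0) + ι (q 1) + ι (q 2)
ι-values (no ¬d) q h = sym (cong₂ _+_ (cong₂ _+_ (none 0) (none 1)) (none 2))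
  where
  none : ∀ j → ι (q j) ≡ 0
  none j = ι-no (q j) λ (a , c , _) → ¬d (a , c)
ι-values {b = b} (yes (a , c)) q h with b | h a c
... | 0 | _ = sym (cong₂ _+_ (cong₂ _+_ (ι-yes (q 0) (a , c , refl)) (ι-no (q 1) λ { (_ , _ , ()) })) (ι-no (q 2) λ { (_ , _ , ()) }))
... | 1 | _ = sym (cong₂ _+_ (cong₂ _+_ (ι-no (q 0) λ { (_ , _ , ()) }) (ι-yes (q 1) (a , c , refl))) (ι-no (q 2) λ { (_ , _ , ()) }))
... | 2 | _ = sym (cong₂ _+_ (cong₂ _+_ (ι-no (q 0) λ { (_ , _ , ()) }) (ι-no (q 1) λ { (_ , _ , ()) })) (ι-yes (q 2) (a , c , refl)))
... | suc (suc (suc _)) | s≤s (s≤s ())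

length-filter-values : ∀ {A : Set} {P R : A → Set} {b : A → ℕ} (P? : ∀ a → Dec (P a × R a)) (Q? : ∀ j a → Dec (P a × R a × b a ≡ j)) →
  (∀ a → P a → R a → b a ≤ 2) → ∀ xs →
  length (filter P? xs) ≡ length (filter (Q? 0) xs) + length (filter (Q? 1) xs) + length (filter (Q? 2) xs)
length-filter-values P? Q? h [] = refl
length-filter-values P? Q? h (x ∷ xs)
  rewrite length-filter-∷ P? x xs | length-filter-∷ (Q? 0) x xs | length-filter-∷ (Q? 1) x xs | length-filter-∷ (Q? 2) x xs =
  lia (ι (P? x) ∷ ι (Q? 0 x) ∷ ι (Q? 1 x) ∷ ι (Q? 2 x) ∷ length (filter P? xs) ∷ length (filter (Q? 0) xs) ∷ length
      (filter (Q? 1) xs) ∷ length (filter (Q? 2) xs) ∷ [])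
    (λ p a b c l x y w → p :≡ a :+ b :+ c ∷ l :≡ x :+ y :+ w ∷ [] , p :+ l :≡ a :+ x :+ (b :+ y) :+ (c :+ w))
    (ι-values (P? x) (λ j → Q? j x) (h x)) (length-filter-values P? Q? h xs)

rStar-sum : ∀ n k → rStar (suc n) k ≡ rj 0 (suc n) k + rj 1 (suc n) k + rj 2 (suc n) k
rStar-sum n k = length-filter-values
  (λ v → isPerm? (lookup v) ×-dec redG1? k (lookup v))
  (λ j v → isPerm? (lookup v) ×-dec (redG1? k (lookup v) ×-dec (numBack (lookup v) ℕP.≟ j)))
  (λ v → redG1-back) (allVecs (suc n) (suc n))

-- Matchings of genus one

closed-min : ∀ {n} {f : Fun n} → IsPerm f → (P : Fin n → Set) → (∀ x → P x → P (f x)) → ∀ {c} → P c → (∀ x → P x → c F.≤ x) → CycleMin f c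
closed-min {f = f} pf P step {c} pc least = Perm.min-intro pf λ { y (k , refl) → least _ (orbit k) }
  where
  orbit : ∀ k → P (iter f k c)
  orbit zero = pc
  orbit (suc k) = step _ (orbit k)

even≢odd : ∀ a b → a + a ≢ suc (b + b)
even≢odd zero b ()
even≢odd (suc a) b e = even≢odd b a (sym (trans (sym (+-suc a a)) (suc-injective e)))

-- Blocks are indexed by ℕ so that block i ends where block i + 1 starts; from index 8 on they are
-- empty.
pattern 8+ i = suc (suc (suc (suc (suc (suc (suc (suc i)))))))

record Cuts (N : ℕ) : Set where
  constructor cuts
  field
    t₁ t₂ t₃ : ℕ
    t₁<t₂ : t₁ < t₂
    t₂≤t₃ : t₂ ≤ t₃
    t₃<N : t₃ < N

-- Chords of a matching of genus one on a circle of N + N points fall into at most three parallel classes: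
-- up to rotation the circle reads A B C Aᵒ Bᵒ Cᵒ, with C possibly empty.  The blocks of the first half end at
-- t₁, t₂, t₃; the block Aᵒ, and with it A, is cut by the origin.  On the i-th linear block [start i, start (i + 1))
-- the matching is x ↦ total i − x.
module Matching {N} (cuts : Cuts N) where
  open Cuts cuts

  start : ℕ → ℕ
  start 0 = 0
  start 1 = t₁ + 1
  start 2 = t₂ + 1
  start 3 = t₃ + 1
  start 4 = t₁ + t₃ + 2
  start 5 = N + t₁ + 1
  start 6 = N + t₂ + 1
  start 7 = N + t₃ + 1
  start (8+ _) = N + N

  total : ℕ → ℕ
  total 0 = t₁ + t₃ + 1
  total 1 = N + t₁ + t₂ + 1
  total 2 = N + t₂ + t₃ + 1
  total 3 = t₁ + t₃ + 1
  total 4 = N + N + t₁ + t₃ + 1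
  total 5 = N + t₁ + t₂ + 1
  total 6 = N + t₂ + t₃ + 1
  total 7 = N + N + t₁ + t₃ + 1
  total (8+ _) = 0

  cutsLia : ∀ {n} (ρ : Vec ℕ n) (f : N-ary (4 + n) (Term (4 + n)) (List (Atom (4 + n)) × Atom (4 + n))) →
    let ρ′ = N ∷ t₁ ∷ t₂ ∷ t₃ ∷ ρ ; hs = proj₁ (f $ⁿ variables) ; g = proj₂ (f $ⁿ variables) in
    {_ : T (proves (var 1F :< var 2F ∷ var 2F :≤ var 3F ∷ var 3F :< var 0F ∷ hs) g)} → Implication ρ′ hs g
  cutsLia ρ f {c} = implication _ _ _ λ ps → proves-sound _ _ (proj₂ (f $ⁿ variables)) c (t₁<t₂ ∷ t₂≤t₃ ∷ t₃<N ∷ ps)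

  start-step : ∀ i → start i ≤ start (suc i)
  start-step 0 = z≤n
  start-step 1 = cutsLia ([]) (λ N a b c → [] , a :+ con 1 :≤ b :+ con 1)
  start-step 2 = cutsLia ([]) (λ N a b c → [] , b :+ con 1 :≤ c :+ con 1)
  start-step 3 = cutsLia ([]) (λ N a b c → [] , c :+ con 1 :≤ a :+ c :+ con 2)
  start-step 4 = cutsLia ([]) (λ N a b c → [] , a :+ c :+ con 2 :≤ N :+ a :+ con 1)
  start-step 5 = cutsLia ([]) (λ N a b c → [] , N :+ a :+ con 1 :≤ N :+ b :+ con 1)
  start-step 6 = cutsLia ([]) (λ N a b c → [] , N :+ b :+ con 1 :≤ N :+ c :+ con 1)
  start-step 7 = cutsLia ([]) (λ N a b c → [] , N :+ c :+ con 1 :≤ N :+ N)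
  start-step (8+ i) = ≤-refl

  start-mono : ∀ {i j} → i ≤ j → start i ≤ start j
  start-mono {i} {j} i≤j = subst (λ k → start i ≤ start k) (ℕP.m+[n∸m]≡n i≤j) (go (j ∸ i))
    where
    go : ∀ d → start i ≤ start (i + d)
    go zero = ≤-reflexive (cong start (sym (+-identityʳ i)))
    go (suc d) = ≤-trans (go d) (≤-trans (start-step (i + d)) (≤-reflexive (cong start (sym (+-suc i d)))))

  In : ℕ → ℕ → Set
  In i x = start i ≤ x × x < start (suc i)

  In-unique : ∀ {x} i j → In i x → In j x → i ≡ j
  In-unique i j (p , q) (p′ , q′) with ℕP.<-cmp i j
  ... | tri< lt _ _ = ⊥-elim (<⇒≱ q (≤-trans (start-mono lt) p′))
  ... | tri≈ _ e _ = e
  ... | tri> _ _ gt = ⊥-elim (<⇒≱ q′ (≤-trans (start-mono gt) p))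

  block : ∀ x → x < N + N → ∃ λ i → In i x
  block x lt = go 8 lt
    where
    go : ∀ i → x < start i → ∃ λ i → In i x
    go (suc i) lt with x <? start i
    ... | yes lt′ = go i lt′
    ... | no ≮ = i , ≮⇒≥ ≮ , lt

  Chord : ℕ → ℕ → Set
  Chord x y = ∃ λ i → In i x × x + y ≡ total i

  Chord-unique : ∀ {x y y′} → Chord x y → Chord x y′ → y ≡ y′
  Chord-unique {x} (i , p , e) (j , q , e′) with In-unique i j p q
  ... | refl = ℕP.+-cancelˡ-≡ x _ _ (trans e (sym e′))

  In-≤-total : ∀ {x} i → In i x → x ≤ total i
  In-≤-total {x} 0 (p , q) = cutsLia (x ∷ []) (λ N a b c x → x :< a :+ con 1 ∷ [] , x :≤ a :+ c :+ con 1) q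
  In-≤-total {x} 1 (p , q) = cutsLia (x ∷ []) (λ N a b c x → x :< b :+ con 1 ∷ [] , x :≤ N :+ a :+ b :+ con 1) q
  In-≤-total {x} 2 (p , q) = cutsLia (x ∷ []) (λ N a b c x → x :< c :+ con 1 ∷ [] , x :≤ N :+ b :+ c :+ con 1) q
  In-≤-total {x} 3 (p , q) = cutsLia (x ∷ []) (λ N a b c x → x :< a :+ c :+ con 2 ∷ [] , x :≤ a :+ c :+ con 1) q
  In-≤-total {x} 4 (p , q) = cutsLia (x ∷ []) (λ N a b c x → x :< N :+ a :+ con 1 ∷ [] , x :≤ N :+ N :+ a :+ c :+ con 1) q
  In-≤-total {x} 5 (p , q) = cutsLia (x ∷ []) (λ N a b c x → x :< N :+ b :+ con 1 ∷ [] , x :≤ N :+ a :+ b :+ con 1) q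
  In-≤-total {x} 6 (p , q) = cutsLia (x ∷ []) (λ N a b c x → x :< N :+ c :+ con 1 ∷ [] , x :≤ N :+ b :+ c :+ con 1) q
  In-≤-total {x} 7 (p , q) = cutsLia (x ∷ []) (λ N a b c x → x :< N :+ N ∷ [] , x :≤ N :+ N :+ a :+ c :+ con 1) q
  In-≤-total {x} (8+ i) (p , q) = ⊥-elim (≤⇒≯ p q)

  Chord-total : ∀ x → x < N + N → ∃ λ y → Chord x y
  Chord-total x lt with block x lt
  ... | i , p = total i ∸ x , i , p , ℕP.m+[n∸m]≡n (In-≤-total i p)

  Far : ℕ → ℕ → Set
  Far x y = x + 2 ≤ y ⊎ y + 2 ≤ x

  -- Paired blocks have equal totals, so reflection exchanges them: 0 with 3, 1 with 5, 2 with 6, 4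
  -- with 7. The gap of 2 comes from t₁ < t₃ for the pairs 0, 3 and 4, 7, and from t₃ < N for the
  -- others.
  Chord-partner : ∀ {x y} → Chord x y → Chord y x × Far x y
  Chord-partner {x} {y} (i , p , e) = partner i p e
    where
    mirror : ∀ i j {F : Set} → (F → Far x y) → start j ≤ y × y < start (suc j) × F → x + y ≡ total i → total i ≡ total j → Chord y x × Far x y
    mirror i j side (p , q , f) e e′ = (j , (p , q) , trans (+-comm y x) (trans e e′)) , side f
    partner : ∀ i → In i x → x + y ≡ total i → Chord y x × Far x y
    partner 0 (p , q) e = mirror 0 3 inj₁ (cutsLia (x ∷ y ∷ []) (λ N a b c x y → x :< a :+ con 1 ∷ x :+ y :≡ a :+ c :+ con 1 ∷ [] ,
      c :+ con 1 :≤ y :∧ y :< a :+ c :+ con 2 :∧ x :+ con 2 :≤ y) q e) e refl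
    partner 1 (p , q) e = mirror 1 5 inj₁ (cutsLia (x ∷ y ∷ [])
        (λ N a b c x y → a :+ con 1 :≤ x ∷ x :< b :+ con 1 ∷ x :+ y :≡ N :+ a :+ b :+ con 1 ∷ [] ,
      N :+ a :+ con 1 :≤ y :∧ y :< N :+ b :+ con 1 :∧ x :+ con 2 :≤ y) p q e) e refl
    partner 2 (p , q) e = mirror 2 6 inj₁ (cutsLia (x ∷ y ∷ [])
        (λ N a b c x y → b :+ con 1 :≤ x ∷ x :< c :+ con 1 ∷ x :+ y :≡ N :+ b :+ c :+ con 1 ∷ [] ,
      N :+ b :+ con 1 :≤ y :∧ y :< N :+ c :+ con 1 :∧ x :+ con 2 :≤ y) p q e) e refl
    partner 3 (p , q) e = mirror 3 0 inj₂ (z≤n , cutsLia (x ∷ y ∷ []) (λ N a b c x y → c :+ con 1 :≤ x ∷ x :+ y :≡ a :+ c :+ con 1 ∷ [] ,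
      y :< a :+ con 1 :∧ y :+ con 2 :≤ x) p e) e refl
    partner 4 (p , q) e = mirror 4 7 inj₁ (cutsLia (x ∷ y ∷ [])
        (λ N a b c x y → a :+ c :+ con 2 :≤ x ∷ x :< N :+ a :+ con 1 ∷ x :+ y :≡ N :+ N :+ a :+ c :+ con 1 ∷ [] ,
      N :+ c :+ con 1 :≤ y :∧ y :< N :+ N :∧ x :+ con 2 :≤ y) p q e) e refl
    partner 5 (p , q) e = mirror 5 1 inj₂ (cutsLia (x ∷ y ∷ [])
        (λ N a b c x y → N :+ a :+ con 1 :≤ x ∷ x :< N :+ b :+ con 1 ∷ x :+ y :≡ N :+ a :+ b :+ con 1 ∷ [] ,
      a :+ con 1 :≤ y :∧ y :< b :+ con 1 :∧ y :+ con 2 :≤ x) p q e) e refl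
    partner 6 (p , q) e = mirror 6 2 inj₂ (cutsLia (x ∷ y ∷ [])
        (λ N a b c x y → N :+ b :+ con 1 :≤ x ∷ x :< N :+ c :+ con 1 ∷ x :+ y :≡ N :+ b :+ c :+ con 1 ∷ [] ,
      b :+ con 1 :≤ y :∧ y :< c :+ con 1 :∧ y :+ con 2 :≤ x) p q e) e refl
    partner 7 (p , q) e = mirror 7 4 inj₂ (cutsLia (x ∷ y ∷ [])
        (λ N a b c x y → N :+ c :+ con 1 :≤ x ∷ x :< N :+ N ∷ x :+ y :≡ N :+ N :+ a :+ c :+ con 1 ∷ [] ,
      a :+ c :+ con 2 :≤ y :∧ y :< N :+ a :+ con 1 :∧ y :+ con 2 :≤ x) p q e) e refl
    partner (8+ i) (p , q) e = ⊥-elim (≤⇒≯ p q)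

  Chord-sym : ∀ {x y} → Chord x y → Chord y x
  Chord-sym c = proj₁ (Chord-partner c)

  Chord-bound : ∀ {x y} → Chord x y → x < N + N
  Chord-bound (i , (p , q) , _) = <-≤-trans q (top i)
    where
    top : ∀ i → start (suc i) ≤ N + N
    top i = start-mono {suc i} {8+ i} (s≤s (ℕP.m≤n+m i 7))

  Chord-far : ∀ {x y} → Chord x y → Far x y
  Chord-far c = proj₂ (Chord-partner c)

  Chord-not-wrapped : ∀ {y} → Chord 0 y → suc y ≢ N + N
  Chord-not-wrapped {y} (i , p , e) = near i p e
    where
    positive : ∀ i → 1 ≤ i → In i 0 → ⊥
    positive i 1≤i (p , _) = <-irrefl refl (≤-trans (≤-trans (ℕP.m≤n+m 1 t₁) (start-mono 1≤i)) p)
    near : ∀ i → In i 0 → y ≡ total i → suc y ≢ N + N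
    near 0 p e e′ = cutsLia (y ∷ []) (λ N a b c y → y :≡ a :+ c :+ con 1 ∷ con 1 :+ y :≡ N :+ N ∷ [] , :⊥) e e′
    near (suc i) p e e′ = positive (suc i) (s≤s z≤n) p

  chord-0 : ∀ {y} → y ≡ t₁ + t₃ + 1 → Chord 0 y
  chord-0 e = 0 , (z≤n , ℕP.m≤n+m 1 t₁) , e

  chord-t₁ : Chord (t₁ + 1) (N + t₂)
  chord-t₁ = 1 , cutsLia ([]) (λ N a b c → [] , a :+ con 1 :≤ a :+ con 1 :∧ a :+ con 1 :< b :+ con 1)  ,
    lia (N ∷ t₁ ∷ t₂ ∷ t₃ ∷ []) (λ N a b c → [] , a :+ con 1 :+ (N :+ b) :≡ N :+ a :+ b :+ con 1)

  chord-t₃ : Chord (t₃ + 1) (t₁)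
  chord-t₃ = 3 , cutsLia ([]) (λ N a b c → [] , c :+ con 1 :≤ c :+ con 1 :∧ c :+ con 1 :< a :+ c :+ con 2)  ,
    lia (N ∷ t₁ ∷ t₂ ∷ t₃ ∷ []) (λ N a b c → [] , c :+ con 1 :+ (a) :≡ a :+ c :+ con 1)

  chord-N+t₁ : Chord (N + t₁ + 1) (t₂)
  chord-N+t₁ = 5 , cutsLia ([]) (λ N a b c → [] , N :+ a :+ con 1 :≤ N :+ a :+ con 1 :∧ N :+ a :+ con 1 :< N :+ b :+ con 1)  ,
    lia (N ∷ t₁ ∷ t₂ ∷ t₃ ∷ []) (λ N a b c → [] , N :+ a :+ con 1 :+ (b) :≡ N :+ a :+ b :+ con 1)

  chord-t₂ : t₂ < t₃ → Chord (t₂ + 1) (N + t₃)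
  chord-t₂ h = 2 , cutsLia ([]) (λ N a b c → b :< c ∷ [] , b :+ con 1 :≤ b :+ con 1 :∧ b :+ con 1 :< c :+ con 1) h ,
    lia (N ∷ t₁ ∷ t₂ ∷ t₃ ∷ []) (λ N a b c → [] , b :+ con 1 :+ (N :+ c) :≡ N :+ b :+ c :+ con 1)

  chord-N+t₂ : t₂ < t₃ → Chord (N + t₂ + 1) (t₃)
  chord-N+t₂ h = 6 , cutsLia ([]) (λ N a b c → b :< c ∷ [] , N :+ b :+ con 1 :≤ N :+ b :+ con 1 :∧ N :+ b :+ con 1 :< N :+ c :+ con 1) h ,
    lia (N ∷ t₁ ∷ t₂ ∷ t₃ ∷ []) (λ N a b c → [] , N :+ b :+ con 1 :+ (c) :≡ N :+ b :+ c :+ con 1)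

  chord-N+t₃ : N + t₃ + 1 < N + N → Chord (N + t₃ + 1) (N + t₁)
  chord-N+t₃ h = 7 , cutsLia ([]) (λ N a b c → N :+ c :+ con 1 :< N :+ N ∷ [] , N :+ c :+ con 1 :≤ N :+ c :+ con 1 :∧ N :+ c :+ con 1 :< N :+ N) h ,
    lia (N ∷ t₁ ∷ t₂ ∷ t₃ ∷ []) (λ N a b c → [] , N :+ c :+ con 1 :+ (N :+ a) :≡ N :+ N :+ a :+ c :+ con 1)

  Cut : ℕ → Set
  Cut x = (x ≡ t₁ ⊎ x ≡ t₂ ⊎ x ≡ t₃) ⊎ (x ≡ N + t₁ ⊎ x ≡ N + t₂ ⊎ x ≡ N + t₃)

  -- Away from the cuts consecutive chords are parallel.
  chord-next : ∀ {x y} → ¬ Cut x → Chord x y → suc x < N + N →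
    (∃ λ w → y ≡ suc w × Chord (suc x) w) ⊎ (y ≡ 0 × ∃ λ w → suc w ≡ N + N × Chord (suc x) w)
  chord-next {x} {y} ¬cut (i , p , e) lt = cases i p e
    where
    Next = (∃ λ w → y ≡ suc w × Chord (suc x) w) ⊎ (y ≡ 0 × ∃ λ w → suc w ≡ N + N × Chord (suc x) w)
    boundary : ∀ {a} → x < a + 1 → ¬ suc x < a + 1 → x ≡ a
    boundary {a} q ≮ = lia (x ∷ a ∷ []) (λ x a → x :< a :+ con 1 ∷ a :+ con 1 :≤ con 1 :+ x ∷ [] , x :≡ a) q (≮⇒≥ ≮)
    inner : ∀ i → In i x → x + y ≡ total i → (¬ suc x < start (suc i) → Next) → Next
    inner i (p , q) e outer with suc x <? start (suc i)
    ... | no ≮ = outer ≮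
    ... | yes lt′ = inj₁ (total i ∸ suc x , ℕP.+-cancelˡ-≡ x _ _ (trans e (sym (trans (+-suc x _) (ℕP.m+[n∸m]≡n le)))) ,
          i , in′ , ℕP.m+[n∸m]≡n le)
      where
      in′ : In i (suc x)
      in′ = ≤-trans p (ℕP.n≤1+n x) , lt′
      le = In-≤-total i in′
    -- Blocks 3 and 4 meet inside Aᵒ, where the partner passes the origin from 0 to N + N - 1.
    wrap : In 3 x → x + y ≡ total 3 → ¬ suc x < start 4 → Next
    wrap (p , q) e ≮ = inj₂ (lia (N ∷ t₁ ∷ t₂ ∷ t₃ ∷ x ∷ y ∷ [])
        (λ N a b c x y → x :+ y :≡ a :+ c :+ con 1 ∷ a :+ c :+ con 2 :≤ con 1 :+ x ∷ [] , y :≡ con 0) e (≮⇒≥ ≮) ,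
        (N + N ∸ 1) , w≡ , 4 , (≮⇒≥ ≮ , in₄) ,
        lia (N ∷ t₁ ∷ t₂ ∷ t₃ ∷ x ∷ N + N ∸ 1 ∷ [])
            (λ N a b c x w → con 1 :+ w :≡ N :+ N ∷ x :< a :+ c :+ con 2 ∷ a :+ c :+ con 2 :≤ con 1 :+ x ∷ [] ,
          con 1 :+ x :+ w :≡ N :+ N :+ a :+ c :+ con 1) w≡ q (≮⇒≥ ≮))
      where
      w≡ : suc (N + N ∸ 1) ≡ N + N
      w≡ = ℕP.m+[n∸m]≡n {1} (≤-trans (s≤s z≤n) lt)
      in₄ : suc x < start 5
      -- If block 4 is empty, then x is already the cut N + t₁.
      in₄ with m≤n⇒m<n∨m≡n (≤-trans q (start-step 4))
      ... | inj₁ lt′ = lt′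
      ... | inj₂ eq = ⊥-elim (¬cut (inj₂ (inj₁ (lia (N ∷ t₁ ∷ x ∷ []) (λ N a x → con 1 :+ x :≡ N :+ a :+ con 1 ∷ [] , x :≡ N :+ a) eq))))
    cases : ∀ i → In i x → x + y ≡ total i → Next
    cases 0 p e = inner 0 p e λ ≮ → ⊥-elim (¬cut (inj₁ (inj₁ (boundary (proj₂ p) ≮))))
    cases 1 p e = inner 1 p e λ ≮ → ⊥-elim (¬cut (inj₁ (inj₂ (inj₁ (boundary (proj₂ p) ≮)))))
    cases 2 p e = inner 2 p e λ ≮ → ⊥-elim (¬cut (inj₁ (inj₂ (inj₂ (boundary (proj₂ p) ≮)))))
    cases 3 p e = inner 3 p e (wrap p e)
    cases 4 p e = inner 4 p e λ ≮ → ⊥-elim (¬cut (inj₂ (inj₁ (boundary (proj₂ p) ≮))))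
    cases 5 p e = inner 5 p e λ ≮ → ⊥-elim (¬cut (inj₂ (inj₂ (inj₁ (boundary (proj₂ p) ≮)))))
    cases 6 p e = inner 6 p e λ ≮ → ⊥-elim (¬cut (inj₂ (inj₂ (inj₂ (boundary (proj₂ p) ≮)))))
    cases 7 p e = inner 7 p e λ ≮ → ⊥-elim (≮ lt)
    cases (8+ i) (p , q) e = ⊥-elim (≤⇒≯ p q)

  -- The last point and the origin are parallel as well, unless the last point is a cut.
  chord-last : ∀ {x y} → ¬ Cut x → Chord x y → suc x ≡ N + N → ∃ λ w → y ≡ suc w × Chord 0 w
  chord-last {x} {y} ¬cut (i , p , e) end = cases i p e
    where
    -- If the last point lies before block 7, then that block is empty and the last point is the cut
    -- N + t₃.
    early : ∀ i → suc i ≤ 7 → x < start (suc i) → ∃ λ w → y ≡ suc w × Chord 0 w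
    early i le q = ⊥-elim (¬cut (inj₂ (inj₂ (inj₂
      (lia (N ∷ t₃ ∷ x ∷ []) (λ N c x → x :< N :+ c :+ con 1 ∷ con 1 :+ x :≡ N :+ N ∷ c :< N ∷ [] , x :≡ N :+ c)
        (<-≤-trans q (start-mono le)) end t₃<N)))))
    cases : ∀ i → In i x → x + y ≡ total i → ∃ λ w → y ≡ suc w × Chord 0 w
    cases i p e with suc i ≤? 7
    ... | yes le = early i le (proj₂ p)
    cases 7 p e | no _ = t₁ + t₃ + 1 , lia (N ∷ t₁ ∷ t₃ ∷ x ∷ y ∷ []) (λ N a c x y → con 1 :+ x :≡ N :+ N ∷ x :+ y :≡ N :+ N :+ a :+ c :+ con 1 ∷ [] ,
      y :≡ con 1 :+ (a :+ c :+ con 1)) end e , chord-0 refl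
    cases (8+ i) (p , q) e | no _ = ⊥-elim (≤⇒≯ p q)
    cases 0 p e | no ≰ = ⊥-elim (≰ (s≤s z≤n))
    cases 1 p e | no ≰ = ⊥-elim (≰ (s≤s (s≤s z≤n)))
    cases 2 p e | no ≰ = ⊥-elim (≰ (s≤s (s≤s (s≤s z≤n))))
    cases 3 p e | no ≰ = ⊥-elim (≰ (s≤s (s≤s (s≤s (s≤s z≤n)))))
    cases 4 p e | no ≰ = ⊥-elim (≰ (s≤s (s≤s (s≤s (s≤s (s≤s z≤n))))))
    cases 5 p e | no ≰ = ⊥-elim (≰ (s≤s (s≤s (s≤s (s≤s (s≤s (s≤s z≤n)))))))
    cases 6 p e | no ≰ = ⊥-elim (≰ (s≤s (s≤s (s≤s (s≤s (s≤s (s≤s (s≤s z≤n))))))))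

module MatchingOnCircle {L N} (cuts : Cuts N) (L≡ : L ≡ N + N) where
  open Cuts cuts
  open Matching cuts

  private
    partner : ∀ x → ∃ (Chord (toℕ {L} x))
    partner x = Chord-total (toℕ x) (subst (toℕ x <_) L≡ (toℕ<n x))

  abstract
    M : Fun L
    M x = fromℕ< (subst (proj₁ (partner x) <_) (sym L≡) (Chord-bound (Chord-sym (proj₂ (partner x)))))

    chord-M : ∀ x → Chord (toℕ x) (toℕ (M x))
    chord-M x = subst (Chord (toℕ x)) (sym (toℕ-fromℕ< _)) (proj₂ (partner x))

  M-value : ∀ {x y} → Chord (toℕ x) y → toℕ (M x) ≡ y
  M-value {x} c = Chord-unique (chord-M x) c

  M-chord : ∀ {x y} → Chord (toℕ x) (toℕ y) → M x ≡ y
  M-chord c = toℕ-injective (M-value c)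

  M-involutive : ∀ x → M (M x) ≡ x
  M-involutive x = M-chord (Chord-sym (chord-M x))

  M-perm : IsPerm M
  M-perm x y e = trans (sym (M-involutive x)) (trans (cong M e) (M-involutive y))

  far-≢ : ∀ {x y d} → d ≤ 1 → x + 2 ≤ y ⊎ y + 2 ≤ x → d + x ≢ y
  far-≢ {x} {d = d} d≤1 (inj₁ p) refl = lia (x ∷ d ∷ []) (λ x d → d :≤ con 1 ∷ x :+ con 2 :≤ d :+ x ∷ [] , :⊥) d≤1 p
  far-≢ {x} {d = d} d≤1 (inj₂ p) refl = lia (x ∷ d ∷ []) (λ x d → d :+ x :+ con 2 :≤ x ∷ [] , :⊥) p

  M-moves : ∀ x → M x ≢ x
  M-moves x e = far-≢ z≤n (Chord-far (chord-M x)) (cong toℕ (sym e))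

  M-not-next : ∀ x → M x ≢ ζ x
  M-not-next x e with ζ-view x
  ... | next _ p = far-≢ (s≤s z≤n) (Chord-far (chord-M x)) (trans (sym p) (cong toℕ (sym e)))
  ... | last p q = Chord-not-wrapped (subst (λ w → Chord w (toℕ x)) (trans (cong toℕ e) q) (Chord-sym (chord-M x))) (trans p L≡)

  φ : Fun L
  φ x = M (ζ x)

  φ-perm : IsPerm φ
  φ-perm = ∘-perm M-perm ζ-perm

  φ-moves : ∀ x → φ x ≢ x
  φ-moves x e = M-not-next x (trans (cong M (sym e)) (M-involutive (ζ x)))

  parallel : ∀ x → ¬ Cut (toℕ x) → M x ≡ ζ (φ x)
  parallel x ¬cut with ζ-view x
  ... | last p q with chord-last ¬cut (chord-M x) (trans p L≡)
  ...   | w , e , c = toℕ-injective (trans e (trans (cong suc (sym w≡)) (sym (ζ-next (subst (_< L) (trans e (cong suc (sym w≡))) (toℕ<n (M x)))))))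
    where
    w≡ : toℕ (φ x) ≡ w
    w≡ = M-value (subst (λ v → Chord v w) (sym q) c)
  parallel x ¬cut | next lt p with chord-next ¬cut (chord-M x) (subst (suc (toℕ x) <_) L≡ lt)
  ... | inj₁ (w , e , c) = toℕ-injective (trans e
      (trans (cong suc (sym w≡)) (sym (ζ-next (subst (_< L) (trans e (cong suc (sym w≡))) (toℕ<n (M x)))))))
    where
    w≡ : toℕ (φ x) ≡ w
    w≡ = M-value (subst (λ v → Chord v w) (sym p) c)
  ... | inj₂ (e , w , e′ , c) = toℕ-injective (trans e (sym (ζ-last (trans (cong suc w≡) (trans e′ (sym L≡))))))
    where
    w≡ : toℕ (φ x) ≡ w
    w≡ = M-value (subst (λ v → Chord v w) (sym p) c)

  φφ : ∀ x → ¬ Cut (toℕ x) → φ (φ x) ≡ x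
  φφ x ¬cut = trans (cong M (sym (parallel x ¬cut))) (M-involutive x)

  φ-next : ∀ {x a y} → toℕ x ≡ a → a + 1 < L → Chord (a + 1) y → toℕ (φ x) ≡ y
  φ-next {x} {a} {y} refl lt c = M-value (subst (λ v → Chord v y) (sym (trans (ζ-next (subst (_< L) (+-comm a 1) lt)) (+-comm 1 a))) c)

  private
    small : ∀ {a} → a < N → a + 1 < L
    small {a} lt = subst (a + 1 <_) (sym L≡)
        (lia (a ∷ N ∷ t₁ ∷ t₂ ∷ t₃ ∷ []) (λ a N x y z → x :< y ∷ y :≤ z ∷ z :< N ∷ a :< N ∷ [] , a :+ con 1 :< N :+ N) t₁<t₂ t₂≤t₃ t₃<N lt)
    t₂<N : t₂ < N
    t₂<N = ≤-<-trans t₂≤t₃ t₃<N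
    t₁<N : t₁ < N
    t₁<N = <-trans t₁<t₂ t₂<N
    big : ∀ {a b} → a < b → b < N → N + a + 1 < L
    big {a} {b} lt lt′ = subst (N + a + 1 <_) (sym L≡) (lia (a ∷ b ∷ N ∷ []) (λ a b N → a :< b ∷ b :< N ∷ [] , N :+ a :+ con 1 :< N :+ N) lt lt′)

  φ-t₁ : ∀ {x} → toℕ x ≡ t₁ → toℕ (φ x) ≡ N + t₂
  φ-t₁ e = φ-next e (small t₁<N) chord-t₁

  φ-t₃ : ∀ {x} → toℕ x ≡ t₃ → toℕ (φ x) ≡ t₁
  φ-t₃ e = φ-next e (small t₃<N) chord-t₃

  φ-N+t₁ : ∀ {x} → toℕ x ≡ N + t₁ → toℕ (φ x) ≡ t₂
  φ-N+t₁ e = φ-next e (big t₁<t₂ t₂<N) chord-N+t₁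

  φ-t₂ : t₂ < t₃ → ∀ {x} → toℕ x ≡ t₂ → toℕ (φ x) ≡ N + t₃
  φ-t₂ lt e = φ-next e (small t₂<N) (chord-t₂ lt)

  φ-N+t₂ : t₂ < t₃ → ∀ {x} → toℕ x ≡ N + t₂ → toℕ (φ x) ≡ t₃
  φ-N+t₂ lt e = φ-next e (big lt t₃<N) (chord-N+t₂ lt)

  -- When N + t₃ is the last point, ζ leads to the origin. Block 0 then gives t₁ + t₃ + 1, which is
  -- N + t₁ because N = t₃ + 1.
  φ-N+t₃ : ∀ {x} → toℕ x ≡ N + t₃ → toℕ (φ x) ≡ N + t₁
  φ-N+t₃ {x} e with ζ-view x
  ... | next lt p = φ-next e (subst (_< L) (trans (cong suc e) (+-comm 1 _)) lt)
                      (chord-N+t₃ (subst₂ _<_ (trans (cong suc e) (+-comm 1 _)) L≡ lt))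
  ... | last p q = M-value (subst (λ v → Chord v (N + t₁)) (sym q) (chord-0
      (lia (N ∷ t₁ ∷ t₃ ∷ toℕ x ∷ L ∷ []) (λ N a c x L → L :≡ N :+ N ∷ con 1 :+ x :≡ L ∷ x :≡ N :+ c ∷ [] , N :+ a :≡ a :+ c :+ con 1) L≡ p e)))

  private
    OneOf : List ℕ → Fin L → Set
    OneOf vs x = Any (λ v → toℕ x ≡ v) vs

    one-of-min : ∀ {c vs} → OneOf vs c → (∀ {x} → OneOf vs x → OneOf vs (φ x)) → All (toℕ c ≤_) vs → CycleMin φ c
    one-of-min {c} {vs} c∈ step least = closed-min φ-perm (OneOf vs) (λ _ → step) c∈ (λ x → bound least)
      where
      bound : ∀ {x vs} → All (toℕ c ≤_) vs → OneOf vs x → c F.≤ x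
      bound (p ∷ _) (here refl) = p
      bound (_ ∷ ps) (there q) = bound ps q

    t₁≤N+ : ∀ a → t₁ ≤ N + a
    t₁≤N+ a = ≤-trans (<⇒≤ t₁<N) (m≤m+n N a)
    t₂≤N+ : ∀ a → t₂ ≤ N + a
    t₂≤N+ a = ≤-trans (<⇒≤ t₂<N) (m≤m+n N a)

  -- The cycles of φ through the cuts: two 3-cycles, or one 4-cycle if C is empty.
  t₁-min : ∀ {x} → toℕ x ≡ t₁ → CycleMin φ x
  t₁-min e with m≤n⇒m<n∨m≡n t₂≤t₃
  ... | inj₁ lt = one-of-min {vs = t₁ ∷ N + t₂ ∷ t₃ ∷ []} (here e)
      (λ { (here p) → there (here (φ-t₁ p)) ; (there (here p)) → there (there (here (φ-N+t₂ lt p))) ; (there (there (here p))) → here (φ-t₃ p) })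
      (≤-reflexive e ∷ ≤-trans (≤-reflexive e) (t₁≤N+ t₂) ∷ ≤-trans (≤-reflexive e) (<⇒≤ (<-≤-trans t₁<t₂ t₂≤t₃)) ∷ [])
  ... | inj₂ eq = one-of-min {vs = t₁ ∷ N + t₂ ∷ N + t₁ ∷ t₂ ∷ []} (here e)
      (λ { (here p) → there (here (φ-t₁ p)) ; (there (here p)) → there (there (here (φ-N+t₃ (trans p (cong (λ w → N + w) eq)))))
         ; (there (there (here p))) → there (there (there (here (φ-N+t₁ p)))) ; (there (there (there (here p)))) → here (φ-t₃ (trans p eq)) })
      (≤-reflexive e ∷ ≤-trans (≤-reflexive e) (t₁≤N+ t₂) ∷ ≤-trans (≤-reflexive e) (t₁≤N+ t₁) ∷ ≤-trans (≤-reflexive e) (<⇒≤ t₁<t₂) ∷ [])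

  t₂-min : t₂ < t₃ → ∀ {x} → toℕ x ≡ t₂ → CycleMin φ x
  t₂-min lt e = one-of-min {vs = t₂ ∷ N + t₃ ∷ N + t₁ ∷ []} (here e)
      (λ { (here p) → there (here (φ-t₂ lt p)) ; (there (here p)) → there (there (here (φ-N+t₃ p))) ; (there (there (here p))) → here (φ-N+t₁ p) })
      (≤-reflexive e ∷ ≤-trans (≤-reflexive e) (t₂≤N+ t₃) ∷ ≤-trans (≤-reflexive e) (t₂≤N+ t₁) ∷ [])

  open Derangement φ-perm φ-moves using (size; mid-long; long-count)

  mid-cut : ∀ {x} → Mid φ x → ¬ ¬ Cut (toℕ x)
  mid-cut {x} m ¬cut = mid-long m (φφ x ¬cut)

  one-of : ∀ a b (x : Fin L) → ¬ ¬ Cut (toℕ x) → (toℕ x ≢ a → toℕ x ≢ b → ¬ Cut (toℕ x)) → toℕ x ≡ a ⊎ toℕ x ≡ b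
  one-of a b x ¬¬cut h with toℕ x ℕP.≟ a | toℕ x ℕP.≟ b
  ... | yes p | _ = inj₁ p
  ... | no _ | yes q = inj₂ q
  ... | no p | no q = ⊥-elim (¬¬cut (h p q))

  -- Only cuts can be `Mid`, and those that are minima or are sent to minima drop out. The 3-cycles
  -- (t₁, N + t₂, t₃) and (t₂, N + t₃, N + t₁) leave N + t₂ and N + t₃; the 4-cycle (t₁, N + t₂, N +
  -- t₁, t₂) leaves N + t₁ and N + t₂.
  two-mid : ∃ λ a → ∃ λ b → ∀ x → Mid φ x → toℕ x ≡ a ⊎ toℕ x ≡ b
  two-mid with m≤n⇒m<n∨m≡n t₂≤t₃
  ... | inj₁ lt = N + t₂ , N + t₃ , λ x m → one-of (N + t₂) (N + t₃) x (mid-cut m) λ p q →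
    λ { (inj₁ (inj₁ e)) → proj₁ m (t₁-min e) ; (inj₁ (inj₂ (inj₁ e))) → proj₁ m (t₂-min lt e) ; (inj₁ (inj₂ (inj₂ e))) → proj₂ m (t₁-min (φ-t₃ e))
      ; (inj₂ (inj₁ e)) → proj₂ m (t₂-min lt (φ-N+t₁ e)) ; (inj₂ (inj₂ (inj₁ e))) → p e ; (inj₂ (inj₂ (inj₂ e))) → q e }
  ... | inj₂ eq = N + t₁ , N + t₂ , λ x m → one-of (N + t₁) (N + t₂) x (mid-cut m) λ p q →
    λ { (inj₁ (inj₁ e)) → proj₁ m (t₁-min e) ; (inj₁ (inj₂ (inj₁ e))) → proj₂ m (t₁-min (φ-t₃ (trans e eq))) ;
        (inj₁ (inj₂ (inj₂ e))) → proj₂ m (t₁-min (φ-t₃ e))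
      ; (inj₂ (inj₁ e)) → p e ; (inj₂ (inj₂ (inj₁ e))) → q e ; (inj₂ (inj₂ (inj₂ e))) → q (trans e (cong (λ w → N + w) (sym eq))) }

  mid-≤2 : count (mid? φ) ≤ 2
  mid-≤2 with two-mid
  ... | a , b , h = ≤-trans (count-≤-sum (mid? φ) (λ x → ι (toℕ x ℕP.≟ a) + ι (toℕ x ℕP.≟ b)) λ x m → weight (toℕ x ℕP.≟ a) (toℕ x ℕP.≟ b) (h x m))
      (≤-trans (≤-reflexive (sum-+ {L} (λ x → ι (toℕ x ℕP.≟ a)) (λ x → ι (toℕ x ℕP.≟ b)))) (ℕP.+-mono-≤ (single a) (single b)))
    where
    weight : ∀ {A B : Set} (d : Dec A) (e : Dec B) → A ⊎ B → 1 ≤ ι d + ι e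
    weight (yes _) _ _ = s≤s z≤n
    weight (no _) (yes _) _ = s≤s z≤n
    weight (no ¬a) (no ¬b) (inj₁ a) = ⊥-elim (¬a a)
    weight (no ¬a) (no ¬b) (inj₂ b) = ⊥-elim (¬b b)
    single : ∀ a → count {L} (λ x → toℕ x ℕP.≟ a) ≤ 1
    single a = count-inj {m = L} {n = 1} (λ x → toℕ x ℕP.≟ a) (λ _ → yes tt) (λ _ → zero) (λ _ _ → tt) (λ i j p q _ → toℕ-injective (trans p (sym q)))

  private
    t₂≢N+ : ∀ {a b} → a < N → a ≢ N + b
    t₂≢N+ lt e = <-irrefl e (<-≤-trans lt (m≤m+n N _))

  long-t₁ : ∀ {x} → toℕ x ≡ t₁ → Long φ x
  long-t₁ {x} e e′ with m≤n⇒m<n∨m≡n t₂≤t₃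
  ... | inj₁ lt = <-irrefl (trans (sym e) (trans (cong toℕ (sym e′)) (φ-N+t₂ lt (φ-t₁ e)))) (<-trans t₁<t₂ lt)
  ... | inj₂ eq = t₂≢N+ t₁<N (trans (sym e) (trans (cong toℕ (sym e′)) (φ-N+t₃ (trans (φ-t₁ e) (cong (λ w → N + w) eq)))))

  long-t₃ : ∀ {x} → toℕ x ≡ t₃ → Long φ x
  long-t₃ {x} e e′ = t₂≢N+ t₃<N (trans (sym e) (trans (cong toℕ (sym e′)) (φ-t₁ (φ-t₃ e))))

  long-t₂ : ∀ {x} → toℕ x ≡ t₂ → Long φ x
  long-t₂ {x} e e′ with m≤n⇒m<n∨m≡n t₂≤t₃
  ... | inj₁ lt = t₂≢N+ t₂<N (trans (sym e) (trans (cong toℕ (sym e′)) (φ-N+t₃ (φ-t₂ lt e))))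
  ... | inj₂ eq = long-t₃ (trans e eq) e′

  long-cut : ∀ {x} → toℕ x < N → Long φ x → toℕ x ≡ t₁ ⊎ toℕ x ≡ t₂ ⊎ toℕ x ≡ t₃
  long-cut {x} lt l with toℕ x ℕP.≟ t₁ | toℕ x ℕP.≟ t₂ | toℕ x ℕP.≟ t₃
  ... | yes p | _ | _ = inj₁ p
  ... | _ | yes p | _ = inj₂ (inj₁ p)
  ... | _ | _ | yes p = inj₂ (inj₂ p)
  ... | no p | no q | no r = ⊥-elim (l (φφ x λ
    { (inj₁ (inj₁ e)) → p e ; (inj₁ (inj₂ (inj₁ e))) → q e ; (inj₁ (inj₂ (inj₂ e))) → r e
    ; (inj₂ (inj₁ e)) → t₂≢N+ lt e ; (inj₂ (inj₂ (inj₁ e))) → t₂≢N+ lt e ; (inj₂ (inj₂ (inj₂ e))) → t₂≢N+ lt e }))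

  -- The excess of φ is 2N - 2 z φ, hence even. It is positive because t₁ is long and at most 2 by
  -- `mid-≤2`, so it equals 2.
  z-φ : z φ + 1 ≡ N
  z-φ = finish (count (mid? φ)) refl
    where
    x₁ : Fin L
    x₁ = fromℕ< {t₁} (subst (t₁ <_) (sym L≡) (<-≤-trans t₁<N (m≤m+n N N)))
    positive : 1 ≤ 3 * count (mid? φ)
    positive = ≤-trans (count-positive (long? φ) x₁ (long-t₁ (toℕ-fromℕ< _))) long-count
    finish : ∀ c → count (mid? φ) ≡ c → z φ + 1 ≡ N
    finish 0 e = ⊥-elim (lia (count (mid? φ) ∷ []) (λ c → con 1 :≤ 3 :* c ∷ c :≡ con 0 ∷ [] , :⊥) positive e)
    finish 1 e = ⊥-elim (even≢odd N (z φ) (lia (N ∷ z φ ∷ L ∷ count (mid? φ) ∷ [])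
        (λ N z L c → L :≡ N :+ N ∷ L :≡ 2 :* z :+ c ∷ c :≡ con 1 ∷ [] , N :+ N :≡ con 1 :+ (z :+ z)) L≡ size e))
    finish 2 e = lia (N ∷ z φ ∷ L ∷ count (mid? φ) ∷ []) (λ N z L c → L :≡ N :+ N ∷ L :≡ 2 :* z :+ c ∷ c :≡ con 2 ∷ [] , z :+ con 1 :≡ N) L≡ size e
    finish (suc (suc (suc c))) e = ⊥-elim (lia (count (mid? φ) ∷ c ∷ []) (λ d c → d :≤ con 2 ∷ d :≡ con 3 :+ c ∷ [] , :⊥) mid-≤2 e)

-- Classification

choices : ∀ {A : Set} {n} → (Fin n → List A) → List (Vec A n)
choices {n = zero} cs = [] ∷ []
choices {n = suc n} cs = List.cartesianProductWith _∷_ (cs zero) (choices (cs ∘ suc))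

choices-complete : ∀ {A : Set} {n} (cs : Fin n → List A) (f : Fin n → A) → (∀ i → f i ∈ cs i) → tabulate f ∈ choices cs
choices-complete {n = zero} cs f h = here refl
choices-complete {n = suc n} cs f h = ∈P.∈-cartesianProductWith⁺ _∷_ (h zero) (choices-complete (cs ∘ suc) (f ∘ suc) (h ∘ suc))

-- Block t of chords is matched with block μ t: no chord joins neighbours, and neighbouring blocks are not parallel.
Irreducible : ∀ {c} → Fun c → Set
Irreducible μ = (∀ t → μ (μ t) ≡ t) × (∀ t → μ t ≢ t) × (∀ t → μ (ζ t) ≢ t) × (∀ t → μ (ζ (μ (ζ t))) ≢ t)

irreducible? : ∀ {c} (μ : Fun c) → Dec (Irreducible μ)
irreducible? μ = all? (λ t → μ (μ t) F.≟ t) ×-dec all? (λ t → ¬? (μ t F.≟ t)) ×-dec all? (λ t → ¬? (μ (ζ t) F.≟ t)) ×-dec all?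
    (λ t → ¬? (μ (ζ (μ (ζ t))) F.≟ t))

-- The part of irreducibility that constrains a single value. Imposed before the enumeration, it
-- leaves 3 choices per entry for c = 6, so 729 vectors instead of 46656.
Separated : ∀ {c} → Fin c → Fin c → Set
Separated t s = s ≢ t × s ≢ ζ t × ζ s ≢ t

separated? : ∀ {c} (t s : Fin c) → Dec (Separated t s)
separated? t s = ¬? (s F.≟ t) ×-dec ¬? (s F.≟ ζ t) ×-dec ¬? (ζ s F.≟ t)

candidates : ∀ c → List (Vec (Fin c) c)
candidates c = choices λ t → filter (separated? t) (allFin c)

irreducible-candidate : ∀ {c} {μ : Fun c} → Irreducible μ → tabulate μ ∈ candidates c
irreducible-candidate {c} {μ} (inv , moves , ν-moves , _) = choices-complete _ μ λ t → ∈P.∈-filter⁺ (separated? t) (∈P.∈-allFin (μ t))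
  (moves t , (λ e → ν-moves t (trans (cong μ (sym e)) (inv t))) , (λ e → ν-moves (μ t) (cong μ e)))

irreducible-cong : ∀ {c} {μ μ′ : Fun c} → (∀ t → μ t ≡ μ′ t) → Irreducible μ → Irreducible μ′
irreducible-cong {μ = μ} {μ′} h (a , b , c , d) = (λ t → trans (hh t) (a t)) , (λ t e → b t (trans (h t) e)) , (λ t e → c t (trans (h _) e)) ,
  λ t e → d t (trans (trans (cong (μ ∘ ζ) (h _)) (h _)) e)
  where
  hh : ∀ t → μ′ (μ′ t) ≡ μ (μ t)
  hh t = sym (trans (cong μ (h t)) (h _))

checkCandidates : ∀ {c} (Q : Vec (Fin c) c → Set)
    (Q? : ∀ v → Dec (Q v)) {_ : True (All.all? (λ v → irreducible? (lookup v) →-dec Q? v) (candidates c))} →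
  (μ : Fun c) → Irreducible μ → Q (tabulate μ)
checkCandidates Q Q? {ok} μ p = All.lookup (toWitness ok) (irreducible-candidate p) (irreducible-cong (λ t → sym (VP.lookup∘tabulate μ t)) p)

-- Settled by evaluating the decision procedure on all candidates; the argument of type `Fin c`
-- excludes c = 0.
antipodal : ∀ c → c ≤ 6 → (μ : Fun c) → Irreducible μ → Fin c →
  (c ≡ 4 × (∀ t → μ t ≡ ζ (ζ t))) ⊎ (c ≡ 6 × (∀ t → μ t ≡ ζ (ζ (ζ t))))
antipodal 1 _ μ p _ = ⊥-elim (checkCandidates (λ _ → ⊥) (λ _ → no id) μ p)
antipodal 2 _ μ p _ = ⊥-elim (checkCandidates (λ _ → ⊥) (λ _ → no id) μ p)
antipodal 3 _ μ p _ = ⊥-elim (checkCandidates (λ _ → ⊥) (λ _ → no id) μ p)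
antipodal 4 _ μ p _ = inj₁ (refl , λ t → trans (sym (VP.lookup∘tabulate μ t))
  (checkCandidates (λ v → ∀ t → lookup v t ≡ ζ (ζ t)) (λ v → all? λ t → lookup v t F.≟ ζ (ζ t)) μ p t))
antipodal 5 _ μ p _ = ⊥-elim (checkCandidates (λ _ → ⊥) (λ _ → no id) μ p)
antipodal 6 _ μ p _ = inj₂ (refl , λ t → trans (sym (VP.lookup∘tabulate μ t))
  (checkCandidates (λ v → ∀ t → lookup v t ≡ ζ (ζ (ζ t))) (λ v → all? λ t → lookup v t F.≟ ζ (ζ (ζ t))) μ p t))
antipodal (suc (suc (suc (suc (suc (suc (suc _))))))) (s≤s (s≤s (s≤s (s≤s (s≤s (s≤s ())))))) μ p _

-- Along a run of parallel chords the sum of the two ends is constant only modulo L, since either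
-- end may pass the origin. Size bounds later turn congruences into equations.
module Congruence (L : ℕ) .{{_ : NonZero L}} where

  infix 4 _≈_
  _≈_ : ℕ → ℕ → Set
  a ≈ b = a % L ≡ b % L

  ≈-+L : ∀ a → a + L ≈ a
  ≈-+L a = DM.[m+n]%n≡m%n a L

  ≈-gap : ∀ {a b} → a ≈ b → a / L < b / L → a + L ≤ b
  ≈-gap {a} {b} e lt = begin
    a + L ≡⟨ cong (_+ L) (DM.m≡m%n+[m/n]*n a L) ⟩
    a % L + (a / L) * L + L ≡⟨ lia (a % L ∷ (a / L) * L ∷ L ∷ []) (λ r q L → [] , r :+ q :+ L :≡ r :+ (L :+ q)) ⟩
    a % L + suc (a / L) * L ≤⟨ ℕP.+-mono-≤ (≤-reflexive e) (ℕP.*-monoˡ-≤ L lt) ⟩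
    b % L + (b / L) * L ≡⟨ DM.m≡m%n+[m/n]*n b L ⟨
    b ∎
    where open ℕP.≤-Reasoning

  ≈-close : ∀ {a b} → a ≈ b → a < b + L → b < a + L → a ≡ b
  ≈-close {a} {b} e a<b+L b<a+L with ℕP.<-cmp (a / L) (b / L)
  ... | tri≈ _ q _ = trans (DM.m≡m%n+[m/n]*n a L) (trans (cong₂ (λ r q → r + q * L) e q) (sym (DM.m≡m%n+[m/n]*n b L)))
  ... | tri< lt _ _ = ⊥-elim (<⇒≱ b<a+L (≈-gap e lt))
  ... | tri> _ _ gt = ⊥-elim (<⇒≱ a<b+L (≈-gap (sym e) gt))

  ζ-≈ : ∀ (y : Fin L) w → toℕ (ζ y) + w ≈ suc (toℕ y) + w
  ζ-≈ y w with ζ-view y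
  ... | next _ e = cong (λ v → (v + w) % L) e
  ... | last p e = trans (cong (λ v → (v + w) % L) e) (sym (trans (cong (λ v → (v + w) % L) p) (trans (cong (_% L) (+-comm L w)) (≈-+L w))))

-- `φ-moves` says that no chord joins neighbours. `z-φ` is genus one for M on N + N points: M has N
-- cycles, so φ must have N - 1.
record ValidMatching {L} (N : ℕ) (M : Fun L) : Set where
  field
    involutive : ∀ x → M (M x) ≡ x
    moves : ∀ x → M x ≢ x
    φ-moves : ∀ x → M (ζ x) ≢ x
    z-φ : z (λ x → M (ζ x)) + 1 ≡ N

  perm : IsPerm M
  perm x y e = trans (sym (involutive x)) (trans (cong M e) (involutive y))

module Classification {L′ N} (L≡ : suc L′ ≡ N + N) {M : Fun (suc L′)} (V : ValidMatching N M) where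
  open ValidMatching V renaming (involutive to M-involutive; moves to M-moves; perm to M-perm)

  L = suc L′
  open Congruence L

  φ : Fun L
  φ x = M (ζ x)

  φ-perm : IsPerm φ
  φ-perm = ∘-perm M-perm ζ-perm

  open Derangement φ-perm φ-moves using (size; mid-long; long-count)

  two-mid : count (mid? φ) ≡ 2
  two-mid = lia (N ∷ z φ ∷ L ∷ count (mid? φ) ∷ []) (λ N z L c → L :≡ N :+ N ∷ L :≡ 2 :* z :+ c ∷ z :+ con 1 :≡ N ∷ [] , c :≡ con 2) L≡ size z-φ

  long-≤6 : count (long? φ) ≤ 6
  long-≤6 = subst (λ c → count (long? φ) ≤ 3 * c) two-mid long-count

  some-long : ∃ (Long φ)
  some-long = map₂ mid-long (count-witness (mid? φ) (subst (1 ≤_) (sym two-mid) (s≤s z≤n)))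

  parallel : ∀ {i} → φ (φ i) ≡ i → M i ≡ ζ (φ i)
  parallel {i} e = trans (cong M (sym e)) (M-involutive _)

  Sound Complete : ∀ {c} → c ⊑ L → Set
  Sound S = ∀ i → i ∈ˢ S → Long φ i
  Complete S = ∀ i → Long φ i → i ∈ˢ S

  module Blocks {m} (S : suc m ⊑ L) (sound : Sound S) (complete : Complete S) where
    open Circle S public

    short : ∀ {i} → ¬ i ∈ˢ S → φ (φ i) ≡ i
    short {i} ∉ with φ (φ i) F.≟ i
    ... | yes e = e
    ... | no l = ⊥-elim (∉ (complete i l))

    φ-∉ : ∀ {i} → ¬ i ∈ˢ S → ¬ φ i ∈ˢ S
    φ-∉ ∉ ∈S = sound _ ∈S (cong φ (short ∉))

    φ-∈ : ∀ {i} → i ∈ˢ S → φ i ∈ˢ S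
    φ-∈ ∈S = complete _ λ e → sound _ ∈S (φ-perm _ _ e)

    μ : Fun (suc m)
    μ t = ρ (M (emb S t))

    -- M carries blocks to blocks: outside S a step along ζ moves one end of the chord forward and
    -- the other backward, and neither end leaves its block.
    ρ-M : ∀ i → ρ (M i) ≡ μ (ρ i)
    ρ-M = circle-induction (λ i → ρ (M i) ≡ μ (ρ i)) (λ t → cong μ (sym (ρ-emb t)))
      λ i ∉ ih → trans (cong ρ (parallel (short ∉))) (trans (ρ-∉ (φ-∉ ∉)) (trans ih (cong μ (ρ-∉ ∉))))

    μ-involutive : ∀ t → μ (μ t) ≡ t
    μ-involutive t = trans (sym (ρ-M (M (emb S t)))) (trans (cong ρ (M-involutive _)) (ρ-emb t))

    -- The long points form whole cycles of φ, so a cut is sent to a cut, and its block tells which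
    -- one.
    φ-emb : ∀ t → φ (emb S t) ≡ emb S (μ (ζ t))
    φ-emb t = go (φ-∈ (t , refl))
      where
      go : φ (emb S t) ∈ˢ S → φ (emb S t) ≡ emb S (μ (ζ t))
      go (u , e) = trans (sym e) (cong (emb S) (begin
        u                    ≡⟨ ρ-emb u ⟨
        ρ (emb S u)          ≡⟨ cong ρ e ⟩
        ρ (M (ζ (emb S t)))  ≡⟨ ρ-M _ ⟩
        μ (ρ (ζ (emb S t)))  ≡⟨ cong μ (ρ-∈ t) ⟩
        μ (ζ t)              ∎))
        where open ≡-Reasoning

    -- A run of parallel chords that returns to itself has an innermost chord joining neighbours.
    folded : ∀ k x → iter ζ k x ≡ M x → (∀ j → j < k → ¬ iter ζ j x ∈ˢ S) → ⊥
    folded 0 x e avoid = M-moves x (sym e)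
    folded 1 x e avoid = φ-moves x (trans (cong M e) (M-involutive x))
    folded (suc (suc k)) x e avoid = folded k (ζ x)
      (trans (iter-comm ζ k x) (ζ-perm _ _ (trans e (parallel (short (avoid 0 (s≤s z≤n)))))))
      λ j lt → subst (λ y → ¬ y ∈ˢ S) (sym (iter-comm ζ j x)) (avoid (suc j) (s≤s (ℕP.m≤n⇒m≤1+n lt)))

    μ-moves : ∀ t → μ t ≢ t
    μ-moves t e = folded steps x (trans arrives (trans (cong (emb S) ρx) (sym Mx))) avoids
      where
      -- The first point of block t. If the block were its own partner, x would be matched with the
      -- last point `emb S t`, and the run between them would fold.
      x : Fin L
      x = ζ (emb S (ζ⁻¹ t))
      open Nearest (nearest x)
      ρx : ρ x ≡ t
      ρx = trans (ρ-∈ (ζ⁻¹ t)) (ζ-ζ⁻¹ t)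
      Mx : M x ≡ emb S t
      Mx = trans (φ-emb (ζ⁻¹ t)) (cong (emb S) (trans (cong μ (ζ-ζ⁻¹ t)) e))

    -- The third condition holds because φ has no fixed point, the fourth because cuts lie on cycles
    -- longer than 2.
    μ-irreducible : Irreducible μ
    μ-irreducible = μ-involutive , μ-moves , (λ t e → φ-moves (emb S t) (trans (φ-emb t) (cong (emb S) e))) ,
      λ t e → sound (emb S t) (t , refl) (trans (cong φ (φ-emb t)) (trans (φ-emb _) (cong (emb S) e)))

    M-emb : ∀ u → M (emb S (μ (ζ u))) ≡ ζ (emb S u)
    M-emb u = trans (cong M (sym (φ-emb u))) (M-involutive _)

    -- Outside S a step along ζ raises one end of the chord by 1 and lowers the other by 1, so the
    -- sum can be evaluated at the last point of the block.
    sum-≈ : ∀ x → toℕ (M x) + toℕ x ≈ toℕ (M (emb S (ρ x))) + toℕ (emb S (ρ x))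
    sum-≈ = circle-induction _ (λ t → cong (λ u → (toℕ (M (emb S u)) + toℕ (emb S u)) % L) (sym (ρ-emb t)))
      λ i ∉ ih → trans (step i ∉) (trans ih (cong (λ u → (toℕ (M (emb S u)) + toℕ (emb S u)) % L) (ρ-∉ ∉)))
      where
      step : ∀ i → ¬ i ∈ˢ S → toℕ (M i) + toℕ i ≈ toℕ (M (ζ i)) + toℕ (ζ i)
      step i ∉ = begin
        (toℕ (M i) + toℕ i) % L         ≡⟨ cong (λ y → (toℕ y + toℕ i) % L) (parallel (short ∉)) ⟩
        (toℕ (ζ (φ i)) + toℕ i) % L     ≡⟨ ζ-≈ (φ i) (toℕ i) ⟩
        (suc (toℕ (φ i)) + toℕ i) % L   ≡⟨ cong (_% L) (lia (toℕ (φ i) ∷ toℕ i ∷ []) (λ a b → [] , con 1 :+ a :+ b :≡ con 1 :+ b :+ a)) ⟩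
        (suc (toℕ i) + toℕ (φ i)) % L   ≡⟨ ζ-≈ i (toℕ (φ i)) ⟨
        (toℕ (ζ i) + toℕ (φ i)) % L     ≡⟨ cong (_% L) (+-comm (toℕ (ζ i)) _) ⟩
        (toℕ (φ i) + toℕ (ζ i)) % L     ∎
        where open ≡-Reasoning

    -- The last point of block t is φ of the cut u, so its partner is the point just after that cut.
    K : ∀ u {t} → μ (ζ u) ≡ t → ∀ {x} → ρ x ≡ t → toℕ (M x) + toℕ x ≈ suc (toℕ (emb S u)) + toℕ (emb S t)
    K u refl {x} e = trans (sum-≈ x) (trans (cong (λ t → (toℕ (M (emb S t)) + toℕ (emb S t)) % L) e)
      (trans (cong (λ y → (toℕ y + toℕ (emb S (μ (ζ u)))) % L) (M-emb u)) (ζ-≈ (emb S u) _)))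

    -- Both ends of block ζ w are matched with ends of its partner.
    ends : ∀ w u {v} → μ (ζ u) ≡ ζ w → μ (ζ w) ≡ v →
      suc (toℕ (emb S v)) + toℕ (emb S w) ≈ suc (toℕ (emb S u)) + toℕ (emb S (ζ w))
    ends w u e refl = begin
      (suc (toℕ (emb S (μ (ζ w)))) + toℕ (emb S w)) % L ≡⟨ cong (_% L)
        (lia (toℕ (emb S (μ (ζ w))) ∷ toℕ (emb S w) ∷ []) (λ a b → [] , con 1 :+ a :+ b :≡ con 1 :+ b :+ a)) ⟩
      (suc (toℕ (emb S w)) + toℕ (emb S (μ (ζ w)))) % L ≡⟨ ζ-≈ (emb S w) _ ⟨
      (toℕ (ζ (emb S w)) + toℕ (emb S (μ (ζ w)))) % L ≡⟨ cong (λ y → (toℕ (ζ (emb S w)) + toℕ y) % L) (φ-emb w) ⟨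
      (toℕ (ζ (emb S w)) + toℕ (M (ζ (emb S w)))) % L ≡⟨ cong (_% L) (+-comm (toℕ (ζ (emb S w))) _) ⟩
      (toℕ (M (ζ (emb S w))) + toℕ (ζ (emb S w))) % L ≡⟨ K u e (ρ-∈ w) ⟩
      (suc (toℕ (emb S u)) + toℕ (emb S (ζ w))) % L ∎
      where open ≡-Reasoning

    rank-≤ : ∀ {m n} (S : m ⊑ n) x → rank S x ≤ m
    rank-≤ done x = z≤n
    rank-≤ (keep S) zero = z≤n
    rank-≤ (keep S) (suc x) = s≤s (rank-≤ S x)
    rank-≤ (drop S) zero = z≤n
    rank-≤ (drop S) (suc x) = rank-≤ S x

    ρ-first : ∀ {x} → toℕ x ≤ toℕ (emb S zero) → ρ x ≡ zero
    ρ-first {x} le = cong (_mod suc m) {y = 0} (ℕP.n≤0⇒n≡0 (≮⇒≥ λ gt → <⇒≱ (rank⇒emb-< S zero (toℕ x) gt) le))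

    ρ-between : ∀ v {x} → toℕ (emb S v) < toℕ x → (∀ w → toℕ w ≡ suc (toℕ v) → toℕ x ≤ toℕ (emb S w)) → ρ x ≡ suc (toℕ v) mod suc m
    ρ-between v {x} lt above = cong (_mod suc m) (≤-antisym upper (emb-<⇒rank S v (toℕ x) lt))
      where
      upper : rank S (toℕ x) ≤ suc (toℕ v)
      upper with m≤n⇒m<n∨m≡n (toℕ<n v)
      ... | inj₂ e = subst (rank S (toℕ x) ≤_) (sym e) (rank-≤ S (toℕ x))
      ... | inj₁ v<m = ≮⇒≥ λ gt → <⇒≱ (rank⇒emb-< S (fromℕ< v<m) (toℕ x) (subst (_< rank S (toℕ x)) (sym (toℕ-fromℕ< v<m)) gt))
            (above (fromℕ< v<m) (toℕ-fromℕ< v<m))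

  swap-ends : ∀ {a b d f} → suc f + a ≈ suc d + b → a < b → d < f → b < L → f < L → suc f + a ≡ suc d + b
  swap-ends {a} {b} {d} {f} e a<b d<f b<L f<L = ≈-close e
    (lia (a ∷ b ∷ d ∷ f ∷ L ∷ []) (λ a b d f L → a :< b ∷ f :< L ∷ [] , con 1 :+ f :+ a :< con 1 :+ d :+ b :+ L) a<b f<L)
    (lia (a ∷ b ∷ d ∷ f ∷ L ∷ []) (λ a b d f L → d :< f ∷ b :< L ∷ [] , con 1 :+ d :+ b :< con 1 :+ f :+ a :+ L) d<f b<L)

  opposite-end : ∀ {a b d f} → suc f + a ≡ suc d + b → d ≡ N + a → f ≡ N + b
  opposite-end {a} {b} {d} {f} e refl =
    lia (a ∷ b ∷ f ∷ N ∷ []) (λ a b f N → con 1 :+ f :+ a :≡ con 1 :+ (N :+ a) :+ b ∷ [] , f :≡ N :+ b) e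

  totalˡ : ∀ {a b d} → d ≡ N + a → suc d + b ≡ N + a + b + 1
  totalˡ {a} {b} refl = lia (N ∷ a ∷ b ∷ []) (λ N a b → [] , con 1 :+ (N :+ a) :+ b :≡ N :+ a :+ b :+ con 1)

  totalʳ : ∀ {a b d} → d ≡ N + b → suc a + d ≡ N + a + b + 1
  totalʳ {a} {b} refl = lia (N ∷ a ∷ b ∷ []) (λ N a b → [] , con 1 :+ a :+ (N :+ b) :≡ N :+ a :+ b :+ con 1)

  Classified : Set
  Classified = ∃ λ (c : Cuts N) → ∀ x → Matching.Chord c (toℕ x) (toℕ (M x))

  at : ∀ {c x} {e : Fin c → ℕ} v → x ≤ e v → ∀ w → toℕ w ≡ toℕ v → x ≤ e w
  at {x = x} {e} v le w eq = subst (λ u → x ≤ e u) (sym (toℕ-injective eq)) le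

  after : ∀ {a b x} → a + 1 ≤ x → b ≡ a → b < x
  after {a} {x = x} le refl = subst (_≤ x) (+-comm a 1) le

  upto : ∀ {a b x} → x < a + 1 → b ≡ a → x ≤ b
  upto {a} {x = x} lt refl = ≤-pred (subst (x <_) (+-comm a 1) lt)

  module Recognise (c : Cuts N) where
    open Matching c

    -- A congruence suffices, since both M x and the prescribed partner are below L.
    chord-≈ : ∀ i {x} → In i (toℕ x) → toℕ (M x) + toℕ x ≈ total i → Chord (toℕ x) (toℕ (M x))
    chord-≈ i {x} inᵢ e with Chord-total (toℕ x) (subst (toℕ x <_) L≡ (toℕ<n x))
    ... | y , c@(j , inⱼ , e′) = subst (Chord (toℕ x)) (ℕP.+-cancelʳ-≡ (toℕ x) y (toℕ (M x)) (sym (≈-close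
        (trans e (cong (_% L) (sym (trans (+-comm y (toℕ x)) (trans e′ (cong total (In-unique j i inⱼ inᵢ)))))))
        (lia (toℕ (M x) ∷ toℕ x ∷ y ∷ L ∷ []) (λ m x y L → m :< L ∷ [] , m :+ x :< y :+ x :+ L) (toℕ<n (M x)))
        (lia (toℕ (M x) ∷ toℕ x ∷ y ∷ L ∷ N ∷ []) (λ m x y L N → L :≡ N :+ N ∷ y :< N :+ N ∷ [] , y :+ x :< m :+ x :+ L) L≡
          (Chord-bound (Chord-sym c)))))) c

    -- The constant delivered by `K` is written in terms of the cuts. It equals the total of the
    -- linear block, falls short of it by L (`via+`), or exceeds it by L (`via-`).
    via : ∀ i {k} x → In i (toℕ x) → toℕ (M x) + toℕ x ≈ k → k ≡ total i → Chord (toℕ x) (toℕ (M x))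
    via i x inᵢ e refl = chord-≈ i inᵢ e

    via+ : ∀ i {k} x → In i (toℕ x) → toℕ (M x) + toℕ x ≈ k → k + L ≡ total i → Chord (toℕ x) (toℕ (M x))
    via+ i {k} x inᵢ e e′ = chord-≈ i inᵢ (trans e (trans (sym (≈-+L k)) (cong (_% L) e′)))

    via- : ∀ i {k} x → In i (toℕ x) → toℕ (M x) + toℕ x ≈ k → k ≡ total i + L → Chord (toℕ x) (toℕ (M x))
    via- i x inᵢ e refl = chord-≈ i inᵢ (trans e (≈-+L (total i)))

  module Six (S : 6 ⊑ L) (sound : Sound S) (complete : Complete S)
    (opposite : ∀ t → Blocks.μ S sound complete t ≡ ζ (ζ (ζ t))) where
    open Blocks S sound complete

    e : Fin 6 → ℕ
    e t = toℕ (emb S t)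

    e₀<e₁ : e 0F < e 1F
    e₀<e₁ = emb-mono S (s≤s z≤n)
    e₁<e₂ : e 1F < e 2F
    e₁<e₂ = emb-mono S (s≤s (s≤s z≤n))
    e₂<e₃ : e 2F < e 3F
    e₂<e₃ = emb-mono S (s≤s (s≤s (s≤s z≤n)))
    e₃<e₄ : e 3F < e 4F
    e₃<e₄ = emb-mono S (s≤s (s≤s (s≤s (s≤s z≤n))))
    e₄<e₅ : e 4F < e 5F
    e₄<e₅ = emb-mono S (s≤s (s≤s (s≤s (s≤s (s≤s z≤n)))))
    e₅<L : e 5F < L
    e₅<L = toℕ<n (emb S 5F)

    ends₀ : suc (e 4F) + e 0F ≡ suc (e 3F) + e 1F
    ends₀ = swap-ends (ends 0F 3F (opposite 4F) (opposite 1F)) e₀<e₁ e₃<e₄ (toℕ<n (emb S 1F)) (toℕ<n (emb S 4F))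

    ends₁ : suc (e 5F) + e 1F ≡ suc (e 4F) + e 2F
    ends₁ = swap-ends (ends 1F 4F (opposite 5F) (opposite 2F)) e₁<e₂ e₄<e₅ (toℕ<n (emb S 2F)) e₅<L

    ends₂ : suc (e 0F) + e 2F + L ≡ suc (e 5F) + e 3F
    ends₂ = ≈-close (trans (≈-+L (suc (e 0F) + e 2F)) (ends 2F 5F (opposite 0F) (opposite 3F)))
      (lia (e 0F ∷ e 2F ∷ e 3F ∷ e 5F ∷ L ∷ e 1F ∷ e 4F ∷ [])
        (λ a c d f L b g → a :< b ∷ b :< c ∷ c :< d ∷ d :< g ∷ g :< f ∷ [] , con 1 :+ a :+ c :+ L :< con 1 :+ f :+ d :+ L) e₀<e₁ e₁<e₂ e₂<e₃ e₃<e₄ e₄<e₅)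
      (lia (e 0F ∷ e 2F ∷ e 3F ∷ e 5F ∷ L ∷ [])
        (λ a c d f L → f :< L ∷ d :< L ∷ [] , con 1 :+ f :+ d :< con 1 :+ a :+ c :+ L :+ L) e₅<L (toℕ<n (emb S 3F)))

    -- The three `ends` equations say that opposite blocks have equal lengths. So the blocks from
    -- `e 0F` to `e 3F` fill exactly half of the circle.
    e₃≡ : e 3F ≡ N + e 0F
    e₃≡ = lia (e 0F ∷ e 1F ∷ e 2F ∷ e 3F ∷ e 4F ∷ e 5F ∷ L ∷ N ∷ [])
        (λ a b c d f g L N → con 1 :+ f :+ a :≡ con 1 :+ d :+ b ∷ con 1 :+ g :+ b :≡ con 1 :+ f :+ c ∷
      con 1 :+ a :+ c :+ L :≡ con 1 :+ g :+ d ∷ L :≡ N :+ N ∷ [] , d :≡ N :+ a) ends₀ ends₁ ends₂ L≡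
    e₄≡ : e 4F ≡ N + e 1F
    e₄≡ = opposite-end ends₀ e₃≡
    e₅≡ : e 5F ≡ N + e 2F
    e₅≡ = opposite-end ends₁ e₄≡
    e₂<N : e 2F < N
    e₂<N = lia (e 2F ∷ e 5F ∷ L ∷ N ∷ []) (λ c g L N → g :≡ N :+ c ∷ g :< L ∷ L :≡ N :+ N ∷ [] , c :< N) e₅≡ e₅<L L≡

    found : Cuts N
    found = cuts (e 0F) (e 1F) (e 2F) e₀<e₁ (<⇒≤ e₁<e₂) e₂<N

    open Matching found
    open Recognise found

    -- Six circular blocks give eight linear ones: 7 and 0 are the pieces of the block cut by the
    -- origin, 3 and 4 the matching pieces of its partner. This is why corrections by L occur at 3
    -- and 7.
    chord : ∀ i x → In i (toℕ x) → Chord (toℕ x) (toℕ (M x))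
    chord 0 x p = via 0 {suc (e 2F) + e 0F} x p (K 2F (opposite 3F) (ρ-first (upto (proj₂ p) refl)))
      (lia (e 0F ∷ e 2F ∷ []) (λ a c → [] , con 1 :+ c :+ a :≡ a :+ c :+ con 1))
    chord 1 x p = via 1 {suc (e 3F) + e 1F} x p (K 3F (opposite 4F) (ρ-between 0F (after (proj₁ p) refl) (at {e = e} 1F (upto (proj₂ p) refl))))
      (totalˡ e₃≡)
    chord 2 x p = via 2 {suc (e 4F) + e 2F} x p (K 4F (opposite 5F) (ρ-between 1F (after (proj₁ p) refl) (at {e = e} 2F (upto (proj₂ p) refl))))
      (totalˡ e₄≡)
    chord 3 x p = via- 3 {suc (e 5F) + e 3F} x p (K 5F (opposite 0F) (ρ-between 2F (after (proj₁ p) refl) (at {e = e} 3F (≤-pred (≤-trans (proj₂ p)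
        (lia (N ∷ e 0F ∷ e 2F ∷ e 3F ∷ []) (λ N a c d → d :≡ N :+ a ∷ c :< N ∷ [] , a :+ c :+ con 2 :≤ con 1 :+ d) e₃≡ e₂<N))))))
      (lia (N ∷ L ∷ e 0F ∷ e 2F ∷ e 3F ∷ e 5F ∷ [])
        (λ N L a c d g → L :≡ N :+ N ∷ d :≡ N :+ a ∷ g :≡ N :+ c ∷ [] , con 1 :+ g :+ d :≡ a :+ c :+ con 1 :+ L) L≡ e₃≡ e₅≡)
    chord 4 x p = via 4 {suc (e 5F) + e 3F} x p
        (K 5F (opposite 0F) (ρ-between 2F (≤-trans (lia (e 0F ∷ e 2F ∷ []) (λ a c → [] , con 1 :+ c :≤ a :+ c :+ con 2)) (proj₁ p))
          (at {e = e} 3F (upto (proj₂ p) e₃≡))))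
      (lia (N ∷ e 0F ∷ e 2F ∷ e 3F ∷ e 5F ∷ []) (λ N a c d g → d :≡ N :+ a ∷ g :≡ N :+ c ∷ [] , con 1 :+ g :+ d :≡ N :+ N :+ a :+ c :+ con 1) e₃≡ e₅≡)
    chord 5 x p = via 5 {suc (e 0F) + e 4F} x p (K 0F (opposite 1F) (ρ-between 3F (after (proj₁ p) e₃≡) (at {e = e} 4F (upto (proj₂ p) e₄≡))))
      (totalʳ e₄≡)
    chord 6 x p = via 6 {suc (e 1F) + e 5F} x p (K 1F (opposite 2F) (ρ-between 4F (after (proj₁ p) e₄≡) (at {e = e} 5F (upto (proj₂ p) e₅≡))))
      (totalʳ e₅≡)
    chord 7 x p = via+ 7 {suc (e 2F) + e 0F} x p (K 2F (opposite 3F) (ρ-between 5F (after (proj₁ p) e₅≡) (λ w eq → ⊥-elim (<-irrefl eq (toℕ<n w)))))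
      (lia (N ∷ L ∷ e 0F ∷ e 2F ∷ []) (λ N L a c → L :≡ N :+ N ∷ [] , con 1 :+ c :+ a :+ L :≡ N :+ N :+ a :+ c :+ con 1) L≡)
    chord (8+ i) x (p , q) = ⊥-elim (≤⇒≯ p q)

    classified : Classified
    classified = found , λ x → let i , inᵢ = block (toℕ x) (subst (toℕ x <_) L≡ (toℕ<n x)) in chord i x inᵢ

  module Four (S : 4 ⊑ L) (sound : Sound S) (complete : Complete S)
    (opposite : ∀ t → Blocks.μ S sound complete t ≡ ζ (ζ t)) where
    open Blocks S sound complete

    e : Fin 4 → ℕ
    e t = toℕ (emb S t)

    e₀<e₁ : e 0F < e 1F
    e₀<e₁ = emb-mono S (s≤s z≤n)
    e₁<e₂ : e 1F < e 2F
    e₁<e₂ = emb-mono S (s≤s (s≤s z≤n))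
    e₂<e₃ : e 2F < e 3F
    e₂<e₃ = emb-mono S (s≤s (s≤s (s≤s z≤n)))
    e₃<L : e 3F < L
    e₃<L = toℕ<n (emb S 3F)

    ends₀ : suc (e 3F) + e 0F ≡ suc (e 2F) + e 1F
    ends₀ = swap-ends (ends 0F 2F (opposite 3F) (opposite 1F)) e₀<e₁ e₂<e₃ (toℕ<n (emb S 1F)) e₃<L

    ends₁ : suc (e 0F) + e 1F + L ≡ suc (e 3F) + e 2F
    ends₁ = ≈-close (trans (≈-+L (suc (e 0F) + e 1F)) (ends 1F 3F (opposite 0F) (opposite 2F)))
      (lia (e 0F ∷ e 1F ∷ e 2F ∷ e 3F ∷ L ∷ [])
        (λ a b c d L → a :< b ∷ b :< c ∷ c :< d ∷ [] , con 1 :+ a :+ b :+ L :< con 1 :+ d :+ c :+ L) e₀<e₁ e₁<e₂ e₂<e₃)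
      (lia (e 0F ∷ e 1F ∷ e 2F ∷ e 3F ∷ L ∷ [])
        (λ a b c d L → d :< L ∷ c :< L ∷ [] , con 1 :+ d :+ c :< con 1 :+ a :+ b :+ L :+ L) e₃<L (toℕ<n (emb S 2F)))

    e₂≡ : e 2F ≡ N + e 0F
    e₂≡ = lia (e 0F ∷ e 1F ∷ e 2F ∷ e 3F ∷ L ∷ N ∷ [])
        (λ a b c d L N → con 1 :+ d :+ a :≡ con 1 :+ c :+ b ∷ con 1 :+ a :+ b :+ L :≡ con 1 :+ d :+ c ∷ L :≡ N :+ N ∷ [] , c :≡ N :+ a) ends₀ ends₁ L≡
    e₃≡ : e 3F ≡ N + e 1F
    e₃≡ = opposite-end ends₀ e₂≡
    e₁<N : e 1F < N
    e₁<N = lia (e 1F ∷ e 3F ∷ L ∷ N ∷ []) (λ c g L N → g :≡ N :+ c ∷ g :< L ∷ L :≡ N :+ N ∷ [] , c :< N) e₃≡ e₃<L L≡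

    found : Cuts N
    -- Four cuts are the case of an empty block C, expressed by t₂ = t₃; the linear blocks 2 and 6
    -- are then empty.
    found = cuts (e 0F) (e 1F) (e 1F) e₀<e₁ ≤-refl e₁<N

    open Matching found
    open Recognise found

    chord : ∀ i x → In i (toℕ x) → Chord (toℕ x) (toℕ (M x))
    chord 0 x p = via 0 {suc (e 1F) + e 0F} x p (K 1F (opposite 2F) (ρ-first (upto (proj₂ p) refl)))
      (lia (e 0F ∷ e 1F ∷ []) (λ a c → [] , con 1 :+ c :+ a :≡ a :+ c :+ con 1))
    chord 1 x p = via 1 {suc (e 2F) + e 1F} x p (K 2F (opposite 3F) (ρ-between 0F (after (proj₁ p) refl) (at {e = e} 1F (upto (proj₂ p) refl))))
      (totalˡ e₂≡)
    chord 2 x (p , q) = ⊥-elim (≤⇒≯ p q)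
    chord 3 x p = via- 3 {suc (e 3F) + e 2F} x p (K 3F (opposite 0F) (ρ-between 1F (after (proj₁ p) refl) (at {e = e} 2F (≤-pred (≤-trans (proj₂ p)
        (lia (N ∷ e 0F ∷ e 1F ∷ e 2F ∷ []) (λ N a c d → d :≡ N :+ a ∷ c :< N ∷ [] , a :+ c :+ con 2 :≤ con 1 :+ d) e₂≡ e₁<N))))))
      (lia (N ∷ L ∷ e 0F ∷ e 1F ∷ e 2F ∷ e 3F ∷ [])
        (λ N L a c d g → L :≡ N :+ N ∷ d :≡ N :+ a ∷ g :≡ N :+ c ∷ [] , con 1 :+ g :+ d :≡ a :+ c :+ con 1 :+ L) L≡ e₂≡ e₃≡)
    chord 4 x p = via 4 {suc (e 3F) + e 2F} x p
        (K 3F (opposite 0F) (ρ-between 1F (≤-trans (lia (e 0F ∷ e 1F ∷ []) (λ a c → [] , con 1 :+ c :≤ a :+ c :+ con 2)) (proj₁ p))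
          (at {e = e} 2F (upto (proj₂ p) e₂≡))))
      (lia (N ∷ e 0F ∷ e 1F ∷ e 2F ∷ e 3F ∷ []) (λ N a c d g → d :≡ N :+ a ∷ g :≡ N :+ c ∷ [] , con 1 :+ g :+ d :≡ N :+ N :+ a :+ c :+ con 1) e₂≡ e₃≡)
    chord 5 x p = via 5 {suc (e 0F) + e 3F} x p (K 0F (opposite 1F) (ρ-between 2F (after (proj₁ p) e₂≡) (at {e = e} 3F (upto (proj₂ p) e₃≡))))
      (totalʳ e₃≡)
    chord 6 x (p , q) = ⊥-elim (≤⇒≯ p q)
    chord 7 x p = via+ 7 {suc (e 1F) + e 0F} x p (K 1F (opposite 2F) (ρ-between 3F (after (proj₁ p) e₃≡) (λ w eq → ⊥-elim (<-irrefl eq (toℕ<n w)))))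
      (lia (N ∷ L ∷ e 0F ∷ e 1F ∷ []) (λ N L a c → L :≡ N :+ N ∷ [] , con 1 :+ c :+ a :+ L :≡ N :+ N :+ a :+ c :+ con 1) L≡)
    chord (8+ i) x (p , q) = ⊥-elim (≤⇒≯ p q)

    classified : Classified
    classified = found , λ x → let i , inᵢ = block (toℕ x) (subst (toℕ x <_) L≡ (toℕ<n x)) in chord i x inᵢ

  classify : ∀ {m} (S : suc m ⊑ L) (sound : Sound S) (complete : Complete S) →
    (suc m ≡ 4 × (∀ t → Blocks.μ S sound complete t ≡ ζ (ζ t))) ⊎ (suc m ≡ 6 × (∀ t → Blocks.μ S sound complete t ≡ ζ (ζ (ζ t)))) → Classified
  classify S sound complete (inj₁ (refl , opposite)) = Four.classified S sound complete opposite
  classify S sound complete (inj₂ (refl , opposite)) = Six.classified S sound complete opposite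

  classified : Classified
  classified = go _ (support (long? φ)) (support-sound (long? φ)) (support-complete (long? φ)) long-≤6
    where
    go : ∀ c (S : c ⊑ L) → Sound S → Complete S → c ≤ 6 → Classified
    go zero S sound complete le = ⊥-elim (FP.¬Fin0 (proj₁ (complete _ (proj₂ some-long))))
    go (suc m) S sound complete le = classify S sound complete
      (antipodal (suc m) le (Blocks.μ S sound complete) (Blocks.μ-irreducible S sound complete) zero)

-- Enumeration

open Cuts

cuts-ext : ∀ {N} {c d : Cuts N} → t₁ c ≡ t₁ d → t₂ c ≡ t₂ d → t₃ c ≡ t₃ d → c ≡ d
cuts-ext {c = cuts _ _ _ p q r} {cuts _ _ _ p′ q′ r′} refl refl refl
  rewrite ℕP.≤-irrelevant p p′ | ℕP.≤-irrelevant q q′ | ℕP.≤-irrelevant r r′ = refl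

module _ {L N} (L≡ : L ≡ N + N) where

  matching : Cuts N → Fun L
  matching c = MatchingOnCircle.M c L≡

  matching-valid : ∀ c → ValidMatching N (matching c)
  matching-valid c = record { involutive = M-involutive ; moves = M-moves ; φ-moves = φ-moves ; z-φ = z-φ }
    where open MatchingOnCircle c L≡

  -- The cuts in the first half are exactly the long points of φ below N, so they depend on the
  -- matching alone.
  matching-cut : ∀ {c d} → (∀ x → matching c x ≡ matching d x) → ∀ {v} → v < N → v ≡ t₁ c ⊎ v ≡ t₂ c ⊎ v ≡ t₃ c → v ≡ t₁ d ⊎ v ≡ t₂ d ⊎ v ≡ t₃ d
  matching-cut {c} {d} h {v} v<N v∈ = subst (λ w → w ≡ t₁ d ⊎ w ≡ t₂ d ⊎ w ≡ t₃ d) x≡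
      (D.long-cut (subst (_< N) (sym x≡) v<N) (λ e → long v∈ (trans (h _) (trans (cong (matching d ∘ ζ) (h _)) e))))
    where
    module C = MatchingOnCircle c L≡
    module D = MatchingOnCircle d L≡
    v<L : v < L
    v<L = subst (v <_) (sym L≡) (<-≤-trans v<N (m≤m+n N N))
    x : Fin L
    x = fromℕ< v<L
    x≡ : toℕ x ≡ v
    x≡ = toℕ-fromℕ< v<L
    long : v ≡ t₁ c ⊎ v ≡ t₂ c ⊎ v ≡ t₃ c → Long C.φ x
    long (inj₁ e) = C.long-t₁ (trans x≡ e)
    long (inj₂ (inj₁ e)) = C.long-t₂ (trans x≡ e)
    long (inj₂ (inj₂ e)) = C.long-t₃ (trans x≡ e)

  matching-injective : ∀ {c d} → (∀ x → matching c x ≡ matching d x) → c ≡ d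
  matching-injective {c} {d} h = cuts-ext
    (≤-antisym (least c (from-d (in₁ d))) (least d (from-c (in₁ c))))
    (middle (from-c (in₂ c)) (from-d (in₂ d)))
    top
    where
    Of : Cuts N → ℕ → Set
    Of c v = v ≡ t₁ c ⊎ v ≡ t₂ c ⊎ v ≡ t₃ c
    bound : ∀ (c : Cuts N) {v} → Of c v → v < N
    bound c (inj₁ refl) = <-trans (t₁<t₂ c) (≤-<-trans (t₂≤t₃ c) (t₃<N c))
    bound c (inj₂ (inj₁ refl)) = ≤-<-trans (t₂≤t₃ c) (t₃<N c)
    bound c (inj₂ (inj₂ refl)) = t₃<N c
    in₁ : ∀ (c : Cuts N) → Of c (t₁ c)
    in₁ c = inj₁ refl
    in₂ : ∀ (c : Cuts N) → Of c (t₂ c)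
    in₂ c = inj₂ (inj₁ refl)
    in₃ : ∀ (c : Cuts N) → Of c (t₃ c)
    in₃ c = inj₂ (inj₂ refl)
    from-c : ∀ {v} → Of c v → Of d v
    from-c p = matching-cut {c} {d} h (bound c p) p
    from-d : ∀ {v} → Of d v → Of c v
    from-d p = matching-cut {d} {c} (λ x → sym (h x)) (bound d p) p
    least : ∀ (c : Cuts N) {v} → Of c v → t₁ c ≤ v
    least c (inj₁ refl) = ≤-refl
    least c (inj₂ (inj₁ refl)) = <⇒≤ (t₁<t₂ c)
    least c (inj₂ (inj₂ refl)) = <⇒≤ (<-≤-trans (t₁<t₂ c) (t₂≤t₃ c))
    greatest : ∀ (c : Cuts N) {v} → Of c v → v ≤ t₃ c
    greatest c (inj₁ refl) = <⇒≤ (<-≤-trans (t₁<t₂ c) (t₂≤t₃ c))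
    greatest c (inj₂ (inj₁ refl)) = t₂≤t₃ c
    greatest c (inj₂ (inj₂ refl)) = ≤-refl
    bottom : t₁ c ≡ t₁ d
    bottom = ≤-antisym (least c (from-d (in₁ d))) (least d (from-c (in₁ c)))
    top : t₃ c ≡ t₃ d
    top = ≤-antisym (greatest d (from-c (in₃ c))) (greatest c (from-d (in₃ d)))
    middle : Of d (t₂ c) → Of c (t₂ d) → t₂ c ≡ t₂ d
    middle (inj₁ e) _ = ⊥-elim (<-irrefl (trans bottom (sym e)) (t₁<t₂ c))
    middle _ (inj₁ e) = ⊥-elim (<-irrefl (trans (sym bottom) (sym e)) (t₁<t₂ d))
    middle (inj₂ (inj₁ e)) _ = e
    middle _ (inj₂ (inj₁ e)) = sym e
    -- Each middle cut is the last cut of the other triple; the last cuts agree, so all four numbers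
    -- coincide.
    middle (inj₂ (inj₂ e)) (inj₂ (inj₂ e′)) = trans e (trans (sym top) (sym e′))

matching-surjective : ∀ {L N} (L≡ : suc L ≡ N + N) {M : Fun (suc L)} → ValidMatching N M → ∃ λ c → ∀ x → M x ≡ matching L≡ c x
matching-surjective L≡ {M} V = proj₁ found , λ x → sym (MatchingOnCircle.M-chord (proj₁ found) L≡ (proj₂ found x))
  where
  found = Classification.classified L≡ V

increasing⇒⊑ : ∀ {m} n (f : Fin m → ℕ) → (∀ {s t} → toℕ s < toℕ t → f s < f t) → (∀ t → f t < n) →
  ∃ λ (S : m ⊑ n) → ∀ t → toℕ (emb S t) ≡ f t
increasing⇒⊑ {zero} zero f mono bound = done , λ ()
increasing⇒⊑ {suc m} zero f mono bound = ⊥-elim (ℕP.n≮0 (bound zero))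
increasing⇒⊑ {zero} (suc n) f mono bound with increasing⇒⊑ n f (λ {}) (λ ())
... | S , _ = drop S , λ ()
increasing⇒⊑ {suc m} (suc n) f mono bound with f zero in eq
... | zero = step (increasing⇒⊑ n (λ t → pred (f (suc t))) (λ lt → ℕP.pred-mono-< {{>-nonZero (pos _)}} (mono (s≤s lt)))
        (λ t → ≤-pred (subst (_≤ suc n) (sym (cong suc (ℕP.suc-pred _ {{>-nonZero (pos t)}}))) (bound (suc t)))))
  where
  pos : ∀ t → 0 < f (suc t)
  pos t = subst (_< f (suc t)) eq (mono {zero} {suc t} (s≤s z≤n))
  step : (∃ λ (S : m ⊑ n) → ∀ t → toℕ (emb S t) ≡ pred (f (suc t))) → ∃ λ (S : suc m ⊑ suc n) → ∀ t → toℕ (emb S t) ≡ f t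
  step (S , h) = keep S , λ { zero → sym eq ; (suc t) → trans (cong suc (h t)) (ℕP.suc-pred _ {{>-nonZero (pos t)}}) }
... | suc a = step (increasing⇒⊑ n (λ t → pred (f t)) (λ lt → ℕP.pred-mono-< {{>-nonZero (pos _)}} (mono lt))
        (λ t → ≤-pred (subst (_≤ suc n) (sym (cong suc (ℕP.suc-pred _ {{>-nonZero (pos t)}}))) (bound t))))
  where
  pos : ∀ t → 0 < f t
  pos zero = subst (0 <_) (sym eq) (s≤s z≤n)
  pos (suc t) = <-trans (subst (0 <_) (sym eq) (s≤s z≤n)) (mono {zero} {suc t} (s≤s z≤n))
  step : (∃ λ (S : suc m ⊑ n) → ∀ t → toℕ (emb S t) ≡ pred (f t)) → ∃ λ (S : suc m ⊑ suc n) → ∀ t → toℕ (emb S t) ≡ f t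
  step (S , h) = drop S , λ t → trans (cong suc (h t)) (ℕP.suc-pred _ {{>-nonZero (pos t)}})

⊑-emb-ext : ∀ {m n} (S S′ : m ⊑ n) → (∀ t → toℕ (emb S t) ≡ toℕ (emb S′ t)) → S ≡ S′
⊑-emb-ext S S′ h = ⊑-ext S S′ (λ { i (t , e) → t , trans (sym (toℕ-injective (h t))) e }) (λ { i (t , e) → t , trans (toℕ-injective (h t)) e })

module Triple {q} (S : 3 ⊑ q) where
  v₀ v₁ v₂ : ℕ
  v₀ = toℕ (emb S 0F)
  v₁ = toℕ (emb S 1F)
  v₂ = toℕ (emb S 2F)
  v₀<v₁ : v₀ < v₁
  v₀<v₁ = emb-mono S (s≤s z≤n)
  v₁<v₂ : v₁ < v₂
  v₁<v₂ = emb-mono S (s≤s (s≤s z≤n))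
  v₂<q : v₂ < q
  v₂<q = toℕ<n (emb S 2F)

triple : ∀ {q a b c} → a < b → b < c → c < q → ∃ λ (S : 3 ⊑ q) → Triple.v₀ S ≡ a × Triple.v₁ S ≡ b × Triple.v₂ S ≡ c
triple {q} {a} {b} {c} a<b b<c c<q with increasing⇒⊑ q f mono (λ t → ≤-<-trans (top t) c<q)
  where
  f : Fin 3 → ℕ
  f 0F = a
  f 1F = b
  f 2F = c
  mono : ∀ {s t} → toℕ s < toℕ t → f s < f t
  mono {0F} {1F} _ = a<b
  mono {0F} {2F} _ = <-trans a<b b<c
  mono {1F} {2F} _ = b<c
  mono {1F} {1F} (s≤s ())
  mono {2F} {1F} (s≤s ())
  mono {2F} {2F} (s≤s (s≤s ()))
  top : ∀ t → f t ≤ c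
  top 0F = <⇒≤ (<-trans a<b b<c)
  top 1F = <⇒≤ b<c
  top 2F = ≤-refl
... | S , h = S , h 0F , h 1F , h 2F

triple-ext : ∀ {q} {S S′ : 3 ⊑ q} → Triple.v₀ S ≡ Triple.v₀ S′ → Triple.v₁ S ≡ Triple.v₁ S′ → Triple.v₂ S ≡ Triple.v₂ S′ → S ≡ S′
triple-ext {S = S} {S′} p q r = ⊑-emb-ext S S′ λ { 0F → p ; 1F → q ; 2F → r }

pred-injective : ∀ {a b x y} → a < x → b < y → pred x ≡ pred y → x ≡ y
pred-injective {x = suc x} {suc y} _ _ e = cong suc e

-- Raising t₃ by one turns t₂ ≤ t₃ < N into strict inequalities below N + 1, so the number of cuts
-- is N + 1 choose 3.
cutsOf : ∀ {N} → 3 ⊑ suc N → Cuts N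
cutsOf S = cuts v₀ v₁ (pred v₂) v₀<v₁ (ℕP.pred-mono-≤ v₁<v₂)
    (≤-trans (≤-reflexive (ℕP.suc-pred v₂ {{>-nonZero (≤-<-trans z≤n v₁<v₂)}})) (≤-pred v₂<q))
  where open Triple S

cutsOf-injective : ∀ {N} {S S′ : 3 ⊑ suc N} → cutsOf S ≡ cutsOf S′ → S ≡ S′
cutsOf-injective {S = S} {S′} e = triple-ext {S = S} {S′} (cong t₁ e) (cong t₂ e) (pred-injective (Triple.v₁<v₂ S) (Triple.v₁<v₂ S′) (cong t₃ e))

cutsOf-surjective : ∀ {N} (c : Cuts N) → ∃ λ S → c ≡ cutsOf S
cutsOf-surjective (cuts a b c p q r) with triple p (s≤s q) (s≤s r)
... | S , e , f , g = S , cuts-ext (sym e) (sym f) (cong pred (sym g))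

-- Good maps and matchings; zero and two back points

goods-count : ∀ {m k} {P : Set} {ps : List P} (enc : P → Fun m) → Unique ps → (∀ p → p ∈ ps) → (∀ p → Good k (enc p)) →
  (∀ p q → (∀ i → enc p i ≡ enc q i) → p ≡ q) → (∀ g → Good k g → ∃ λ p → ∀ i → g i ≡ enc p i) →
  length (goods m k) ≡ length ps
goods-count {m} {k} {ps = ps} enc u all good inj surj = trans
  (length-cong (goods-unique m k) (map-unique (λ p → tabulate (enc p)) u
    (λ _ _ e → inj _ _ λ i → trans (sym (VP.lookup∘tabulate _ i)) (trans (cong (λ v → lookup v i) e) (VP.lookup∘tabulate _ i))))
    (λ v∈ → to (surj _ (∈-goods⁻ v∈)))
    (λ v∈ → from (∈P.∈-map⁻ _ v∈)))
  (LP.length-map _ ps)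
  where
  to : ∀ {v} → (∃ λ p → ∀ i → lookup v i ≡ enc p i) → v ∈ map (λ p → tabulate (enc p)) ps
  to (p , h) = subst (_∈ map (λ p → tabulate (enc p)) ps) (lookup-ext λ i → trans (VP.lookup∘tabulate _ i) (sym (h i))) (∈P.∈-map⁺ _ (all p))
  from : ∀ {v} → (∃ λ p → p ∈ ps × v ≡ tabulate (enc p)) → v ∈ goods m k
  from (p , _ , refl) = ∈-goods⁺ (good-cong (λ i → sym (VP.lookup∘tabulate (enc p) i)) (good p))

unmixed-involutive : ∀ {n} {f : Fun n} → IsPerm f → (∀ x → f x ≢ x) → n ≡ 2 * z f → ∀ x → f (f x) ≡ x
unmixed-involutive {n} {f} pf moves e x with f (f x) F.≟ x
... | yes p = p
... | no l = ⊥-elim (lia (n ∷ z f ∷ count (mid? f) ∷ count (long? f) ∷ [])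
    (λ n z c l → n :≡ 2 :* z ∷ n :≡ 2 :* z :+ c ∷ l :≤ 3 :* c ∷ con 1 :≤ l ∷ [] , :⊥)
    e size long-count (count-positive (long? f) x l))
  where open Derangement pf moves using (size; long-count)

involution-z : ∀ {n} {f : Fun n} → (∀ x → f (f x) ≡ x) → (∀ x → f x ≢ x) → n ≡ 2 * z f
involution-z {n} {f} inv moves = trans size (trans (cong (λ w → 2 * z f + w) (count-none (mid? f) (λ x m → mid-long m (inv x)))) (+-identityʳ _))
  where open Derangement (λ x y e → trans (sym (inv x)) (trans (cong f e) (inv y))) moves using (size; mid-long)

module _ {L N} (L≡ : L ≡ N + N) {M : Fun L} (V : ValidMatching N M) where
  open ValidMatching V

  private
    z-M : z M ≡ N
    z-M = lia (z M ∷ N ∷ L ∷ []) (λ z N L → L :≡ N :+ N ∷ L :≡ 2 :* z ∷ [] , z :≡ N) L≡ (involution-z involutive moves)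

  -- Here M is α′, so γ′ is ζ⁻¹ ∘ M, the inverse of φ, and k = N.
  valid⇒good₀ : Good N (λ t → ζ⁻¹ (M t))
  valid⇒good₀ = pg , (λ t e → φ-moves t (trans (cong M (trans (cong ζ (sym e)) (ζ-ζ⁻¹ (M t)))) (involutive t))) ,
    (λ t e → moves t (trans (sym (ζ-ζ⁻¹ (M t))) e)) , trans (z-cong (∘-perm ζ-perm pg) perm (λ t → ζ-ζ⁻¹ (M t))) z-M ,
    lia (z g ∷ z φ ∷ N ∷ L ∷ []) (λ g f N L → g :≡ f ∷ f :+ con 1 :≡ N ∷ L :≡ N :+ N ∷ [] , g :+ N :+ con 1 :≡ L)
      (z-inverse pg (∘-perm perm ζ-perm) (λ x → trans (cong ζ⁻¹ (involutive (ζ x))) (ζ⁻¹-ζ x))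
        (λ x → trans (cong M (ζ-ζ⁻¹ (M x))) (involutive x))) z-φ L≡
    where
    g = λ t → ζ⁻¹ (M t)
    φ = λ x → M (ζ x)
    pg : IsPerm g
    pg = ∘-perm ζ⁻¹-perm perm

  -- Here M is γ′, and α′ = ζ ∘ M is conjugate to φ by ζ, so k = N - 1.
  valid⇒good₂ : ∀ {k} → N ≡ suc k → Good k M
  valid⇒good₂ {k} N≡ = perm , moves , (λ t e → φ-moves (M t) (cong M e)) ,
    trans (sym (z-conjugate (∘-perm perm ζ-perm) (∘-perm ζ-perm perm) ζ-perm (λ x → refl))) (suc-injective (trans (trans (+-comm 1 _) z-φ) N≡)) ,
    lia (z M ∷ k ∷ N ∷ L ∷ []) (λ z k N L → z :≡ N ∷ N :≡ con 1 :+ k ∷ L :≡ N :+ N ∷ [] , z :+ k :+ con 1 :≡ L) z-M N≡ L≡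

good⇒valid₀ : ∀ {L N} → L ≡ N + N → {g : Fun L} → Good N g → ValidMatching N (λ t → ζ (g t))
good⇒valid₀ {L} {N} L≡ {g} (pg , g-moves , α-moves , zα , e) = record
  { involutive = invol ; moves = α-moves
  ; φ-moves = λ x q → g-moves x (ζ-perm _ _ (trans (sym (cong (ζ ∘ g) q)) (invol (ζ x))))
  ; z-φ = lia (z g ∷ z (λ x → ζ (g (ζ x))) ∷ N ∷ L ∷ []) (λ g f N L → g :≡ f ∷ g :+ N :+ con 1 :≡ L ∷ L :≡ N :+ N ∷ [] , f :+ con 1 :≡ N)
      (z-inverse pg (∘-perm (∘-perm ζ-perm pg) ζ-perm) (λ x → ζ-perm _ _ (invol (ζ x))) invol) e L≡ }
  where
  invol : ∀ x → ζ (g (ζ (g x))) ≡ x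
  invol = unmixed-involutive (∘-perm ζ-perm pg) α-moves
      (lia (L ∷ N ∷ z (λ t → ζ (g t)) ∷ []) (λ L N z → L :≡ N :+ N ∷ z :≡ N ∷ [] , L :≡ 2 :* z) L≡ zα)

good⇒valid₂ : ∀ {L N k} → L ≡ N + N → N ≡ suc k → {g : Fun L} → Good k g → ValidMatching N g
good⇒valid₂ {L} {N} {k} L≡ N≡ {g} (pg , g-moves , α-moves , zα , e) = record
  { involutive = unmixed-involutive pg g-moves
      (lia (L ∷ N ∷ k ∷ z g ∷ []) (λ L N k z → L :≡ N :+ N ∷ N :≡ con 1 :+ k ∷ z :+ k :+ con 1 :≡ L ∷ [] , L :≡ 2 :* z) L≡ N≡ e)
  ; moves = g-moves ; φ-moves = λ x q → α-moves (ζ x) (cong ζ q)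
  ; z-φ = trans (cong (_+ 1) (trans (z-conjugate (∘-perm pg ζ-perm) (∘-perm ζ-perm pg) ζ-perm (λ x → refl)) zα)) (trans (+-comm k 1) (sym N≡)) }

length-goods₀ : ∀ k → length (goods (suc k + suc k) (suc k)) ≡ suc (suc k) C 3
length-goods₀ k = trans (goods-count (λ S t → ζ⁻¹ (matching refl (cutsOf S) t)) (subsets-unique 3 (suc (suc k))) subsets-complete
    (λ S → valid⇒good₀ refl (matching-valid refl (cutsOf S)))
    (λ S S′ h → cutsOf-injective (matching-injective refl (λ x → ζ⁻¹-perm _ _ (h x))))
    surj) (length-subsets 3 (suc (suc k)))
  where
  surj : ∀ g → Good (suc k) g → ∃ λ S → ∀ i → g i ≡ ζ⁻¹ (matching refl (cutsOf S) i)
  surj g G = go (matching-surjective refl (good⇒valid₀ refl G))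
    where
    go : (∃ λ c → ∀ x → ζ (g x) ≡ matching refl c x) → ∃ λ S → ∀ i → g i ≡ ζ⁻¹ (matching refl (cutsOf S) i)
    go (c , h) = proj₁ (cutsOf-surjective c) , λ i → trans (sym (ζ⁻¹-ζ (g i)))
        (cong ζ⁻¹ (trans (h i) (cong (λ d → matching refl d i) (proj₂ (cutsOf-surjective c)))))

length-goods₂ : ∀ k → length (goods (suc k + suc k) k) ≡ suc (suc k) C 3
length-goods₂ k = trans (goods-count (λ S → matching refl (cutsOf S)) (subsets-unique 3 (suc (suc k))) subsets-complete
    (λ S → valid⇒good₂ refl (matching-valid refl (cutsOf S)) refl)
    (λ S S′ h → cutsOf-injective (matching-injective refl h))
    surj) (length-subsets 3 (suc (suc k)))
  where
  surj : ∀ g → Good k g → ∃ λ S → ∀ i → g i ≡ matching refl (cutsOf S) i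
  surj g G = go (matching-surjective refl (good⇒valid₂ refl refl G))
    where
    go : (∃ λ c → ∀ x → g x ≡ matching refl c x) → ∃ λ S → ∀ i → g i ≡ matching refl (cutsOf S) i
    go (c , h) = proj₁ (cutsOf-surjective c) , λ i → trans (h i) (cong (λ d → matching refl d i) (proj₂ (cutsOf-surjective c)))

-- One back point: doubling the circle

evenF oddF : ∀ {m} → Fin m → Fin (m * 2)
evenF zero = zero
evenF (suc i) = suc (suc (evenF i))
oddF zero = suc zero
oddF (suc i) = suc (suc (oddF i))

toℕ-even : ∀ {m} (i : Fin m) → toℕ (evenF i) ≡ toℕ i + toℕ i
toℕ-even zero = refl
toℕ-even (suc i) = trans (cong (λ w → suc (suc w)) (toℕ-even i)) (cong suc (sym (+-suc (toℕ i) (toℕ i))))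

toℕ-odd : ∀ {m} (i : Fin m) → toℕ (oddF i) ≡ suc (toℕ i + toℕ i)
toℕ-odd zero = refl
toℕ-odd (suc i) = trans (cong (λ w → suc (suc w)) (toℕ-odd i)) (cong (λ w → suc (suc w)) (sym (+-suc (toℕ i) (toℕ i))))

*2≡+ : ∀ m → m * 2 ≡ m + m
*2≡+ m = trans (ℕP.*-comm m 2) (cong (λ w → m + w) (+-identityʳ m))

ζ-even : ∀ {m} (i : Fin m) → ζ (evenF i) ≡ oddF i
ζ-even {m} i = toℕ-injective (trans (ζ-next (subst (_< m * 2) odd≡ (toℕ<n (oddF i)))) (sym odd≡))
  where
  odd≡ : toℕ (oddF i) ≡ suc (toℕ (evenF i))
  odd≡ = trans (toℕ-odd i) (cong suc (sym (toℕ-even i)))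

ζ-odd : ∀ {m} (i : Fin m) → ζ (oddF i) ≡ evenF (ζ i)
ζ-odd {m} i with ζ-view i
... | next lt e = toℕ-injective (trans (ζ-next {x = oddF i} (lia (toℕ (oddF i) ∷ toℕ i ∷ m ∷ m * 2 ∷ [])
      (λ o i m L → o :≡ con 1 :+ (i :+ i) ∷ con 1 :+ i :< m ∷ L :≡ m :+ m ∷ [] , con 1 :+ o :< L) (toℕ-odd i) lt (*2≡+ m)))
    (lia (toℕ (oddF i) ∷ toℕ i ∷ toℕ (ζ i) ∷ toℕ (evenF (ζ i)) ∷ [])
      (λ o i j e → o :≡ con 1 :+ (i :+ i) ∷ j :≡ con 1 :+ i ∷ e :≡ j :+ j ∷ [] , con 1 :+ o :≡ e)
      (toℕ-odd i) e (toℕ-even (ζ i))))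
... | last p e = toℕ-injective (trans (ζ-last {x = oddF i} (lia (toℕ (oddF i) ∷ toℕ i ∷ m ∷ m * 2 ∷ [])
      (λ o i m L → o :≡ con 1 :+ (i :+ i) ∷ con 1 :+ i :≡ m ∷ L :≡ m :+ m ∷ [] , con 1 :+ o :≡ L) (toℕ-odd i) p (*2≡+ m)))
    (sym (trans (toℕ-even (ζ i)) (cong (λ w → w + w) e))))

-- The circle has `m * 2` rather than `m + m` points because `suc m * 2` reduces to two successors,
-- as the recursion requires.
data Half {m} : Fin (m * 2) → Set where
  isEven : (i : Fin m) → Half (evenF i)
  isOdd : (i : Fin m) → Half (oddF i)

half : ∀ {m} (x : Fin (m * 2)) → Half {m} x
half {suc m} zero = isEven zero
half {suc m} (suc zero) = isOdd zero
half {suc m} (suc (suc x)) with half {m} x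
... | isEven i = isEven (suc i)
... | isOdd i = isOdd (suc i)

index : ∀ {m} {x : Fin (m * 2)} → Half {m} x → Fin m
index (isEven i) = i
index (isOdd i) = i

double-injective : ∀ a b → a + a ≡ b + b → a ≡ b
double-injective a b e = lia (a ∷ b ∷ []) (λ a b → a :+ a :≡ b :+ b ∷ [] , a :≡ b) e

even-injective : ∀ {m} {i j : Fin m} → evenF i ≡ evenF j → i ≡ j
even-injective {i = i} {j} e = toℕ-injective (double-injective _ _ (trans (sym (toℕ-even i)) (trans (cong toℕ e) (toℕ-even j))))

odd-injective : ∀ {m} {i j : Fin m} → oddF i ≡ oddF j → i ≡ j
odd-injective {i = i} {j} e = toℕ-injective (double-injective _ _ (suc-injective (trans (sym (toℕ-odd i)) (trans (cong toℕ e) (toℕ-odd j)))))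

evenF≢oddF : ∀ {m} (i j : Fin m) → evenF i ≢ oddF j
evenF≢oddF i j e = even≢odd (toℕ i) (toℕ j) (trans (sym (toℕ-even i)) (trans (cong toℕ e) (toℕ-odd j)))

half-even : ∀ {m} (i : Fin m) → half {m} (evenF i) ≡ isEven i
half-even zero = refl
half-even (suc i) rewrite half-even i = refl

half-odd : ∀ {m} (i : Fin m) → half {m} (oddF i) ≡ isOdd i
half-odd zero = refl
half-odd (suc i) rewrite half-odd i = refl

even-mono : ∀ {m} {s t : Fin m} → toℕ s < toℕ t → toℕ (evenF s) < toℕ (evenF t)
even-mono {s = s} {t} lt = subst₂ _<_ (sym (toℕ-even s)) (sym (toℕ-even t)) (ℕP.+-mono-< lt lt)

odd-mono : ∀ {m} {s t : Fin m} → toℕ s < toℕ t → toℕ (oddF s) < toℕ (oddF t)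
odd-mono {s = s} {t} lt = subst₂ _<_ (sym (toℕ-odd s)) (sym (toℕ-odd t)) (s≤s (ℕP.+-mono-< lt lt))

sum-halves : ∀ {m} (f : Fin (m * 2) → ℕ) → sum f ≡ sum {m} (λ i → f (evenF i)) + sum {m} (λ i → f (oddF i))
sum-halves {zero} f = refl
sum-halves {suc m} f = trans (cong (λ w → f zero + (f (suc zero) + w)) (sum-halves {m} (λ x → f (suc (suc x)))))
  (lia (f zero ∷ f (suc zero) ∷ sum {m} (λ i → f (suc (suc (evenF i)))) ∷ sum {m} (λ i → f (suc (suc (oddF i)))) ∷ [])
    (λ a b c d → [] , a :+ (b :+ (c :+ d)) :≡ a :+ c :+ (b :+ d)))

z-halves : ∀ {m} {f : Fun (m * 2)} {a b : Fun m} → IsPerm f → IsPerm a → IsPerm b →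
  (∀ i → f (evenF i) ≡ evenF (a i)) → (∀ i → f (oddF i) ≡ oddF (b i)) → z f ≡ z a + z b
z-halves {m} {f} {a} {b} pf pa pb ea eb = begin
  z f ≡⟨ trans (z-count f) (sum-halves {m} (λ x → ι (cycleMin? f x))) ⟩
  count {m} (λ i → cycleMin? f (evenF i)) + count {m} (λ i → cycleMin? f (oddF i))
    ≡⟨ cong₂ _+_ (count-cong {m} (λ i → cycleMin? f (evenF i)) (cycleMin? a) (emb-min pa pf evenF (even-mono {m}) ea)
        (min-emb pa pf evenF (even-mono {m}) ea))
                 (count-cong {m} (λ i → cycleMin? f (oddF i)) (cycleMin? b) (emb-min pb pf oddF (odd-mono {m}) eb)
                   (min-emb pb pf oddF (odd-mono {m}) eb)) ⟩
  count (cycleMin? a) + count (cycleMin? b) ≡⟨ cong₂ _+_ (z-count a) (z-count b) ⟨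
  z a + z b ∎
  where open ≡-Reasoning

-- The polygon of the unicellular bipartite map with edges g: side 2i is glued to side 2 g(i) + 1.
record Doubling {m} (g h : Fun m) (M : Fun (m * 2)) : Set where
  field
    gh : ∀ i → g (h i) ≡ i
    hg : ∀ i → h (g i) ≡ i
    M-even : ∀ i → M (evenF i) ≡ oddF (g i)
    M-odd : ∀ i → M (oddF i) ≡ evenF (h i)

  g-perm : IsPerm g
  g-perm x y e = trans (sym (hg x)) (trans (cong h e) (hg y))

  h-perm : IsPerm h
  h-perm x y e = trans (sym (gh x)) (trans (cong g e) (gh y))

  M-involutive : ∀ x → M (M x) ≡ x
  M-involutive x with half {m} x
  ... | isEven i = trans (cong M (M-even i)) (trans (M-odd (g i)) (cong evenF (hg i)))
  ... | isOdd i = trans (cong M (M-odd i)) (trans (M-even (h i)) (cong oddF (gh i)))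

  M-perm : IsPerm M
  M-perm x y e = trans (sym (M-involutive x)) (trans (cong M e) (M-involutive y))

  -- φ preserves parity: on even points it acts as the inverse of g, on odd points as g ∘ ζ, which
  -- is conjugate to α′.
  z-doubled : z (λ x → M (ζ x)) ≡ z g + z (λ t → ζ (g t))
  z-doubled = trans (z-halves (∘-perm M-perm ζ-perm) h-perm (∘-perm g-perm ζ-perm)
      (λ i → trans (cong M (ζ-even i)) (M-odd i)) (λ i → trans (cong M (ζ-odd i)) (M-even (ζ i))))
    (cong₂ _+_ (z-inverse h-perm g-perm hg gh) (z-conjugate (∘-perm g-perm ζ-perm) (∘-perm ζ-perm g-perm) ζ-perm (λ x → refl)))

  odd-sum : ∀ x → ∃ λ d → toℕ x + toℕ (M x) ≡ suc (d + d)
  odd-sum x with half {m} x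
  ... | isEven i = toℕ i + toℕ (g i) , lia (toℕ i ∷ toℕ (g i) ∷ toℕ (evenF i) ∷ toℕ (oddF (g i)) ∷ toℕ (M (evenF i)) ∷ [])
    (λ i j a b c → a :≡ i :+ i ∷ b :≡ con 1 :+ (j :+ j) ∷ c :≡ b ∷ [] , a :+ c :≡ con 1 :+ (i :+ j :+ (i :+ j))) (toℕ-even i)
      (toℕ-odd (g i)) (cong toℕ (M-even i))
  ... | isOdd i = toℕ i + toℕ (h i) , lia (toℕ i ∷ toℕ (h i) ∷ toℕ (oddF i) ∷ toℕ (evenF (h i)) ∷ toℕ (M (oddF i)) ∷ [])
    (λ i j a b c → a :≡ con 1 :+ (i :+ i) ∷ b :≡ j :+ j ∷ c :≡ b ∷ [] , a :+ c :≡ con 1 :+ (i :+ j :+ (i :+ j))) (toℕ-odd i)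
      (toℕ-even (h i)) (cong toℕ (M-odd i))

  good⇒valid₁ : ∀ {k} → Good k g → ValidMatching m M
  good⇒valid₁ {k} (_ , g-moves , α-moves , zα , e) = record
    { involutive = M-involutive
    ; moves = moves′
    ; φ-moves = φ-moves′
    ; z-φ = lia (z (λ x → M (ζ x)) ∷ z g ∷ z (λ t → ζ (g t)) ∷ k ∷ m ∷ [])
        (λ f g a k m → f :≡ g :+ a ∷ a :≡ k ∷ g :+ k :+ con 1 :≡ m ∷ [] , f :+ con 1 :≡ m) z-doubled zα e }
    where
    moves′ : ∀ x → M x ≢ x
    moves′ x q with half {m} x
    ... | isEven i = evenF≢oddF i (g i) (trans (sym q) (M-even i))
    ... | isOdd i = evenF≢oddF (h i) i (trans (sym (M-odd i)) q)
    φ-moves′ : ∀ x → M (ζ x) ≢ x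
    φ-moves′ x q with half {m} x
    ... | isEven i = g-moves i (trans (cong g (sym (even-injective (trans (sym (trans (cong M (ζ-even i)) (M-odd i))) q)))) (gh i))
    ... | isOdd i = α-moves (ζ i) (cong ζ (odd-injective (trans (sym (trans (cong M (ζ-odd i)) (M-even (ζ i)))) q)))

  -- The matching determines only the sum of the two cycle numbers, which is 2k. But on 2k + 1
  -- points a permutation without fixed points has at most k cycles, so both equal k.
  valid⇒good₁ : ∀ {k} → m ≡ suc (k + k) → ValidMatching m M → Good k g
  valid⇒good₁ {k} m≡ V = g-perm , g-moves , α-moves , proj₁ counts , proj₂ counts
    where
    open ValidMatching V using (φ-moves; z-φ)
    α = λ t → ζ (g t)
    g-moves : ∀ t → g t ≢ t
    g-moves t e = φ-moves (evenF t) (trans (cong M (ζ-even t)) (trans (M-odd t) (cong evenF (trans (cong h (sym e)) (hg t)))))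
    α-moves : ∀ t → ζ (g t) ≢ t
    α-moves t e = φ-moves (oddF (g t)) (trans (cong M (trans (ζ-odd (g t)) (cong evenF e))) (M-even t))
    bound : ∀ {f : Fun m} → IsPerm f → (∀ x → f x ≢ x) → z f ≤ k
    bound {f} pf moves with count (mid? f) in eq
    ... | suc c = lia (m ∷ k ∷ z f ∷ c ∷ count (mid? f) ∷ [])
        (λ m k z c d → m :≡ con 1 :+ (k :+ k) ∷ m :≡ 2 :* z :+ d ∷ d :≡ con 1 :+ c ∷ [] , z :≤ k) m≡ (Derangement.size pf moves) eq
    ... | zero = ⊥-elim (even≢odd (z f) k (lia (m ∷ k ∷ z f ∷ count (mid? f) ∷ [])
        (λ m k z d → m :≡ con 1 :+ (k :+ k) ∷ m :≡ 2 :* z :+ d ∷ d :≡ con 0 ∷ [] , z :+ z :≡ con 1 :+ (k :+ k)) m≡ (Derangement.size pf moves) eq))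
    counts : z α ≡ k × z g + k + 1 ≡ m
    counts = lia (m ∷ k ∷ z g ∷ z α ∷ z (λ x → M (ζ x)) ∷ [])
        (λ m k g a f → m :≡ con 1 :+ (k :+ k) ∷ g :≤ k ∷ a :≤ k ∷ f :≡ g :+ a ∷ f :+ con 1 :≡ m ∷ [] ,
      a :≡ k :∧ g :+ k :+ con 1 :≡ m) m≡ (bound g-perm g-moves) (bound (∘-perm ζ-perm g-perm) α-moves) z-doubled z-φ

doubled : ∀ {m} (g h : Fun m) → Fun (m * 2)
doubled {m} g h x with half {m} x
... | isEven i = oddF (g i)
... | isOdd i = evenF (h i)

doubled-even : ∀ {m} (g h : Fun m) i → doubled g h (evenF i) ≡ oddF (g i)
doubled-even g h i rewrite half-even i = refl

doubled-odd : ∀ {m} (g h : Fun m) i → doubled g h (oddF i) ≡ evenF (h i)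
doubled-odd g h i rewrite half-odd i = refl

doubling : ∀ {m} {g h : Fun m} → (∀ i → g (h i) ≡ i) → (∀ i → h (g i) ≡ i) → Doubling g h (doubled g h)
doubling {g = g} {h} gh hg = record { gh = gh ; hg = hg ; M-even = doubled-even g h ; M-odd = doubled-odd g h }

halved : ∀ {m} → Fun (m * 2) → Fun m
halved {m} M i = index {m} (half {m} (M (evenF i)))

-- An odd sum means that the chord joins an even to an odd point, so M restricted to even points is
-- a permutation g of the indices.
halving : ∀ {m} {M : Fun (m * 2)} → ValidMatching m M → (∀ x → ∃ λ d → toℕ x + toℕ (M x) ≡ suc (d + d)) →
  ∃ λ h → Doubling (halved M) h M
halving {m} {M} V odd-sum = h , record { gh = gh ; hg = hg ; M-even = M-even ; M-odd = M-odd }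
  where
  open ValidMatching V using (involutive)
  h : Fun m
  h i = index {m} (half {m} (M (oddF i)))
  flip-even : ∀ i {y} → M (evenF i) ≡ y → (H : Half {m} y) → M (evenF i) ≡ oddF (index {m} H)
  flip-even i e (isOdd j) = e
  flip-even i e (isEven j) = ⊥-elim (clash (odd-sum (evenF i)))
    where
    clash : (∃ λ d → toℕ (evenF i) + toℕ (M (evenF i)) ≡ suc (d + d)) → ⊥
    clash (d , s) = even≢odd (toℕ i + toℕ j) d (lia (toℕ i ∷ toℕ j ∷ d ∷ toℕ (evenF i) ∷ toℕ (evenF j) ∷ toℕ (M (evenF i)) ∷ [])
      (λ i j d a b c → a :≡ i :+ i ∷ b :≡ j :+ j ∷ c :≡ b ∷ a :+ c :≡ con 1 :+ (d :+ d) ∷ [] , i :+ j :+ (i :+ j) :≡ con 1 :+ (d :+ d))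
        (toℕ-even i) (toℕ-even j) (cong toℕ e) s)
  flip-odd : ∀ i {y} → M (oddF i) ≡ y → (H : Half {m} y) → M (oddF i) ≡ evenF (index {m} H)
  flip-odd i e (isEven j) = e
  flip-odd i e (isOdd j) = ⊥-elim (clash (odd-sum (oddF i)))
    where
    clash : (∃ λ d → toℕ (oddF i) + toℕ (M (oddF i)) ≡ suc (d + d)) → ⊥
    clash (d , s) = even≢odd (toℕ i + toℕ j + 1) d (lia (toℕ i ∷ toℕ j ∷ d ∷ toℕ (oddF i) ∷ toℕ (oddF j) ∷ toℕ (M (oddF i)) ∷ [])
      (λ i j d a b c → a :≡ con 1 :+ (i :+ i) ∷ b :≡ con 1 :+ (j :+ j) ∷ c :≡ b ∷ a :+ c :≡ con 1 :+ (d :+ d) ∷ [] , i :+ j :+ con 1 :+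
        (i :+ j :+ con 1) :≡ con 1 :+ (d :+ d)) (toℕ-odd i) (toℕ-odd j) (cong toℕ e) s)
  M-even : ∀ i → M (evenF i) ≡ oddF (halved M i)
  M-even i = flip-even i refl (half {m} (M (evenF i)))
  M-odd : ∀ i → M (oddF i) ≡ evenF (h i)
  M-odd i = flip-odd i refl (half {m} (M (oddF i)))
  gh : ∀ i → halved M (h i) ≡ i
  gh i = odd-injective {m} (trans (sym (M-even (h i))) (trans (cong M (sym (M-odd i))) (involutive (oddF i))))
  hg : ∀ i → h (halved M i) ≡ i
  hg i = even-injective {m} (trans (sym (M-odd (halved M i))) (trans (cong M (sym (M-even i))) (involutive (evenF i))))

-- Parity of the cuts

EvenOrOdd : ℕ → Set
EvenOrOdd n = (∃ λ a → n ≡ a + a) ⊎ (∃ λ a → n ≡ suc (a + a))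

evenOrOdd : ∀ n → EvenOrOdd n
evenOrOdd zero = inj₁ (0 , refl)
evenOrOdd (suc n) with evenOrOdd n
... | inj₁ (a , e) = inj₂ (a , cong suc e)
... | inj₂ (a , e) = inj₁ (suc a , trans (cong suc e) (cong suc (sym (+-suc a a))))

-- On an odd circle the doubled matchings are those whose cuts alternate in parity.
Alternating : ∀ {N} → Cuts N → Set
Alternating {N} c = (∃ λ u → t₁ c + t₃ c ≡ u + u) × (∃ λ v → N + t₁ c + t₂ c ≡ v + v)

module _ {L N} (L≡ : L ≡ N + N) (c : Cuts N) where
  open Matching c
  open MatchingOnCircle c L≡ using (chord-M)

  alternating⁺ : Alternating c → ∀ x → ∃ λ d → toℕ x + toℕ (matching L≡ c x) ≡ suc (d + d)
  alternating⁺ ((u , eu) , (v , ev)) x = go (chord-M x)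
    where
    a = t₁ c
    b = t₂ c
    d = t₃ c
    -- The third total needs no condition of its own: its parity is that of the sum of the other
    -- two.
    N+b+d : ∃ λ w → N + b + d + 1 ≡ suc (w + w)
    N+b+d with evenOrOdd (N + b + d)
    ... | inj₁ (w , e) = w , trans (+-comm _ 1) (cong suc e)
    ... | inj₂ (w , e) = ⊥-elim (even≢odd (u + v) (w + a) (lia (N ∷ a ∷ b ∷ d ∷ u ∷ v ∷ w ∷ [])
          (λ N a b d u v w → a :+ d :≡ u :+ u ∷ N :+ a :+ b :≡ v :+ v ∷ N :+ b :+ d :≡ con 1 :+ (w :+ w) ∷ [] , u :+ v :+
            (u :+ v) :≡ con 1 :+ (w :+ a :+ (w :+ a))) eu ev e))
    odd-total : ∀ i {y} → In i y → ∃ λ w → total i ≡ suc (w + w)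
    odd-total 0 _ = u , lia (a ∷ d ∷ u ∷ []) (λ a d u → a :+ d :≡ u :+ u ∷ [] , a :+ d :+ con 1 :≡ con 1 :+ (u :+ u)) eu
    odd-total 1 _ = v , lia (N ∷ a ∷ b ∷ v ∷ []) (λ N a b v → N :+ a :+ b :≡ v :+ v ∷ [] , N :+ a :+ b :+ con 1 :≡ con 1 :+ (v :+ v)) ev
    odd-total 2 _ = N+b+d
    odd-total 3 p = u , lia (a ∷ d ∷ u ∷ []) (λ a d u → a :+ d :≡ u :+ u ∷ [] , a :+ d :+ con 1 :≡ con 1 :+ (u :+ u)) eu
    odd-total 4 _ = N + u , lia (N ∷ a ∷ d ∷ u ∷ [])
        (λ N a d u → a :+ d :≡ u :+ u ∷ [] , N :+ N :+ a :+ d :+ con 1 :≡ con 1 :+ (N :+ u :+ (N :+ u))) eu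
    odd-total 5 p = v , lia (N ∷ a ∷ b ∷ v ∷ []) (λ N a b v → N :+ a :+ b :≡ v :+ v ∷ [] , N :+ a :+ b :+ con 1 :≡ con 1 :+ (v :+ v)) ev
    odd-total 6 _ = N+b+d
    odd-total 7 _ = N + u , lia (N ∷ a ∷ d ∷ u ∷ [])
        (λ N a d u → a :+ d :≡ u :+ u ∷ [] , N :+ N :+ a :+ d :+ con 1 :≡ con 1 :+ (N :+ u :+ (N :+ u))) eu
    odd-total (8+ i) (p , q) = ⊥-elim (≤⇒≯ p q)
    go : Chord (toℕ x) (toℕ (matching L≡ c x)) → ∃ λ d → toℕ x + toℕ (matching L≡ c x) ≡ suc (d + d)
    go (i , p , e) = proj₁ (odd-total i p) , trans e (proj₂ (odd-total i p))

  -- Blocks 0 and 1 are never empty; their totals are tested at their last points t₁ and t₂.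
  alternating⁻ : (∀ x → ∃ λ d → toℕ x + toℕ (matching L≡ c x) ≡ suc (d + d)) → Alternating c
  alternating⁻ h = from 0 (t₁ c) (z≤n , ≤-reflexive (+-comm 1 (t₁ c))) (<-trans (t₁<t₂ c) t₂<N) (+-comm _ 1) ,
    from 1 (t₂ c) (≤-trans (≤-reflexive (+-comm (t₁ c) 1)) (t₁<t₂ c) , ≤-reflexive (+-comm 1 (t₂ c))) t₂<N (+-comm _ 1)
    where
    t₂<N : t₂ c < N
    t₂<N = ≤-<-trans (t₂≤t₃ c) (t₃<N c)
    from : ∀ i v → In i v → v < N → ∀ {s} → total i ≡ suc s → ∃ λ w → s ≡ w + w
    from i v inᵢ v<N eq = go (chord-M x) (h x)
      where
      v<L : v < L
      v<L = subst (v <_) (sym L≡) (<-≤-trans v<N (m≤m+n N N))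
      x : Fin L
      x = fromℕ< v<L
      go : Chord (toℕ x) (toℕ (matching L≡ c x)) → (∃ λ d → toℕ x + toℕ (matching L≡ c x) ≡ suc (d + d)) → ∃ λ w → _ ≡ w + w
      go (j , inⱼ , e) (d , s) = d , suc-injective
          (trans (sym eq) (trans (cong total (In-unique i j inᵢ (subst (In j) (toℕ-fromℕ< v<L) inⱼ))) (trans (sym e) s)))

AlternatingTriple : ℕ → Set
AlternatingTriple k = (3 ⊑ suc (suc k)) ⊎ (3 ⊑ suc k)

alternatingTriples : ∀ k → List (AlternatingTriple k)
alternatingTriples k = map inj₁ (subsets 3 (suc (suc k))) ++ map inj₂ (subsets 3 (suc k))

pred-< : ∀ {a x} → a < x → suc (pred x) ≡ x
pred-< {x = suc x} _ = refl

-- The pattern even, odd, even is 2a, 2b + 1, 2c with a ≤ b < c ≤ k, that is, the strict triple a <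
-- b + 1 < c + 1 below k + 2. The pattern odd, even, odd is 2a + 1, 2b, 2c + 1 with a < b ≤ c < k,
-- that is, a < b < c + 1 below k + 1. `pred` undoes the shifts.
alternatingCuts : ∀ {k} → AlternatingTriple k → Cuts (suc (k + k))
alternatingCuts {k} (inj₁ S) = cuts (v₀ + v₀) (suc (pred v₁ + pred v₁)) (pred v₂ + pred v₂)
  (lia (v₀ ∷ v₁ ∷ pred v₁ ∷ []) (λ a b p → a :< b ∷ con 1 :+ p :≡ b ∷ [] , a :+ a :< con 1 :+ (p :+ p)) v₀<v₁ (pred-< v₀<v₁))
  (lia (v₁ ∷ v₂ ∷ pred v₁ ∷ pred v₂ ∷ []) (λ b c p q → b :< c ∷ con 1 :+ p :≡ b ∷ con 1 :+ q :≡ c ∷ [] , con 1 :+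
    (p :+ p) :≤ q :+ q) v₁<v₂ (pred-< v₀<v₁) (pred-< v₁<v₂))
  (lia (v₂ ∷ pred v₂ ∷ k ∷ []) (λ c q k → c :< con 2 :+ k ∷ con 1 :+ q :≡ c ∷ [] , q :+ q :< con 1 :+ (k :+ k)) v₂<q (pred-< v₁<v₂))
  where open Triple S
alternatingCuts {k} (inj₂ S) = cuts (suc (v₀ + v₀)) (v₁ + v₁) (suc (pred v₂ + pred v₂))
  (lia (v₀ ∷ v₁ ∷ []) (λ a b → a :< b ∷ [] , con 1 :+ (a :+ a) :< b :+ b) v₀<v₁)
  (lia (v₁ ∷ v₂ ∷ pred v₂ ∷ []) (λ b c q → b :< c ∷ con 1 :+ q :≡ c ∷ [] , b :+ b :≤ con 1 :+ (q :+ q)) v₁<v₂ (pred-< v₁<v₂))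
  (lia (v₂ ∷ pred v₂ ∷ k ∷ []) (λ c q k → c :< con 1 :+ k ∷ con 1 :+ q :≡ c ∷ [] , con 1 :+ (q :+ q) :< con 1 :+ (k :+ k)) v₂<q (pred-< v₁<v₂))
  where open Triple S

alternatingCuts-alternating : ∀ {k} (p : AlternatingTriple k) → Alternating (alternatingCuts p)
alternatingCuts-alternating {k} (inj₁ S) = (v₀ + pred v₂ , lia (v₀ ∷ pred v₂ ∷ []) (λ a q → [] , a :+ a :+ (q :+ q) :≡ a :+ q :+ (a :+ q))) ,
  (suc (k + v₀ + pred v₁) , lia (k ∷ v₀ ∷ pred v₁ ∷ [])
    (λ k a p → [] , con 1 :+ (k :+ k) :+ (a :+ a) :+ (con 1 :+ (p :+ p)) :≡ con 1 :+ (k :+ a :+ p) :+ (con 1 :+ (k :+ a :+ p))))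
  where open Triple S
alternatingCuts-alternating {k} (inj₂ S) =
    (suc (v₀ + pred v₂) , lia (v₀ ∷ pred v₂ ∷ [])
      (λ a q → [] , con 1 :+ (a :+ a) :+ (con 1 :+ (q :+ q)) :≡ con 1 :+ (a :+ q) :+ (con 1 :+ (a :+ q)))) ,
  (suc (k + v₀ + v₁) , lia (k ∷ v₀ ∷ v₁ ∷ [])
    (λ k a p → [] , con 1 :+ (k :+ k) :+ (con 1 :+ (a :+ a)) :+ (p :+ p) :≡ con 1 :+ (k :+ a :+ p) :+ (con 1 :+ (k :+ a :+ p))))
  where open Triple S

alternatingCuts-injective : ∀ {k} (p q : AlternatingTriple k) → alternatingCuts p ≡ alternatingCuts q → p ≡ q
alternatingCuts-injective (inj₁ S) (inj₁ S′) e = cong inj₁ (triple-ext {S = S} {S′} (double-injective _ _ (cong t₁ e))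
  (pred-injective (Triple.v₀<v₁ S) (Triple.v₀<v₁ S′) (double-injective _ _ (suc-injective (cong t₂ e))))
  (pred-injective (Triple.v₁<v₂ S) (Triple.v₁<v₂ S′) (double-injective _ _ (cong t₃ e))))
alternatingCuts-injective (inj₂ S) (inj₂ S′) e = cong inj₂ (triple-ext {S = S} {S′} (double-injective _ _ (suc-injective (cong t₁ e)))
  (double-injective _ _ (cong t₂ e))
  (pred-injective (Triple.v₁<v₂ S) (Triple.v₁<v₂ S′) (double-injective _ _ (suc-injective (cong t₃ e)))))
alternatingCuts-injective (inj₁ S) (inj₂ S′) e = ⊥-elim (even≢odd (Triple.v₀ S) (Triple.v₀ S′) (cong t₁ e))
alternatingCuts-injective (inj₂ S) (inj₁ S′) e = ⊥-elim (even≢odd (Triple.v₀ S′) (Triple.v₀ S) (sym (cong t₁ e)))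

alternatingCuts-surjective : ∀ {k} (c : Cuts (suc (k + k))) → Alternating c → ∃ λ p → c ≡ alternatingCuts p
alternatingCuts-surjective {k} (cuts x y w x<y y≤w w<N) ((u , eu) , (v , ev)) = go (evenOrOdd x) (evenOrOdd y) (evenOrOdd w)
  where
  Result = ∃ λ p → cuts x y w x<y y≤w w<N ≡ alternatingCuts p
  first-last : ∀ a c → x ≡ a + a → w ≡ suc (c + c) → ⊥
  first-last a c e f = even≢odd u (a + c) (lia (x ∷ w ∷ a ∷ c ∷ u ∷ [])
      (λ x w a c u → x :≡ a :+ a ∷ w :≡ con 1 :+ (c :+ c) ∷ x :+ w :≡ u :+ u ∷ [] , u :+ u :≡ con 1 :+ (a :+ c :+ (a :+ c))) e f eu)
  last-first : ∀ a c → x ≡ suc (a + a) → w ≡ c + c → ⊥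
  last-first a c e f = even≢odd u (a + c) (lia (x ∷ w ∷ a ∷ c ∷ u ∷ [])
      (λ x w a c u → x :≡ con 1 :+ (a :+ a) ∷ w :≡ c :+ c ∷ x :+ w :≡ u :+ u ∷ [] , u :+ u :≡ con 1 :+ (a :+ c :+ (a :+ c))) e f eu)
  both-even : ∀ a b → x ≡ a + a → y ≡ b + b → ⊥
  both-even a b e f = even≢odd v (k + a + b)
      (lia (x ∷ y ∷ a ∷ b ∷ v ∷ k ∷ []) (λ x y a b v k → x :≡ a :+ a ∷ y :≡ b :+ b ∷ con 1 :+ (k :+ k) :+ x :+ y :≡ v :+ v ∷ [] ,
    v :+ v :≡ con 1 :+ (k :+ a :+ b :+ (k :+ a :+ b))) e f ev)
  both-odd : ∀ a b → x ≡ suc (a + a) → y ≡ suc (b + b) → ⊥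
  both-odd a b e f = even≢odd v (suc (k + a + b))
      (lia (x ∷ y ∷ a ∷ b ∷ v ∷ k ∷ []) (λ x y a b v k → x :≡ con 1 :+ (a :+ a) ∷ y :≡ con 1 :+ (b :+ b) ∷ con 1 :+
        (k :+ k) :+ x :+ y :≡ v :+ v ∷ [] ,
    v :+ v :≡ con 1 :+ (con 1 :+ (k :+ a :+ b) :+ (con 1 :+ (k :+ a :+ b)))) e f ev)
  go : EvenOrOdd x → EvenOrOdd y → EvenOrOdd w → Result
  go (inj₁ (a , e)) (inj₂ (b , f)) (inj₁ (c , g)) with triple {suc (suc k)} {a} {suc b} {suc c}
      (lia (x ∷ y ∷ a ∷ b ∷ []) (λ x y a b → x :≡ a :+ a ∷ y :≡ con 1 :+ (b :+ b) ∷ x :< y ∷ [] , a :< con 1 :+ b) e f x<y)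
      (bound b c f g) (lia (w ∷ c ∷ k ∷ []) (λ w c k → w :≡ c :+ c ∷ w :< con 1 :+ (k :+ k) ∷ [] , con 1 :+ c :< con 2 :+ k) g w<N)
    where
    bound : ∀ b c → y ≡ suc (b + b) → w ≡ c + c → suc b < suc c
    bound b c f g = ≰⇒> λ le → ⊥-elim (lia (y ∷ w ∷ b ∷ c ∷ [])
        (λ y w b c → y :≡ con 1 :+ (b :+ b) ∷ w :≡ c :+ c ∷ y :≤ w ∷ con 1 :+ c :≤ con 1 :+ b ∷ [] , :⊥) f g y≤w le)
  ... | S , p , q , r = inj₁ S , cuts-ext (trans e (sym (cong₂ _+_ p p)))
      (trans f (sym (cong suc (cong₂ _+_ (cong pred q) (cong pred q))))) (trans g (sym (cong₂ _+_ (cong pred r) (cong pred r))))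
  go (inj₂ (a , e)) (inj₁ (b , f)) (inj₂ (c , g)) with triple {suc k} {a} {b} {suc c}
      (lia₁ a b e f) (lia₂ b c f g) (lia₃ c g)
    where
    lia₁ : ∀ a b → x ≡ suc (a + a) → y ≡ b + b → a < b
    lia₁ a b e f = lia (x ∷ y ∷ a ∷ b ∷ []) (λ x y a b → x :≡ con 1 :+ (a :+ a) ∷ y :≡ b :+ b ∷ x :< y ∷ [] , a :< b) e f x<y
    lia₂ : ∀ b c → y ≡ b + b → w ≡ suc (c + c) → b < suc c
    lia₂ b c f g = ≰⇒> λ le → ⊥-elim (lia (y ∷ w ∷ b ∷ c ∷ [])
        (λ y w b c → y :≡ b :+ b ∷ w :≡ con 1 :+ (c :+ c) ∷ y :≤ w ∷ con 1 :+ c :≤ b ∷ [] , :⊥) f g y≤w le)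
    lia₃ : ∀ c → w ≡ suc (c + c) → suc c < suc k
    lia₃ c g = ≰⇒> λ le → ⊥-elim (lia (w ∷ c ∷ k ∷ [])
        (λ w c k → w :≡ con 1 :+ (c :+ c) ∷ w :< con 1 :+ (k :+ k) ∷ con 1 :+ k :≤ con 1 :+ c ∷ [] , :⊥) g w<N le)
  ... | S , p , q , r = inj₂ S , cuts-ext (trans e (sym (cong suc (cong₂ _+_ p p)))) (trans f (sym (cong₂ _+_ q q)))
      (trans g (sym (cong suc (cong₂ _+_ (cong pred r) (cong pred r)))))
  go (inj₁ (a , e)) _ (inj₂ (c , g)) = ⊥-elim (first-last a c e g)
  go (inj₂ (a , e)) _ (inj₁ (c , g)) = ⊥-elim (last-first a c e g)
  go (inj₁ (a , e)) (inj₁ (b , f)) _ = ⊥-elim (both-even a b e f)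
  go (inj₂ (a , e)) (inj₂ (b , f)) _ = ⊥-elim (both-odd a b e f)

alternatingTriples-unique : ∀ k → Unique (alternatingTriples k)
alternatingTriples-unique k = UP.++⁺ (UP.map⁺ (λ { refl → refl }) (subsets-unique 3 (suc (suc k))))
    (UP.map⁺ (λ { refl → refl }) (subsets-unique 3 (suc k)))
  λ (p , q) → disjoint (∈P.∈-map⁻ inj₁ p) (∈P.∈-map⁻ inj₂ q)
  where
  disjoint : ∀ {x : AlternatingTriple k} → (∃ λ S → S ∈ subsets 3 (suc (suc k)) × x ≡ inj₁ S) → (∃ λ S → S ∈ subsets 3 (suc k) × x ≡ inj₂ S) → ⊥
  disjoint (_ , _ , refl) (_ , _ , ())

alternatingTriples-complete : ∀ k (p : AlternatingTriple k) → p ∈ alternatingTriples k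
alternatingTriples-complete k (inj₁ S) = ∈P.∈-++⁺ˡ (∈P.∈-map⁺ inj₁ (subsets-complete S))
alternatingTriples-complete k (inj₂ S) = ∈P.∈-++⁺ʳ (map inj₁ (subsets 3 (suc (suc k)))) (∈P.∈-map⁺ inj₂ (subsets-complete S))

length-alternatingTriples : ∀ k → length (alternatingTriples k) ≡ (suc (suc k) C 3) + (suc k C 3)
length-alternatingTriples k = trans (LP.length-++ (map inj₁ (subsets 3 (suc (suc k)))))
  (cong₂ _+_ (trans (LP.length-map inj₁ (subsets 3 (suc (suc k)))) (length-subsets 3 (suc (suc k))))
    (trans (LP.length-map inj₂ (subsets 3 (suc k))) (length-subsets 3 (suc k))))

length-goods₁ : ∀ k → length (goods (suc (k + k)) k) ≡ (suc (suc k) C 3) + (suc k C 3)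
length-goods₁ k = trans (goods-count (λ p → halved (M p)) (alternatingTriples-unique k) (alternatingTriples-complete k)
    (λ p → Doubling.valid⇒good₁ (proj₂ (D p)) refl (matching-valid L≡ (alternatingCuts p)))
    (λ p q h → alternatingCuts-injective p q (matching-injective L≡ (same (proj₂ (D p)) (proj₂ (D q)) h)))
    surj) (length-alternatingTriples k)
  where
  m = suc (k + k)
  L≡ = *2≡+ m
  M : AlternatingTriple k → Fun (m * 2)
  M p = matching L≡ (alternatingCuts p)
  D : ∀ p → ∃ λ h → Doubling (halved (M p)) h (M p)
  D p = halving (matching-valid L≡ (alternatingCuts p)) (alternating⁺ L≡ (alternatingCuts p) (alternatingCuts-alternating p))
  same : ∀ {g h g′ h′ : Fun m} {M M′} → Doubling g h M → Doubling g′ h′ M′ → (∀ i → g i ≡ g′ i) → ∀ x → M x ≡ M′ x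
  same {g} {h} {g′} {h′} E E′ eq x with half {m} x
  ... | isEven i = trans (Doubling.M-even E i) (trans (cong oddF (eq i)) (sym (Doubling.M-even E′ i)))
  -- The values at odd points follow from g as well, because h is its inverse.
  ... | isOdd i = trans (Doubling.M-odd E i)
      (trans (cong evenF (Doubling.g-perm E _ _ (trans (Doubling.gh E i) (sym (trans (eq (h′ i)) (Doubling.gh E′ i)))))) (sym (Doubling.M-odd E′ i)))
  surj : ∀ g → Good k g → ∃ λ p → ∀ i → g i ≡ halved (M p) i
  surj g G@(pg , _) = find (matching-surjective L≡ (Doubling.good⇒valid₁ E G))
    where
    g⁻¹ = Perm.f⁻¹ pg
    E : Doubling g g⁻¹ (doubled g g⁻¹)
    E = doubling (Perm.f-f⁻¹ pg) (Perm.f⁻¹-f pg)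
    finish : ∀ c → (∀ x → doubled g g⁻¹ x ≡ matching L≡ c x) → (∃ λ p → c ≡ alternatingCuts p) → ∃ λ p → ∀ i → g i ≡ halved (M p) i
    finish c h (p , e) = p , λ i → odd-injective {m}
        (trans (sym (doubled-even g g⁻¹ i)) (trans (h (evenF i)) (trans (cong (λ d → matching L≡ d (evenF i)) e) (Doubling.M-even (proj₂ (D p)) i))))
    find : (∃ λ c → ∀ x → doubled g g⁻¹ x ≡ matching L≡ c x) → ∃ λ p → ∀ i → g i ≡ halved (M p) i
    find (c , h) = finish c h (alternatingCuts-surjective c
        (alternating⁻ L≡ c λ x → subst (λ y → ∃ λ d → toℕ x + toℕ y ≡ suc (d + d)) (h x) (Doubling.odd-sum E x)))

-- Binomial identities and the final counts

pascal : ∀ n k → suc n C suc k ≡ n C k + n C suc k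
pascal n k = sym (CP.nCk+nC[k+1]≡[n+1]C[k+1] n k)

r₀ : ∀ n k → rj 0 (suc n) (suc k) ≡ (suc n C (2 * suc k)) * ((suc k + 1) C 3)
r₀ n k = trans (rj-goods 0 n k (lia (k ∷ []) (λ k → [] , con 1 :+ k :+ (con 1 :+ k) :≡ 2 :* (con 1 :+ k) :+ con 0)))
  (cong₂ (λ m l → (suc n C m) * l) (lia (k ∷ []) (λ k → [] , con 1 :+ k :+ (con 1 :+ k) :≡ 2 :* (con 1 :+ k)))
    (trans (length-goods₀ k) (cong (_C 3) (+-comm 1 (suc k)))))

r₁ : ∀ n k → rj 1 (suc n) (suc k) ≡ (suc n C (2 * suc k + 1)) * (((suc k + 2) C 3) + ((suc k + 1) C 3))
r₁ n k = trans (rj-goods 1 n k size) (cong₂ (λ m l → (suc n C m) * l) size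
    (trans (length-goods₁ (suc k)) (cong₂ (λ a b → (a C 3) + (b C 3)) (+-comm 2 (suc k)) (+-comm 1 (suc k)))))
  where
  size : suc (suc k + suc k) ≡ 2 * suc k + 1
  size = lia (k ∷ []) (λ k → [] , con 1 :+ (con 1 :+ k :+ (con 1 :+ k)) :≡ 2 :* (con 1 :+ k) :+ con 1)

r₂ : ∀ n k → rj 2 (suc n) (suc k) ≡ (suc n C (2 * suc k + 2)) * ((suc k + 2) C 3)
r₂ n k = trans (rj-goods 2 n k size) (cong₂ (λ m l → (suc n C m) * l) size (trans (length-goods₂ (suc k)) (cong (_C 3) (+-comm 2 (suc k)))))
  where
  size : suc (suc k) + suc (suc k) ≡ 2 * suc k + 2
  size = lia (k ∷ []) (λ k → [] , con 2 :+ k :+ (con 2 :+ k) :≡ 2 :* (con 1 :+ k) :+ con 2)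

-- With a, b, c the three consecutive binomials of n, splitting `w` leaves the coefficient a + 2b +
-- c of d, which is Pascal's rule applied twice, and b + c of e, which is Pascal's rule applied
-- once.
regroup : ∀ a b c d e {x y w} → x ≡ (a + b) + (b + c) → y ≡ b + c → w ≡ e + d → a * d + b * (w + d) + c * w ≡ x * d + y * e
regroup a b c d e refl refl refl = solve 5
    (λ a b c d e → a ⊗ d ⊕ b ⊗ ((e ⊕ d) ⊕ d) ⊕ c ⊗ (e ⊕ d) := ((a ⊕ b) ⊕ (b ⊕ c)) ⊗ d ⊕ (b ⊕ c) ⊗ e) refl a b c d e
  where open +-*-Solver using (solve; _:=_) renaming (_:+_ to _⊕_; _:*_ to _⊗_)

pascal′ : ∀ n k → (n + 1) C (k + 1) ≡ n C k + n C (k + 1)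
pascal′ n k = trans (cong₂ _C_ (+-comm n 1) (+-comm k 1)) (trans (pascal n k) (cong (λ w → n C k + n C w) (+-comm 1 k)))

r-total : ∀ n k →
  (n C (2 * k)) * ((k + 1) C 3) + (n C (2 * k + 1)) * (((k + 2) C 3) + ((k + 1) C 3)) + (n C (2 * k + 2)) * ((k + 2) C 3)
  ≡ ((n + 2) C (2 * k + 2)) * ((k + 1) C 3) + ((n + 1) C (2 * k + 2)) * ((k + 1) C 2)
r-total n k = regroup (n C (2 * k)) (n C (2 * k + 1)) (n C (2 * k + 2)) ((k + 1) C 3) ((k + 1) C 2)
  (trans (cong₂ _C_ (sym (+-assoc n 1 1)) 2k+2) (trans (pascal′ (n + 1) (2 * k + 1)) (cong₂ _+_ (pascal′ n (2 * k)) step)))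
  (trans (cong ((n + 1) C_) 2k+2) step)
  (trans (cong (_C 3) (sym (+-assoc k 1 1))) (pascal′ (k + 1) 2))
  where
  2k+2 : 2 * k + 2 ≡ 2 * k + 1 + 1
  2k+2 = sym (+-assoc (2 * k) 1 1)
  step : (n + 1) C (2 * k + 1 + 1) ≡ n C (2 * k + 1) + n C (2 * k + 2)
  step = trans (pascal′ n (2 * k + 1)) (cong (λ w → n C (2 * k + 1) + n C w) (sym 2k+2))

theorem4p4 : (n k : ℕ) → 1 ≤ n → 1 ≤ k →
    (rStar n k ≡ ((n + 2) C (2 * k + 2)) * ((k + 1) C 3) + ((n + 1) C (2 * k + 2)) * ((k + 1) C 2))
    × (rj 0 n k ≡ (n C (2 * k)) * ((k + 1) C 3))
    × (rj 2 n k ≡ (n C (2 * k + 2)) * ((k + 2) C 3))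
    × (rj 1 n k ≡ (n C (2 * k + 1)) * (((k + 2) C 3) + ((k + 1) C 3)))
theorem4p4 (suc n) (suc k) _ _ =
  trans (rStar-sum n (suc k)) (trans (cong₂ _+_ (cong₂ _+_ (r₀ n k) (r₁ n k)) (r₂ n k)) (r-total (suc n) (suc k))) , r₀ n k , r₂ n k , r₁ n k
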